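{- Let $k\in\{2,3,4\}$, let $i$ be an integer with $k\ge i\ge 1$, and let $n\ge 0$. Then \[ \sum_{n_1\geq \dots\geq n_{k-1}\geq n_k=0} q^{n_1^2+\dots+n_{k-1}^2 + n_i+\dots +n_{k-1}} \prod_{j=1}^{k-1} {2n- 2\sum_{l=1}^{j-1}n_l -n_j - n_{j+1} -2 \alpha_{ij} \brack n_j - n_{j+1}}'_q = \sum_{r=-\infty}^{\infty} (-1)^r q^{\frac{r( (2k+1)r + 2k-2i +1)}{2}} {2n\brack n - \frac{(2k+1)r}{2} + (2k-2i+1)\frac{(-1)^r-1}{4}}_q, \] where the left sum runs over integers $n_1\ge n_2\ge\dots\ge n_{k-1}\ge0$ with $n_k:=0$, and $n_i+\dots+n_{k-1}$ is $0$ when $i=k$. Furthermore, for $k\in\{2,3\}$ and $i\in\{1,2\}$, \[ CP_{(2k-i,i-1)}(n) = \frac{1}{(q;q)_{2n}} \sum_{r=-\infty}^{\infty} (-1)^r q^{\frac{r( (2k+1)r + 2k-2i +1)}{2}} {2n\brack n - \frac{(2k+1)r}{2} + (2k-2i+1)\frac{(-1)^r-1}{4}}_q. \]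
   Context: $\alpha_{ij}:=\max\{j-i+1,0\}$. $(a;q)_m=\prod_{j=0}^{m-1}(1-aq^j)$. For integers $a,b$, ${a\brack b}_q=\frac{(q;q)_a}{(q;q)_b(q;q)_{a-b}}$ if $0\le b\le a$ and $0$ otherwise; the modified coefficient ${a\brack b}'_q$ equals $1$ if $a<0$ and $b=0$, and equals ${a\brack b}_q$ otherwise. A cylindric partition with profile $(c_1,c_2)$ is a pair of partitions $(\lambda^{(1)},\lambda^{(2)})$ (parts in weakly decreasing order, $\lambda^{(i)}_j=0$ beyond the number of parts) with $\lambda^{(1)}_j\ge\lambda^{(2)}_{j+c_2}$ and $\lambda^{(2)}_j\ge\lambda^{(1)}_{j+c_1}$ for all $j\ge1$; its size is $|\lambda^{(1)}|+|\lambda^{(2)}|$. $CP_{(a,b)}(n)$ is the generating function $\sum q^{\text{size}}$ over cylindric partitions of profile $(a,b)$ in which each partition has at most $n$ parts, with $CP_{(a,b)}(0)=1$. -}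

module Defs where

open import Data.Bool using (Bool; true; false; if_then_else_; _∧_)
open import Data.Nat as ℕ using (ℕ; zero; suc; _∸_; _≡ᵇ_; _≤ᵇ_)
open import Data.Integer as ℤ using (ℤ; +_; -[1+_]; _/ℕ_)
open import Data.List using (List; []; _∷_; map; upTo; concatMap; foldr; length; filterᵇ; cartesianProduct)
open import Data.Product using (_×_; _,_)

-- Formal power series in q with integer coefficients: coefficient maps.

PS : Set
PS = ℕ → ℤ

sumℤ : List ℤ → ℤ
sumℤ = foldr ℤ._+_ (+ 0)

sumℕ : List ℕ → ℕ
sumℕ = foldr ℕ._+_ 0

fromTo : ℕ → ℕ → List ℕ
fromTo a b = map (a ℕ.+_) (upTo (suc b ∸ a))

0ₚ : PS
0ₚ _ = + 0

mono : ℕ → PS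
mono e m = if m ≡ᵇ e then + 1 else + 0

1ₚ : PS
1ₚ = mono 0

_+ₚ_ : PS → PS → PS
(f +ₚ g) m = f m ℤ.+ g m

_-ₚ_ : PS → PS → PS
(f -ₚ g) m = f m ℤ.- g m

_*ₚ_ : PS → PS → PS
(f *ₚ g) m = sumℤ (map (λ t → f t ℤ.* g (m ∸ t)) (upTo (suc m)))

scaleₚ : ℤ → PS → PS
scaleₚ c f m = c ℤ.* f m

prodₚ : List PS → PS
prodₚ = foldr _*ₚ_ 1ₚ

shiftₚ : ℕ → PS → PS
shiftₚ e f m = if e ≤ᵇ m then f (m ∸ e) else + 0

-- multiplication by q^e, e ∈ ℤ (coefficients at negative exponents are
-- discarded; only used for e ≥ 0)
shiftℤₚ : ℤ → PS → PS
shiftℤₚ (+ e) f = shiftₚ e f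
shiftℤₚ -[1+ e ] f m = f (m ℕ.+ suc e)

-- Multiplicative inverse of a power series with constant term 1:
-- c₀ = 1, c_n = - Σ_{k=1}^{n} f_k c_{n-k}.
-- invRev f n = [c_n, c_{n-1}, ..., c_0]
invRev : PS → ℕ → List ℤ
invRev f zero = + 1 ∷ []
invRev f (suc n) = ℤ.- (go 0 prev) ∷ prev
  where
  prev = invRev f n
  -- prev at position t holds c_{n-t}; pair it with f_{t+1}
  go : ℕ → List ℤ → ℤ
  go t [] = + 0
  go t (x ∷ xs) = f (suc t) ℤ.* x ℤ.+ go (suc t) xs

invₚ : PS → PS
invₚ f n with invRev f n
... | c ∷ _ = c
... | [] = + 0

qPoch : ℕ → PS
qPoch m = prodₚ (map (λ j → 1ₚ -ₚ mono (suc j)) (upTo m))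

qBinom : ℤ → ℤ → PS
qBinom (+ a) (+ b) with b ≤ᵇ a
... | true  = qPoch a *ₚ (invₚ (qPoch b) *ₚ invₚ (qPoch (a ∸ b)))
... | false = 0ₚ
qBinom (+ a) -[1+ b ] = 0ₚ
qBinom -[1+ a ] b = 0ₚ

qBinom' : ℤ → ℤ → PS
qBinom' -[1+ a ] (+ zero) = 1ₚ
qBinom' a b = qBinom a b

-- 1-indexed lookup with default 0: nth xs j = x_j, 0 beyond the length
nth : List ℕ → ℕ → ℕ
nth [] _ = 0
nth (x ∷ xs) zero = 0
nth (x ∷ xs) (suc zero) = x
nth (x ∷ xs) (suc (suc j)) = nth xs (suc j)

decr : ℕ → ℕ → List (List ℕ)
decr zero b = [] ∷ []
decr (suc len) b = concatMap (λ x → map (x ∷_) (decr len x)) (upTo (suc b))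

-- Left-hand side.
-- ns = [n_1, ..., n_{k-1}] (n_1 ≥ ... ≥ n_{k-1} ≥ 0), n_k = nth ns k = 0.

α : ℕ → ℕ → ℤ
α i j = + (suc j ∸ i)

lhsExp : ℕ → ℕ → List ℕ → ℕ
lhsExp k i ns = sumℕ (map (λ j → nth ns j ℕ.* nth ns j) (fromTo 1 (k ∸ 1)))
         ℕ.+ sumℕ (map (nth ns) (fromTo i (k ∸ 1)))

lhsTop : ℕ → ℕ → List ℕ → ℕ → ℤ
lhsTop i n ns j =
  + (2 ℕ.* n) ℤ.- + (2 ℕ.* sumℕ (map (nth ns) (fromTo 1 (j ∸ 1))))
  ℤ.- + nth ns j ℤ.- + nth ns (suc j) ℤ.- (+ 2) ℤ.* α i j

lhsTerm : ℕ → ℕ → ℕ → List ℕ → PS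
lhsTerm k i n ns =
  shiftₚ (lhsExp k i ns)
    (prodₚ (map (λ j → qBinom' (lhsTop i n ns j) (+ nth ns j ℤ.- + nth ns (suc j)))
                (fromTo 1 (k ∸ 1))))

-- Coefficient of q^m of the (infinite, summable) left-hand sum.  Tuples
-- with n_1 > m contribute nothing to this coefficient, since their term
-- carries the factor q^{n_1^2 + ...} with n_1^2 > m.
LHS : ℕ → ℕ → ℕ → PS
LHS k i n m = sumℤ (map (λ ns → lhsTerm k i n ns m) (decr (k ∸ 1) m))

sgn : ℤ → ℤ
sgn r = -[1+ 0 ] ℤ.^ ℤ.∣ r ∣

-- r((2k+1)r + 2k - 2i + 1)/2  (an integer)
rhsExp : ℕ → ℕ → ℤ → ℤ
rhsExp k i r = (r ℤ.* (+ (2 ℕ.* k ℕ.+ 1) ℤ.* r ℤ.+ (+ (2 ℕ.* k ℕ.+ 1) ℤ.- + (2 ℕ.* i)))) /ℕ 2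

-- n - (2k+1)r/2 + (2k-2i+1)((-1)^r - 1)/4  (an integer), computed as
-- (4n - 2(2k+1)r + (2k-2i+1)((-1)^r - 1)) / 4
rhsBot : ℕ → ℕ → ℕ → ℤ → ℤ
rhsBot k i n r =
  (+ (4 ℕ.* n) ℤ.- + (2 ℕ.* (2 ℕ.* k ℕ.+ 1)) ℤ.* r
    ℤ.+ (+ (2 ℕ.* k ℕ.+ 1) ℤ.- + (2 ℕ.* i)) ℤ.* (sgn r ℤ.- + 1)) /ℕ 4

rhsTerm : ℕ → ℕ → ℕ → ℤ → PS
rhsTerm k i n r = scaleₚ (sgn r) (shiftℤₚ (rhsExp k i r) (qBinom (+ (2 ℕ.* n)) (rhsBot k i n r)))

symRange : ℕ → List ℤ
symRange m = map (λ t → + t ℤ.- + m) (upTo (suc (2 ℕ.* m)))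

-- Coefficient of q^m of the bilateral sum over r ∈ ℤ.  Terms with |r| > m
-- contribute nothing to it since their exponent r((2k+1)r+2k-2i+1)/2 ≥ |r| > m.
RHS : ℕ → ℕ → ℕ → PS
RHS k i n m = sumℤ (map (λ r → rhsTerm k i n r m) (symRange m))

-- Cylindric partitions of profile (c₁, c₂), each partition with at most
-- n parts, encoded as weakly decreasing lists of length n (padded by 0).

allFromTo : ℕ → ℕ → (ℕ → Bool) → Bool
allFromTo a b p = foldr (λ x r → p x ∧ r) true (fromTo a b)

-- λ1_j ≥ λ2_{j+c₂} and λ2_j ≥ λ1_{j+c₁} for all j ≥ 1 (for j > n both
-- sides are 0, so checking 1 ≤ j ≤ n suffices)
isCylindric : ℕ → ℕ → ℕ → List ℕ → List ℕ → Bool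
isCylindric c₁ c₂ n l₁ l₂ =
  allFromTo 1 n (λ j → (nth l₂ (j ℕ.+ c₂) ≤ᵇ nth l₁ j) ∧ (nth l₁ (j ℕ.+ c₁) ≤ᵇ nth l₂ j))

-- coefficient of q^m of CP_{(c₁,c₂)}(n): number of such cylindric
-- partitions of size m (all parts of such a partition are ≤ m)
CP : ℕ → ℕ → ℕ → PS
CP c₁ c₂ n m = + length (filterᵇ ok (cartesianProduct (decr n m) (decr n m)))
  where
  ok : List ℕ × List ℕ → Bool
  ok (l₁ , l₂) = isCylindric c₁ c₂ n l₁ l₂ ∧ (sumℕ l₁ ℕ.+ sumℕ l₂ ≡ᵇ m)

{-# OPTIONS --safe #-}
-- Write T(u,v) for the Gaussian binomial [u+v ; u].
--
-- The right-hand side is the value at a = b = n of a signed sum H(a,b) of terms q^e T(a+s,b-s).  Each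
-- such term satisfies H(a,b) = H(a-1,b) + H(a,b-1) - (1-q^(a+b-1)) H(a-1,b-1), and the signs and
-- exponents are those of the reflection principle for the strip -c₂ ≤ a-b ≤ c₁ with (c₁,c₂) = (2k-i,i-1).
--
-- Cylindric partitions: let G(a,b) be the generating function of those with at most a and at most b
-- parts.  Subtracting 1 from all parts when all are positive, and inclusion-exclusion otherwise, give
-- (1-q^(a+b)) G(a,b) = G(a-1,b) + G(a,b-1) - G(a-1,b-1) inside the strip; on its boundary one of the two
-- last parts is the smallest part and a single term remains.  Hence (q;q)_(a+b) G(a,b) = H(a,b).
--
-- Multisums: if R(L,M) is a signed sum of terms q^e T(M-r,L+a) T(M+r,L-a), then by q-Pfaff–Saalschütz
-- the Burge transform Σ_x q^(x²) T(M-x,2L) R(L-x,x) is the sum of the same shape with a+r for a and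
-- e+r² for e, and by q-Vandermonde omitting the factor T(M-x,2L) turns the terms into T(L+a+r,L-a-r).
-- Starting from a sum of modulus 1, which is 1 for M = 0 and 0 otherwise, each index n_j with j < i is one
-- such transform.  For j ≥ i the transform has q^(x²+x) and L-1-x in place of q^(x²) and L-x; it applies after
-- rewriting R with terms q^e T(M-r,L+a) T(M+r+1,L+1-a), which Pascal's rule allows since the extra
-- terms cancel.
module Submission where

open import Defs
open import Algebra.Bundles using (CommutativeRing)
import Algebra.Properties.CommutativeSemigroup as CommutativeSemigroupProperties
open import Data.Bool using (true; false; Bool; _∧_; T)
import Data.Bool.Properties as Boolₚ
open import Data.Empty using (⊥-elim; ⊥)
import Data.Integer.DivMod as ℤ-DivMod
import Data.Integer.Properties as ℤₚ
open import Data.Integer.Tactic.RingSolver using (solve-∀)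
open import Data.List using (List; []; _∷_; map; upTo; applyUpTo; _++_; concatMap; foldr; length; filter; cartesianProduct)
import Data.List.Properties as Listₚ
open import Data.Nat as ℕ using (ℕ; zero; suc; _∸_; z≤n; s≤s; _≤ᵇ_; pred)
import Data.Nat.Properties as ℕₚ
import Data.Nat.Tactic.RingSolver as ℕ-Solver
open import Data.Product using (_,_; ∃; _×_; proj₁; proj₂)
open import Data.Sum using (_⊎_; inj₁; inj₂; [_,_]′)
open import Data.Unit using (⊤; tt)
open import Function using (_∘_; id; mk⇔; _⇔_; Equivalence)
open import Relation.Binary.PropositionalEquality using (_≡_; _≢_; refl; sym; trans; cong; cong₂; subst; _≗_; module ≡-Reasoning; subst₂)
import Relation.Binary.Reasoning.Setoid as SetoidReasoning
open import Relation.Nullary using (¬_; yes; no; Dec; ¬?; _×-dec_; contradiction)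
open import Relation.Unary using (Decidable)

-- The bilateral sums are cut off at |s| ≤ B with one B for all coefficients: the cutoff |r| ≤ m of
-- `RHS` changes with the coefficient and is therefore incompatible with products and shifts of
-- series. The truncated identities are exact, because the boundary terms of each reindexing vanish
-- once B is large compared with the parameters; B is chosen in terms of m and n at the very end.
-- The index r is split into 2s and 2s - 1, so that signs, halves and quarters disappear and
-- everything is polynomial in s. The other obstacle is that the inner sums run beyond x = L, where
-- the first parameter of the multisum is negative. There the bosonic sums are 0, whereas the
-- modified coefficients make the multisum equal to 1 for x = 0 and to 0 for x > 0. The two agree
-- for x > 0, and x = 0 occurs only if a shifted transform is applied at L = 0; this case is
-- computed separately, and it is the one for which the modified coefficients matter.

-- Formal power series: finite sums, ring laws, shifts, Pochhammer products, inverses.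

module PowerSeries where

  open import Data.Integer using (ℤ; +_; _+_; _*_; _-_; -_; 0ℤ; 1ℤ)

  +-congˡ : ∀ x {y z} → y ≡ z → x + y ≡ x + z
  +-congˡ x = cong (λ y → x + y)

  ∑ : ℕ → (ℕ → ℤ) → ℤ
  ∑ zero    f = 0ℤ
  ∑ (suc n) f = f 0 + ∑ n (f ∘ suc)

  ∑-cong : ∀ n {f g : ℕ → ℤ} → f ≗ g → ∑ n f ≡ ∑ n g
  ∑-cong zero    eq = refl
  ∑-cong (suc n) eq = cong₂ _+_ (eq 0) (∑-cong n (eq ∘ suc))

  ∑-cong-< : ∀ n {f g : ℕ → ℤ} → (∀ t → t ℕ.< n → f t ≡ g t) → ∑ n f ≡ ∑ n g
  ∑-cong-< zero    eq = refl
  ∑-cong-< (suc n) eq = cong₂ _+_ (eq 0 (s≤s z≤n)) (∑-cong-< n (λ t t<n → eq (suc t) (s≤s t<n)))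

  ∑-zero : ∀ n {f : ℕ → ℤ} → (∀ t → f t ≡ 0ℤ) → ∑ n f ≡ 0ℤ
  ∑-zero zero    eq = refl
  ∑-zero (suc n) eq = cong₂ _+_ (eq 0) (∑-zero n (eq ∘ suc))

  private
    interchange : ∀ a b c d → (a + b) + (c + d) ≡ (a + c) + (b + d)
    interchange = solve-∀

  ∑-+ : ∀ n (f g : ℕ → ℤ) → ∑ n (λ t → f t + g t) ≡ ∑ n f + ∑ n g
  ∑-+ zero    f g = refl
  ∑-+ (suc n) f g = trans (+-congˡ (f 0 + g 0) (∑-+ n (f ∘ suc) (g ∘ suc))) (interchange (f 0) (g 0) _ _)

  ∑-* : ∀ n c (f : ℕ → ℤ) → ∑ n (λ t → c * f t) ≡ c * ∑ n f
  ∑-* zero    c f = sym (ℤₚ.*-zeroʳ c)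
  ∑-* (suc n) c f = trans (+-congˡ (c * f 0) (∑-* n c (f ∘ suc))) (sym (ℤₚ.*-distribˡ-+ c (f 0) _))

  ∑-neg : ∀ n (f : ℕ → ℤ) → ∑ n (λ t → - f t) ≡ - ∑ n f
  ∑-neg zero    f = refl
  ∑-neg (suc n) f = trans (+-congˡ (- f 0) (∑-neg n (f ∘ suc))) (sym (ℤₚ.neg-distrib-+ (f 0) _))

  ∑-snoc : ∀ n (f : ℕ → ℤ) → ∑ (suc n) f ≡ ∑ n f + f n
  ∑-snoc zero    f = ℤₚ.+-comm (f 0) 0ℤ
  ∑-snoc (suc n) f = trans (+-congˡ (f 0) (∑-snoc n (f ∘ suc))) (sym (ℤₚ.+-assoc (f 0) _ _))

  ∑-swap : ∀ n k (f : ℕ → ℕ → ℤ) → ∑ n (λ s → ∑ k (f s)) ≡ ∑ k (λ t → ∑ n (λ s → f s t))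
  ∑-swap zero    k f = sym (∑-zero k (λ _ → refl))
  ∑-swap (suc n) k f = trans (+-congˡ (∑ k (f 0)) (∑-swap n k (f ∘ suc))) (sym (∑-+ k (f 0) _))

  ∑-extend : ∀ n k (f : ℕ → ℤ) → (∀ t → n ℕ.≤ t → f t ≡ 0ℤ) → ∑ (n ℕ.+ k) f ≡ ∑ n f
  ∑-extend zero    k f eq = ∑-zero k (λ t → eq t z≤n)
  ∑-extend (suc n) k f eq = +-congˡ (f 0) (∑-extend n k (f ∘ suc) (λ t n≤t → eq (suc t) (s≤s n≤t)))

  ∑-support : ∀ {n n′} (f : ℕ → ℤ) → n ℕ.≤ n′ → (∀ t → n ℕ.≤ t → f t ≡ 0ℤ) → ∑ n′ f ≡ ∑ n f
  ∑-support {n} {n′} f n≤n′ eq = subst (λ k → ∑ k f ≡ ∑ n f) (ℕₚ.m+[n∸m]≡n n≤n′) (∑-extend n (n′ ∸ n) f eq)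

  ∑-single : ∀ n k (f : ℕ → ℤ) → k ℕ.< n → (∀ t → t ≢ k → f t ≡ 0ℤ) → ∑ n f ≡ f k
  ∑-single (suc n) zero    f _         eq =
    trans (+-congˡ (f 0) (∑-zero n (λ t → eq (suc t) (λ ())))) (ℤₚ.+-identityʳ (f 0))
  ∑-single (suc n) (suc k) f (s≤s k<n) eq =
    trans (cong₂ _+_ (eq 0 (λ ())) (∑-single n k (f ∘ suc) k<n (λ t t≢k → eq (suc t) (t≢k ∘ ℕₚ.suc-injective))))
          (ℤₚ.+-identityˡ (f (suc k)))

  sumℤ-applyUpTo : ∀ (f : ℕ → ℤ) n → sumℤ (applyUpTo f n) ≡ ∑ n f
  sumℤ-applyUpTo f zero    = refl
  sumℤ-applyUpTo f (suc n) = +-congˡ (f 0) (sumℤ-applyUpTo (f ∘ suc) n)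

  sumℤ-upTo : ∀ (f : ℕ → ℤ) n → sumℤ (map f (upTo n)) ≡ ∑ n f
  sumℤ-upTo f n = trans (cong sumℤ (Listₚ.map-upTo f n)) (sumℤ-applyUpTo f n)

  sumℤ-++ : ∀ xs ys → sumℤ (xs ++ ys) ≡ sumℤ xs + sumℤ ys
  sumℤ-++ []       ys = sym (ℤₚ.+-identityˡ _)
  sumℤ-++ (x ∷ xs) ys = trans (+-congˡ (x) (sumℤ-++ xs ys)) (sym (ℤₚ.+-assoc x _ _))

  negₚ : PS → PS
  negₚ f m = - f m

  tail : PS → PS
  tail f = f ∘ suc

  conv : ∀ f g m → (f *ₚ g) m ≡ ∑ (suc m) (λ t → f t * g (m ∸ t))
  conv f g m = sumℤ-upTo (λ t → f t * g (m ∸ t)) (suc m)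

  conv-zero : ∀ f g → (f *ₚ g) 0 ≡ f 0 * g 0
  conv-zero f g = ℤₚ.+-identityʳ _

  -- This is the product rule for removing the constant term of the left factor. With it the ring
  -- laws are inductions on the coefficient, general in the series, and no double sum has to be
  -- reindexed.
  conv-suc : ∀ f g m → (f *ₚ g) (suc m) ≡ f 0 * g (suc m) + (tail f *ₚ g) m
  conv-suc f g m =
    trans (conv f g (suc m)) (+-congˡ (f 0 * g (suc m)) (sym (conv (tail f) g m)))

  *ₚ-cong : ∀ {f f′ g g′} → f ≗ f′ → g ≗ g′ → f *ₚ g ≗ f′ *ₚ g′
  *ₚ-cong f≗ g≗ m = cong sumℤ (Listₚ.map-cong (λ t → cong₂ _*_ (f≗ t) (g≗ (m ∸ t))) (upTo (suc m)))

  *ₚ-distribʳ : ∀ h f g → (f +ₚ g) *ₚ h ≗ (f *ₚ h) +ₚ (g *ₚ h)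
  *ₚ-distribʳ h f g zero = begin
    ((f +ₚ g) *ₚ h) 0              ≡⟨ conv-zero (f +ₚ g) h ⟩
    (f 0 + g 0) * h 0              ≡⟨ ℤₚ.*-distribʳ-+ (h 0) (f 0) (g 0) ⟩
    f 0 * h 0 + g 0 * h 0          ≡⟨ sym (cong₂ _+_ (conv-zero f h) (conv-zero g h)) ⟩
    (f *ₚ h) 0 + (g *ₚ h) 0        ∎
    where open ≡-Reasoning
  *ₚ-distribʳ h f g (suc m) = begin
    ((f +ₚ g) *ₚ h) (suc m)                                  ≡⟨ conv-suc (f +ₚ g) h m ⟩
    (f 0 + g 0) * h (suc m) + ((tail f +ₚ tail g) *ₚ h) m    ≡⟨ cong₂ _+_ (ℤₚ.*-distribʳ-+ (h (suc m)) (f 0) (g 0)) (*ₚ-distribʳ h (tail f) (tail g) m) ⟩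
    (f 0 * h (suc m) + g 0 * h (suc m)) + ((tail f *ₚ h) m + (tail g *ₚ h) m) ≡⟨ interchange (f 0 * h (suc m)) (g 0 * h (suc m)) _ _ ⟩
    (f 0 * h (suc m) + (tail f *ₚ h) m) + (g 0 * h (suc m) + (tail g *ₚ h) m) ≡⟨ sym (cong₂ _+_ (conv-suc f h m) (conv-suc g h m)) ⟩
    (f *ₚ h) (suc m) + (g *ₚ h) (suc m)                      ∎
    where open ≡-Reasoning

  *ₚ-comm : ∀ f g → f *ₚ g ≗ g *ₚ f
  *ₚ-comm f g zero = trans (conv-zero f g) (trans (ℤₚ.*-comm (f 0) (g 0)) (sym (conv-zero g f)))
  *ₚ-comm f g (suc zero) = begin
    (f *ₚ g) 1                     ≡⟨ trans (conv-suc f g 0) (+-congˡ (f 0 * g 1) (conv-zero (tail f) g)) ⟩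
    f 0 * g 1 + f 1 * g 0          ≡⟨ flip (f 0) (f 1) (g 0) (g 1) ⟩
    g 0 * f 1 + g 1 * f 0          ≡⟨ sym (trans (conv-suc g f 0) (+-congˡ (g 0 * f 1) (conv-zero (tail g) f))) ⟩
    (g *ₚ f) 1                     ∎
    where
    open ≡-Reasoning
    flip : ∀ a b c d → a * d + b * c ≡ c * b + d * a
    flip = solve-∀
  -- `conv-suc` opens only the left factor, so each factor is opened on its own side of an inductive
  -- swap. The induction therefore refers one and two steps back and needs two base cases.
  *ₚ-comm f g (suc (suc m)) = begin
    (f *ₚ g) (2 ℕ.+ m)                                                        ≡⟨ conv-suc f g (suc m) ⟩
    f 0 * g (2 ℕ.+ m) + (tail f *ₚ g) (suc m)                                 ≡⟨ +-congˡ (f 0 * g (2 ℕ.+ m)) (trans (*ₚ-comm (tail f) g (suc m)) (conv-suc g (tail f) m)) ⟩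
    f 0 * g (2 ℕ.+ m) + (g 0 * f (2 ℕ.+ m) + (tail g *ₚ tail f) m)            ≡⟨ cong (λ x → f 0 * g (2 ℕ.+ m) + (g 0 * f (2 ℕ.+ m) + x)) (*ₚ-comm (tail g) (tail f) m) ⟩
    f 0 * g (2 ℕ.+ m) + (g 0 * f (2 ℕ.+ m) + (tail f *ₚ tail g) m)            ≡⟨ swap₁ (f 0 * g (2 ℕ.+ m)) (g 0 * f (2 ℕ.+ m)) _ ⟩
    g 0 * f (2 ℕ.+ m) + (f 0 * g (2 ℕ.+ m) + (tail f *ₚ tail g) m)            ≡⟨ +-congˡ (g 0 * f (2 ℕ.+ m)) (trans (sym (conv-suc f (tail g) m)) (*ₚ-comm f (tail g) (suc m))) ⟩
    g 0 * f (2 ℕ.+ m) + (tail g *ₚ f) (suc m)                                 ≡⟨ sym (conv-suc g f (suc m)) ⟩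
    (g *ₚ f) (2 ℕ.+ m)                                                        ∎
    where
    open ≡-Reasoning
    swap₁ : ∀ a b c → a + (b + c) ≡ b + (a + c)
    swap₁ = solve-∀

  scale-* : ∀ c f g → scaleₚ c f *ₚ g ≗ scaleₚ c (f *ₚ g)
  scale-* c f g zero = trans (conv-zero (scaleₚ c f) g) (trans (ℤₚ.*-assoc c (f 0) (g 0)) (cong (c *_) (sym (conv-zero f g))))
  scale-* c f g (suc m) = begin
    (scaleₚ c f *ₚ g) (suc m)                                ≡⟨ conv-suc (scaleₚ c f) g m ⟩
    c * f 0 * g (suc m) + (scaleₚ c (tail f) *ₚ g) m         ≡⟨ cong₂ _+_ (ℤₚ.*-assoc c (f 0) _) (scale-* c (tail f) g m) ⟩
    c * (f 0 * g (suc m)) + c * (tail f *ₚ g) m              ≡⟨ sym (ℤₚ.*-distribˡ-+ c _ _) ⟩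
    c * (f 0 * g (suc m) + (tail f *ₚ g) m)                  ≡⟨ cong (c *_) (sym (conv-suc f g m)) ⟩
    c * (f *ₚ g) (suc m)                                     ∎
    where open ≡-Reasoning

  *ₚ-assoc : ∀ f g h → (f *ₚ g) *ₚ h ≗ f *ₚ (g *ₚ h)
  *ₚ-assoc f g h zero = begin
    ((f *ₚ g) *ₚ h) 0      ≡⟨ trans (conv-zero (f *ₚ g) h) (cong (_* h 0) (conv-zero f g)) ⟩
    f 0 * g 0 * h 0        ≡⟨ ℤₚ.*-assoc (f 0) (g 0) (h 0) ⟩
    f 0 * (g 0 * h 0)      ≡⟨ sym (trans (conv-zero f (g *ₚ h)) (cong (f 0 *_) (conv-zero g h))) ⟩
    (f *ₚ (g *ₚ h)) 0      ∎
    where open ≡-Reasoning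
  *ₚ-assoc f g h (suc m) = begin
    ((f *ₚ g) *ₚ h) (suc m)                                                       ≡⟨ conv-suc (f *ₚ g) h m ⟩
    -- `conv-suc f g` is used as an equation of series: the tail of `f *ₚ g` is f 0 times the tail
    -- of g, plus the product of the tail of f with g.
    (f *ₚ g) 0 * h (suc m) + (tail (f *ₚ g) *ₚ h) m                               ≡⟨ cong₂ (λ x y → x * h (suc m) + y) (conv-zero f g) (*ₚ-cong {g = h} (conv-suc f g) (λ _ → refl) m) ⟩
    f 0 * g 0 * h (suc m) + ((scaleₚ (f 0) (tail g) +ₚ (tail f *ₚ g)) *ₚ h) m     ≡⟨ cong₂ _+_ (ℤₚ.*-assoc (f 0) (g 0) _) (trans (*ₚ-distribʳ h (scaleₚ (f 0) (tail g)) (tail f *ₚ g) m) (cong₂ _+_ (scale-* (f 0) (tail g) h m) (*ₚ-assoc (tail f) g h m))) ⟩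
    f 0 * (g 0 * h (suc m)) + (f 0 * (tail g *ₚ h) m + (tail f *ₚ (g *ₚ h)) m)    ≡⟨ collect (f 0) (g 0 * h (suc m)) _ _ ⟩
    f 0 * (g 0 * h (suc m) + (tail g *ₚ h) m) + (tail f *ₚ (g *ₚ h)) m            ≡⟨ cong (λ x → f 0 * x + (tail f *ₚ (g *ₚ h)) m) (sym (conv-suc g h m)) ⟩
    f 0 * (g *ₚ h) (suc m) + (tail f *ₚ (g *ₚ h)) m                               ≡⟨ sym (conv-suc f (g *ₚ h) m) ⟩
    (f *ₚ (g *ₚ h)) (suc m)                                                       ∎
    where
    open ≡-Reasoning
    collect : ∀ a b c d → a * b + (a * c + d) ≡ a * (b + c) + d
    collect = solve-∀

  *ₚ-zeroˡ : ∀ {z} g → z ≗ 0ₚ → z *ₚ g ≗ 0ₚ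
  *ₚ-zeroˡ g eq m = trans (*ₚ-cong {g = g} eq (λ _ → refl) m) (trans (conv 0ₚ g m) (∑-zero (suc m) (λ _ → refl)))

  *ₚ-zeroʳ : ∀ {z} g → z ≗ 0ₚ → g *ₚ z ≗ 0ₚ
  *ₚ-zeroʳ {z} g eq m = trans (*ₚ-comm g z m) (*ₚ-zeroˡ g eq m)

  *ₚ-identityˡ : ∀ f → 1ₚ *ₚ f ≗ f
  *ₚ-identityˡ f zero    = trans (conv-zero 1ₚ f) (ℤₚ.*-identityˡ (f 0))
  *ₚ-identityˡ f (suc m) = trans (conv-suc 1ₚ f m)
    (trans (cong₂ _+_ (ℤₚ.*-identityˡ (f (suc m))) (*ₚ-zeroˡ f (λ _ → refl) m)) (ℤₚ.+-identityʳ _))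

  *ₚ-identityʳ : ∀ f → f *ₚ 1ₚ ≗ f
  *ₚ-identityʳ f m = trans (*ₚ-comm f 1ₚ m) (*ₚ-identityˡ f m)

  *ₚ-distribˡ : ∀ h f g → h *ₚ (f +ₚ g) ≗ (h *ₚ f) +ₚ (h *ₚ g)
  *ₚ-distribˡ h f g m = trans (*ₚ-comm h (f +ₚ g) m)
    (trans (*ₚ-distribʳ h f g m) (cong₂ _+_ (*ₚ-comm f h m) (*ₚ-comm g h m)))

  psRing : CommutativeRing _ _
  psRing = record
    { Carrier = PS ; _≈_ = _≗_ ; _+_ = _+ₚ_ ; _*_ = _*ₚ_ ; -_ = negₚ ; 0# = 0ₚ ; 1# = 1ₚ
    ; isCommutativeRing = record
      { isRing = record
        { +-isAbelianGroup = record
          { isGroup = record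
            { isMonoid = record
              { isSemigroup = record
                { isMagma = record
                  { isEquivalence = record
                    { refl = λ _ → refl ; sym = λ eq m → sym (eq m) ; trans = λ p q m → trans (p m) (q m) }
                  ; ∙-cong = λ p q m → cong₂ _+_ (p m) (q m) }
                ; assoc = λ f g h m → ℤₚ.+-assoc (f m) (g m) (h m) }
              ; identity = (λ f m → ℤₚ.+-identityˡ (f m)) , (λ f m → ℤₚ.+-identityʳ (f m)) }
            ; inverse = (λ f m → ℤₚ.+-inverseˡ (f m)) , (λ f m → ℤₚ.+-inverseʳ (f m))
            ; ⁻¹-cong = λ p m → cong -_ (p m) }
          ; comm = λ f g m → ℤₚ.+-comm (f m) (g m) }
        ; *-cong = *ₚ-cong
        ; *-assoc = *ₚ-assoc
        ; *-identity = *ₚ-identityˡ , *ₚ-identityʳ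
        ; distrib = *ₚ-distribˡ , *ₚ-distribʳ }
      ; *-comm = *ₚ-comm } }

  module *ₚ-Properties = CommutativeSemigroupProperties (CommutativeRing.*-commutativeSemigroup psRing)
  module ≗-Reasoning = SetoidReasoning (CommutativeRing.setoid psRing)

  ≗-refl : {f : PS} → f ≗ f
  ≗-refl _ = refl

  ≗-sym : {f g : PS} → f ≗ g → g ≗ f
  ≗-sym eq m = sym (eq m)

  -- The Boolean test inside `shiftₚ` reduces only when `e` is a constructor; the inductions on a
  -- shift all pass through this equation.
  shift-suc : ∀ e f m → shiftₚ (suc e) f (suc m) ≡ shiftₚ e f m
  shift-suc zero    f m = refl
  shift-suc (suc e) f m = refl

  shift-cong : ∀ e {f g} → f ≗ g → shiftₚ e f ≗ shiftₚ e g
  shift-cong zero    eq m       = eq m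
  shift-cong (suc e) eq zero    = refl
  shift-cong (suc e) {f} {g} eq (suc m) = trans (shift-suc e f m) (trans (shift-cong e eq m) (sym (shift-suc e g m)))

  shift-+ : ∀ e f g → shiftₚ e (f +ₚ g) ≗ shiftₚ e f +ₚ shiftₚ e g
  shift-+ zero    f g m       = refl
  shift-+ (suc e) f g zero    = refl
  shift-+ (suc e) f g (suc m) = trans (shift-suc e (f +ₚ g) m)
    (trans (shift-+ e f g m) (sym (cong₂ _+_ (shift-suc e f m) (shift-suc e g m))))

  shift-neg : ∀ e f → shiftₚ e (negₚ f) ≗ negₚ (shiftₚ e f)
  shift-neg zero    f m       = refl
  shift-neg (suc e) f zero    = refl
  shift-neg (suc e) f (suc m) = trans (shift-suc e (negₚ f) m) (trans (shift-neg e f m) (cong -_ (sym (shift-suc e f m))))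

  shift-shift : ∀ a b f → shiftₚ a (shiftₚ b f) ≗ shiftₚ (a ℕ.+ b) f
  shift-shift zero    b f m       = refl
  shift-shift (suc a) b f zero    = refl
  shift-shift (suc a) b f (suc m) = trans (shift-suc a (shiftₚ b f) m)
    (trans (shift-shift a b f m) (sym (shift-suc (a ℕ.+ b) f m)))

  shift-*ˡ : ∀ e f g → shiftₚ e f *ₚ g ≗ shiftₚ e (f *ₚ g)
  shift-*ˡ zero    f g m       = refl
  shift-*ˡ (suc e) f g zero    = conv-zero (shiftₚ (suc e) f) g
  shift-*ˡ (suc e) f g (suc m) = begin
    (shiftₚ (suc e) f *ₚ g) (suc m)                ≡⟨ conv-suc (shiftₚ (suc e) f) g m ⟩
    0ℤ + (tail (shiftₚ (suc e) f) *ₚ g) m          ≡⟨ ℤₚ.+-identityˡ _ ⟩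
    (tail (shiftₚ (suc e) f) *ₚ g) m               ≡⟨ *ₚ-cong {g = g} (shift-suc e f) ≗-refl m ⟩
    (shiftₚ e f *ₚ g) m                            ≡⟨ shift-*ˡ e f g m ⟩
    shiftₚ e (f *ₚ g) m                            ≡⟨ sym (shift-suc e (f *ₚ g) m) ⟩
    shiftₚ (suc e) (f *ₚ g) (suc m)                ∎
    where open ≡-Reasoning

  shift-*ʳ : ∀ e f g → f *ₚ shiftₚ e g ≗ shiftₚ e (f *ₚ g)
  shift-*ʳ e f g m = trans (*ₚ-comm f (shiftₚ e g) m) (trans (shift-*ˡ e g f m) (shift-cong e (*ₚ-comm g f) m))

  mono-shift : ∀ e → mono e ≗ shiftₚ e 1ₚ
  mono-shift zero    m       = refl
  mono-shift (suc e) zero    = refl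
  mono-shift (suc e) (suc m) = trans (mono-shift e m) (sym (shift-suc e 1ₚ m))

  -- Multiplication by 1 - qⁿ
  diff : ℕ → PS → PS
  diff n f = f -ₚ shiftₚ n f

  diff-cong : ∀ n {f g} → f ≗ g → diff n f ≗ diff n g
  diff-cong n eq m = cong₂ _-_ (eq m) (shift-cong n eq m)

  neg-*ˡ : ∀ f g → negₚ f *ₚ g ≗ negₚ (f *ₚ g)
  neg-*ˡ f g m = trans (conv (negₚ f) g m) (trans (∑-cong (suc m) (λ t → sym (ℤₚ.neg-distribˡ-* (f t) (g (m ∸ t)))))
    (trans (∑-neg (suc m) (λ t → f t * g (m ∸ t))) (cong -_ (sym (conv f g m)))))

  diff-*ˡ : ∀ n f g → diff n f *ₚ g ≗ diff n (f *ₚ g)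
  diff-*ˡ n f g m = trans (*ₚ-distribʳ g f (negₚ (shiftₚ n f)) m)
    (+-congˡ ((f *ₚ g) m) (trans (neg-*ˡ (shiftₚ n f) g m) (cong -_ (shift-*ˡ n f g m))))

  diff-*ʳ : ∀ n f g → f *ₚ diff n g ≗ diff n (f *ₚ g)
  diff-*ʳ n f g m = trans (*ₚ-comm f (diff n g) m) (trans (diff-*ˡ n g f m) (diff-cong n (*ₚ-comm g f) m))

  prodₚ-∷ʳ : ∀ fs g → prodₚ (fs ++ g ∷ []) ≗ g *ₚ prodₚ fs
  prodₚ-∷ʳ []       g = ≗-refl
  prodₚ-∷ʳ (f ∷ fs) g = begin
    f *ₚ prodₚ (fs ++ g ∷ [])   ≈⟨ *ₚ-cong {f} {f} ≗-refl (prodₚ-∷ʳ fs g) ⟩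
    f *ₚ (g *ₚ prodₚ fs)        ≈⟨ *ₚ-Properties.x∙yz≈y∙xz f g (prodₚ fs) ⟩
    g *ₚ (f *ₚ prodₚ fs)        ∎
    where open ≗-Reasoning

  -- The new factor is the last entry of the list and hence innermost in the right fold; it has to
  -- be commuted out.
  qPoch-suc : ∀ n → qPoch (suc n) ≗ diff (suc n) (qPoch n)
  qPoch-suc n = begin
    qPoch (suc n)                                     ≡⟨ cong (prodₚ ∘ map _) (sym (Listₚ.upTo-∷ʳ n)) ⟩
    prodₚ (map _ (upTo n ++ n ∷ []))                  ≡⟨ cong prodₚ (Listₚ.map-++ _ (upTo n) (n ∷ [])) ⟩
    prodₚ (map _ (upTo n) ++ (1ₚ -ₚ mono (suc n)) ∷ []) ≈⟨ prodₚ-∷ʳ (map _ (upTo n)) _ ⟩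
    (1ₚ -ₚ mono (suc n)) *ₚ qPoch n                   ≈⟨ *ₚ-cong {g = qPoch n} (λ m → cong (λ x → 1ₚ m - x) (mono-shift (suc n) m)) ≗-refl ⟩
    diff (suc n) 1ₚ *ₚ qPoch n                        ≈⟨ diff-*ˡ (suc n) 1ₚ (qPoch n) ⟩
    diff (suc n) (1ₚ *ₚ qPoch n)                      ≈⟨ diff-cong (suc n) (*ₚ-identityˡ (qPoch n)) ⟩
    diff (suc n) (qPoch n)                            ∎
    where open ≗-Reasoning

  qPoch-const : ∀ n → qPoch n 0 ≡ 1ℤ
  qPoch-const zero    = refl
  qPoch-const (suc n) = trans (qPoch-suc n 0) (trans (ℤₚ.+-identityʳ _) (qPoch-const n))

  qPoch-suc-* : ∀ n f → qPoch (suc n) *ₚ f ≗ diff (suc n) (qPoch n *ₚ f)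
  qPoch-suc-* n f m = trans (*ₚ-cong {g = f} (qPoch-suc n) ≗-refl m) (diff-*ˡ (suc n) (qPoch n) f m)

  private
    dot : PS → ℕ → List ℤ → ℤ
    dot f t []       = 0ℤ
    dot f t (x ∷ xs) = f (suc t) * x + dot f (suc t) xs

    dot-unique : ∀ f (g : ℕ → List ℤ → ℤ) → (∀ t → g t [] ≡ 0ℤ) →
      (∀ t x xs → g t (x ∷ xs) ≡ f (suc t) * x + g (suc t) xs) → ∀ t xs → g t xs ≡ dot f t xs
    dot-unique f g g-[] g-∷ t []       = g-[] t
    dot-unique f g g-[] g-∷ t (x ∷ xs) =
      trans (g-∷ t x xs) (+-congˡ (f (suc t) * x) (dot-unique f g g-[] g-∷ (suc t) xs))

    -- The placeholder stands for the local function of invRev, which has no name outside its definition.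
    mutual
      go≡dot : ∀ f (n : ℕ) t xs → _ ≡ dot f t xs
      go≡dot f n = dot-unique f _ (λ _ → refl) (λ _ _ _ → refl)

      invₚ-suc : ∀ f n → invₚ f (suc n) ≡ - dot f 0 (invRev f n)
      -- With the list and the starting index abstracted to variables, the goal applies the local
      -- function to variables only, which is what determines the placeholder.
      invₚ-suc f n with invRev f n | 0
      ... | xs | t = cong -_ (go≡dot f n t xs)

    -- `invRev` lists the coefficients backwards, so pairing it with those of f gives a coefficient
    -- of a product; t is the offset reached inside the list.
    dot-invRev : ∀ f t n → dot f t (invRev f n) ≡ ((λ j → f (suc (t ℕ.+ j))) *ₚ invₚ f) n
    dot-invRev f t zero    = trans (cong (λ j → f (suc j) * 1ℤ + 0ℤ) (sym (ℕₚ.+-identityʳ t))) (sym (trans (conv-zero (λ j → f (suc (t ℕ.+ j))) (invₚ f)) (sym (ℤₚ.+-identityʳ _))))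
    dot-invRev f t (suc n) = sym (trans (conv-suc (λ j → f (suc (t ℕ.+ j))) (invₚ f) n) (cong₂ _+_ (cong (λ j → f (suc j) * invₚ f (suc n)) (ℕₚ.+-identityʳ t))
      (trans (*ₚ-cong {g = invₚ f} (λ j → cong (f ∘ suc) (ℕₚ.+-suc t j)) ≗-refl n) (sym (dot-invRev f (suc t) n)))))

  invₚ-inverse : ∀ f → f 0 ≡ 1ℤ → f *ₚ invₚ f ≗ 1ₚ
  invₚ-inverse f f0≡1 zero    = trans (conv-zero f (invₚ f)) (cong (_* 1ℤ) f0≡1)
  invₚ-inverse f f0≡1 (suc n) = begin
    (f *ₚ invₚ f) (suc n)                                ≡⟨ conv-suc f (invₚ f) n ⟩
    f 0 * invₚ f (suc n) + (tail f *ₚ invₚ f) n          ≡⟨ cong₂ (λ x y → x * y + (tail f *ₚ invₚ f) n) f0≡1 (trans (invₚ-suc f n) (cong -_ (dot-invRev f 0 n))) ⟩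
    1ℤ * - (tail f *ₚ invₚ f) n + (tail f *ₚ invₚ f) n   ≡⟨ cancel ((tail f *ₚ invₚ f) n) ⟩
    0ℤ                                                   ∎
    where
    open ≡-Reasoning
    cancel : ∀ x → 1ℤ * - x + x ≡ 0ℤ
    cancel = solve-∀

  invₚ-cancel : ∀ f {g h} → f 0 ≡ 1ℤ → f *ₚ g ≗ h → g ≗ invₚ f *ₚ h
  invₚ-cancel f {g} {h} f0≡1 eq = begin
    g                      ≈⟨ ≗-sym (*ₚ-identityˡ g) ⟩
    1ₚ *ₚ g                ≈⟨ *ₚ-cong {g = g} (≗-sym (invₚ-inverse f f0≡1)) ≗-refl ⟩
    (f *ₚ invₚ f) *ₚ g     ≈⟨ *ₚ-Properties.xy∙z≈y∙xz f (invₚ f) g ⟩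
    invₚ f *ₚ (f *ₚ g)     ≈⟨ *ₚ-cong {f = invₚ f} ≗-refl eq ⟩
    invₚ f *ₚ h            ∎
    where open ≗-Reasoning

  -- Identities between Gaussian binomials are reduced by this to identities between Pochhammer
  -- products, whose constant term is 1.
  *ₚ-cancelˡ : ∀ f {g h} → f 0 ≡ 1ℤ → f *ₚ g ≗ f *ₚ h → g ≗ h
  *ₚ-cancelˡ f {g} {h} f0≡1 eq m = trans (invₚ-cancel f f0≡1 eq m) (sym (invₚ-cancel f f0≡1 (≗-refl {f *ₚ h}) m))

-- Integer powers of q, and Gaussian binomials extended by zero to integer arguments.

module GaussianBinomials where

  open PowerSeries
  open import Data.Integer using (ℤ; +_; -[1+_]; _+_; _*_; _-_; -_; 0ℤ; 1ℤ; _⊖_)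

  -- In mon e f, for negative e, the coefficients at negative exponents are discarded.

  ι : PS → ℤ → ℤ
  ι f (+ m)    = f m
  ι f -[1+ m ] = 0ℤ

  mon : ℤ → PS → PS
  mon e f m = ι f (+ m - e)

  ι-cong : ∀ {f g} → f ≗ g → ∀ z → ι f z ≡ ι g z
  ι-cong eq (+ m)    = eq m
  ι-cong eq -[1+ m ] = refl

  ι-+ : ∀ f g z → ι (f +ₚ g) z ≡ ι f z + ι g z
  ι-+ f g (+ m)    = refl
  ι-+ f g -[1+ m ] = refl

  ι-shift : ∀ u f z → ι (shiftₚ u f) z ≡ ι f (z - + u)
  ι-shift zero    f z        = trans (ι-cong (λ _ → refl) z) (cong (ι f) (sym (ℤₚ.+-identityʳ z)))
  ι-shift (suc u) f -[1+ m ] = refl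
  ι-shift (suc u) f (+ zero) = refl
  ι-shift (suc u) f (+ suc m) = begin
    shiftₚ (suc u) f (suc m)    ≡⟨ shift-suc u f m ⟩
    shiftₚ u f m                ≡⟨ ι-shift u f (+ m) ⟩
    ι f (+ m - + u)             ≡⟨ cong (ι f) (trans (ℤₚ.m-n≡m⊖n m u) (trans (sym (ℤₚ.[1+m]⊖[1+n]≡m⊖n m u)) (sym (ℤₚ.m-n≡m⊖n (suc m) (suc u))))) ⟩
    ι f (+ suc m - + suc u)     ∎
    where open ≡-Reasoning

  mon-cong : ∀ {e e′ f f′} → e ≡ e′ → f ≗ f′ → mon e f ≗ mon e′ f′
  mon-cong {e} refl eq m = ι-cong eq (+ m - e)

  mon-0 : ∀ f → mon 0ℤ f ≗ f
  mon-0 f m = cong (ι f) (ℤₚ.+-identityʳ (+ m))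

  mon-zero : ∀ e {f} → f ≗ 0ₚ → mon e f ≗ 0ₚ
  mon-zero e eq m = trans (ι-cong eq (+ m - e)) (lem (+ m - e))
    where
    lem : ∀ z → ι 0ₚ z ≡ 0ℤ
    lem (+ _)    = refl
    lem -[1+ _ ] = refl

  mon-+ : ∀ e f g → mon e (f +ₚ g) ≗ mon e f +ₚ mon e g
  mon-+ e f g m = ι-+ f g (+ m - e)

  mon-shift : ∀ e u f → mon e (shiftₚ u f) ≗ mon (e + + u) f
  mon-shift e u f m = trans (ι-shift u f (+ m - e)) (cong (ι f) (lem (+ m) e (+ u)))
    where
    lem : ∀ a b c → a - b - c ≡ a - (b + c)
    lem = solve-∀

  shift≗mon : ∀ u f → shiftₚ u f ≗ mon (+ u) f
  shift≗mon u f m = trans (sym (mon-0 (shiftₚ u f) m)) (mon-shift 0ℤ u f m)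

  shiftℤ≗mon : ∀ e f → shiftℤₚ e f ≗ mon e f
  shiftℤ≗mon (+ e)    f m = shift≗mon e f m
  shiftℤ≗mon -[1+ e ] f m = refl

  -- The inner exponent has to be nonnegative here: a negative one would discard coefficients that
  -- the outer shift cannot restore. In `mon-shift` the shift acts first, so no sign condition
  -- arises.
  mon-mon : ∀ n e f → shiftₚ n (mon (+ e) f) ≗ mon (+ n + + e) f
  mon-mon n e f m = trans (shift-cong n (≗-sym (shift≗mon e f)) m)
    (trans (shift-shift n e f m) (shift≗mon (n ℕ.+ e) f m))

  *ₚ-mon : ∀ e W f → W *ₚ mon (+ e) f ≗ mon (+ e) (W *ₚ f)
  *ₚ-mon e W f m = trans (*ₚ-cong {W} {W} ≗-refl (≗-sym (shift≗mon e f)) m)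
    (trans (shift-*ʳ e W f m) (shift≗mon e (W *ₚ f) m))

  mon-high : ∀ e f m → m ℕ.< e → mon (+ e) f m ≡ 0ℤ
  mon-high e f m m<e = trans (sym (shift≗mon e f m)) (lem e m m<e)
    where
    lem : ∀ e m → m ℕ.< e → shiftₚ e f m ≡ 0ℤ
    lem (suc e) zero    _         = refl
    lem (suc e) (suc m) (s≤s m<e) = trans (shift-suc e f m) (lem e m m<e)

  -- Γ u v is the Gaussian binomial [u+v ; u], and 0 if u or v is negative.

  Γℕ : ℕ → ℕ → PS
  Γℕ zero    v       = 1ₚ
  Γℕ (suc u) zero    = 1ₚ
  Γℕ (suc u) (suc v) = Γℕ u (suc v) +ₚ shiftₚ (suc u) (Γℕ (suc u) v)

  Γℕ-zeroʳ : ∀ u → Γℕ u 0 ≡ 1ₚ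
  Γℕ-zeroʳ zero    = refl
  Γℕ-zeroʳ (suc u) = refl

  -- The inductive step is (1-q^(u+1)) + q^(u+1) (1-q^(v+1)) = 1-q^(u+v+2). This ties the Pascal
  -- recursion to the quotient of Pochhammer products in the definition of `qBinom`.
  qPoch-Γℕ : ∀ u v → (qPoch u *ₚ qPoch v) *ₚ Γℕ u v ≗ qPoch (u ℕ.+ v)
  qPoch-Γℕ zero v m = trans (*ₚ-identityʳ (1ₚ *ₚ qPoch v) m) (*ₚ-identityˡ (qPoch v) m)
  qPoch-Γℕ (suc u) zero m = trans (*ₚ-identityʳ (qPoch (suc u) *ₚ 1ₚ) m)
    (trans (*ₚ-identityʳ (qPoch (suc u)) m) (cong (λ n → qPoch n m) (sym (ℕₚ.+-identityʳ (suc u)))))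
  qPoch-Γℕ (suc u) (suc v) m = begin
    ((qPoch (suc u) *ₚ qPoch (suc v)) *ₚ (Γℕ u (suc v) +ₚ shiftₚ (suc u) (Γℕ (suc u) v))) m
      ≡⟨ *ₚ-distribˡ (qPoch (suc u) *ₚ qPoch (suc v)) (Γℕ u (suc v)) (shiftₚ (suc u) (Γℕ (suc u) v)) m ⟩
    ((qPoch (suc u) *ₚ qPoch (suc v)) *ₚ Γℕ u (suc v)) m + ((qPoch (suc u) *ₚ qPoch (suc v)) *ₚ shiftₚ (suc u) (Γℕ (suc u) v)) m
      ≡⟨ cong₂ _+_ (left m) (trans (shift-*ʳ (suc u) (qPoch (suc u) *ₚ qPoch (suc v)) (Γℕ (suc u) v) m) (shift-cong (suc u) right m)) ⟩
    diff (suc u) p m + shiftₚ (suc u) (diff (suc v) p) m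
      ≡⟨ +-congˡ (diff (suc u) p m) (trans (shift-+ (suc u) p (negₚ (shiftₚ (suc v) p)) m) (+-congˡ (shiftₚ (suc u) p m) (trans (shift-neg (suc u) (shiftₚ (suc v) p) m) (cong -_ (shift-shift (suc u) (suc v) p m))))) ⟩
    (p m - shiftₚ (suc u) p m) + (shiftₚ (suc u) p m - shiftₚ (suc u ℕ.+ suc v) p m)
      ≡⟨ telescope (p m) (shiftₚ (suc u) p m) (shiftₚ (suc u ℕ.+ suc v) p m) ⟩
    p m - shiftₚ (suc u ℕ.+ suc v) p m
      ≡⟨ sym (qPoch-suc (u ℕ.+ suc v) m) ⟩
    qPoch (suc u ℕ.+ suc v) m ∎
    where
    open ≡-Reasoning
    p = qPoch (u ℕ.+ suc v)
    telescope : ∀ a b c → (a - b) + (b - c) ≡ a - c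
    telescope = solve-∀
    left : (qPoch (suc u) *ₚ qPoch (suc v)) *ₚ Γℕ u (suc v) ≗ diff (suc u) p
    left = λ m → trans (*ₚ-assoc (qPoch (suc u)) (qPoch (suc v)) (Γℕ u (suc v)) m)
      (trans (qPoch-suc-* u (qPoch (suc v) *ₚ Γℕ u (suc v)) m)
        (diff-cong (suc u) (λ m → trans (sym (*ₚ-assoc (qPoch u) (qPoch (suc v)) (Γℕ u (suc v)) m)) (qPoch-Γℕ u (suc v) m)) m))
    right : (qPoch (suc u) *ₚ qPoch (suc v)) *ₚ Γℕ (suc u) v ≗ diff (suc v) p
    right = λ m → trans (*ₚ-Properties.xy∙z≈y∙xz (qPoch (suc u)) (qPoch (suc v)) (Γℕ (suc u) v) m)
      (trans (qPoch-suc-* v (qPoch (suc u) *ₚ Γℕ (suc u) v) m)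
        (diff-cong (suc v) (λ m → trans (sym (*ₚ-Properties.xy∙z≈y∙xz (qPoch (suc u)) (qPoch v) (Γℕ (suc u) v) m))
          (trans (qPoch-Γℕ (suc u) v m) (cong (λ n → qPoch n m) (sym (ℕₚ.+-suc u v))))) m))

  private
    *-const : ∀ f g → f 0 ≡ 1ℤ → g 0 ≡ 1ℤ → (f *ₚ g) 0 ≡ 1ℤ
    *-const f g p q = trans (conv-zero f g) (cong₂ _*_ p q)

    qPoch²-const : ∀ u v → (qPoch u *ₚ qPoch v) 0 ≡ 1ℤ
    qPoch²-const u v = *-const (qPoch u) (qPoch v) (qPoch-const u) (qPoch-const v)

  Γℕ-sym : ∀ u v → Γℕ u v ≗ Γℕ v u
  Γℕ-sym u v = *ₚ-cancelˡ (qPoch u *ₚ qPoch v) (qPoch²-const u v) (λ m → trans (qPoch-Γℕ u v m)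
    (trans (cong (λ n → qPoch n m) (ℕₚ.+-comm u v)) (trans (sym (qPoch-Γℕ v u m))
      (*ₚ-cong {g = Γℕ v u} (*ₚ-comm (qPoch v) (qPoch u)) ≗-refl m))))

  -- After multiplication by (q;q)_u (q;q)_v both sides are (q;q)_(u+v+1).
  Γℕ-absorb : ∀ u v → diff (suc u) (Γℕ (suc u) v) ≗ diff (suc u ℕ.+ v) (Γℕ u v)
  Γℕ-absorb u v = *ₚ-cancelˡ (qPoch u *ₚ qPoch v) (qPoch²-const u v) (begin
    (qPoch u *ₚ qPoch v) *ₚ diff (suc u) (Γℕ (suc u) v)    ≈⟨ diff-*ʳ (suc u) (qPoch u *ₚ qPoch v) (Γℕ (suc u) v) ⟩
    diff (suc u) ((qPoch u *ₚ qPoch v) *ₚ Γℕ (suc u) v)    ≈⟨ diff-cong (suc u) (*ₚ-assoc (qPoch u) (qPoch v) (Γℕ (suc u) v)) ⟩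
    diff (suc u) (qPoch u *ₚ (qPoch v *ₚ Γℕ (suc u) v))    ≈⟨ ≗-sym (qPoch-suc-* u (qPoch v *ₚ Γℕ (suc u) v)) ⟩
    qPoch (suc u) *ₚ (qPoch v *ₚ Γℕ (suc u) v)             ≈⟨ ≗-sym (*ₚ-assoc (qPoch (suc u)) (qPoch v) (Γℕ (suc u) v)) ⟩
    (qPoch (suc u) *ₚ qPoch v) *ₚ Γℕ (suc u) v             ≈⟨ qPoch-Γℕ (suc u) v ⟩
    qPoch (suc u ℕ.+ v)                                    ≈⟨ qPoch-suc (u ℕ.+ v) ⟩
    diff (suc u ℕ.+ v) (qPoch (u ℕ.+ v))                   ≈⟨ diff-cong (suc u ℕ.+ v) (≗-sym (qPoch-Γℕ u v)) ⟩
    diff (suc u ℕ.+ v) ((qPoch u *ₚ qPoch v) *ₚ Γℕ u v)    ≈⟨ ≗-sym (diff-*ʳ (suc u ℕ.+ v) (qPoch u *ₚ qPoch v) (Γℕ u v)) ⟩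
    (qPoch u *ₚ qPoch v) *ₚ diff (suc u ℕ.+ v) (Γℕ u v)    ∎)
    where open ≗-Reasoning

  -- Both sides are the q-multinomial coefficient (q;q)_(u+v+w) / ((q;q)_u (q;q)_v (q;q)_w).
  Γℕ-trinomial : ∀ u v w → Γℕ v w *ₚ Γℕ u (v ℕ.+ w) ≗ Γℕ u v *ₚ Γℕ (u ℕ.+ v) w
  Γℕ-trinomial u v w = *ₚ-cancelˡ (pu *ₚ (pv *ₚ pw)) (*-const pu (pv *ₚ pw) (qPoch-const u) (qPoch²-const v w)) (begin
    (pu *ₚ (pv *ₚ pw)) *ₚ (Γℕ v w *ₚ Γℕ u (v ℕ.+ w))     ≈⟨ *ₚ-assoc pu (pv *ₚ pw) (Γℕ v w *ₚ Γℕ u (v ℕ.+ w)) ⟩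
    pu *ₚ ((pv *ₚ pw) *ₚ (Γℕ v w *ₚ Γℕ u (v ℕ.+ w)))     ≈⟨ *ₚ-cong {pu} ≗-refl (≗-sym (*ₚ-assoc (pv *ₚ pw) (Γℕ v w) (Γℕ u (v ℕ.+ w)))) ⟩
    pu *ₚ (((pv *ₚ pw) *ₚ Γℕ v w) *ₚ Γℕ u (v ℕ.+ w))     ≈⟨ *ₚ-cong {pu} ≗-refl (*ₚ-cong {g = Γℕ u (v ℕ.+ w)} (qPoch-Γℕ v w) ≗-refl) ⟩
    pu *ₚ (qPoch (v ℕ.+ w) *ₚ Γℕ u (v ℕ.+ w))            ≈⟨ ≗-sym (*ₚ-assoc pu (qPoch (v ℕ.+ w)) (Γℕ u (v ℕ.+ w))) ⟩
    (pu *ₚ qPoch (v ℕ.+ w)) *ₚ Γℕ u (v ℕ.+ w)            ≈⟨ qPoch-Γℕ u (v ℕ.+ w) ⟩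
    qPoch (u ℕ.+ (v ℕ.+ w))                              ≡⟨ cong qPoch (sym (ℕₚ.+-assoc u v w)) ⟩
    qPoch (u ℕ.+ v ℕ.+ w)                                ≈⟨ ≗-sym (qPoch-Γℕ (u ℕ.+ v) w) ⟩
    (qPoch (u ℕ.+ v) *ₚ pw) *ₚ Γℕ (u ℕ.+ v) w            ≈⟨ *ₚ-cong {g = Γℕ (u ℕ.+ v) w} (*ₚ-cong {g = pw} (≗-sym (qPoch-Γℕ u v)) ≗-refl) ≗-refl ⟩
    (((pu *ₚ pv) *ₚ Γℕ u v) *ₚ pw) *ₚ Γℕ (u ℕ.+ v) w     ≈⟨ *ₚ-cong {g = Γℕ (u ℕ.+ v) w} (*ₚ-Properties.xy∙z≈xz∙y (pu *ₚ pv) (Γℕ u v) pw) ≗-refl ⟩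
    (((pu *ₚ pv) *ₚ pw) *ₚ Γℕ u v) *ₚ Γℕ (u ℕ.+ v) w     ≈⟨ *ₚ-assoc ((pu *ₚ pv) *ₚ pw) (Γℕ u v) (Γℕ (u ℕ.+ v) w) ⟩
    ((pu *ₚ pv) *ₚ pw) *ₚ (Γℕ u v *ₚ Γℕ (u ℕ.+ v) w)     ≈⟨ *ₚ-cong {g = Γℕ u v *ₚ Γℕ (u ℕ.+ v) w} (*ₚ-assoc pu pv pw) ≗-refl ⟩
    (pu *ₚ (pv *ₚ pw)) *ₚ (Γℕ u v *ₚ Γℕ (u ℕ.+ v) w)     ∎)
    where
    open ≗-Reasoning
    pu = qPoch u
    pv = qPoch v
    pw = qPoch w

  Γ : ℤ → ℤ → PS
  Γ (+ u)    (+ v)    = Γℕ u v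
  Γ (+ u)    -[1+ v ] = 0ₚ
  Γ -[1+ u ] v        = 0ₚ

  Γ-negʳ : ∀ u n → Γ u -[1+ n ] ≡ 0ₚ
  Γ-negʳ (+ u)    n = refl
  Γ-negʳ -[1+ u ] n = refl

  Γ-sym : ∀ u v → Γ u v ≗ Γ v u
  Γ-sym (+ u)    (+ v)    m = Γℕ-sym u v m
  Γ-sym (+ u)    -[1+ v ] m = refl
  Γ-sym -[1+ u ] (+ v)    m = refl
  Γ-sym -[1+ u ] -[1+ v ] m = refl

  Γ-trinomial : ∀ u v w → Γ v w *ₚ Γ u (v + w) ≗ Γ u v *ₚ Γ (u + v) w
  Γ-trinomial (+ u)    (+ v)    (+ w)    = Γℕ-trinomial u v w
  Γ-trinomial (+ u)    (+ v)    -[1+ w ] m = trans (*ₚ-zeroˡ (Γ (+ u) (v ⊖ suc w)) ≗-refl m) (sym (*ₚ-zeroʳ (Γℕ u v) ≗-refl m))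
  Γ-trinomial (+ u)    -[1+ v ] w        m = trans (*ₚ-zeroˡ (Γ (+ u) (-[1+ v ] + w)) ≗-refl m) (sym (*ₚ-zeroˡ (Γ (u ⊖ suc v) w) ≗-refl m))
  Γ-trinomial -[1+ u ] v        w        m = trans (*ₚ-zeroʳ (Γ v w) ≗-refl m) (sym (*ₚ-zeroˡ (Γ (-[1+ u ] + v) w) ≗-refl m))

  -- Pascal's rule fails only at u = v = 0.
  Γ-pascal : ∀ u v W e m → (u ≡ 0ℤ → v ≡ 0ℤ → W ≗ 0ₚ) →
    mon e (Γ u v *ₚ W) m ≡ mon e (Γ (u - 1ℤ) v *ₚ W) m + mon (e + u) (Γ u (v - 1ℤ) *ₚ W) m
  Γ-pascal -[1+ u ] v W e m _ = trans (mon-zero e (*ₚ-zeroˡ W ≗-refl) m)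
    (sym (cong₂ _+_ (mon-zero e (*ₚ-zeroˡ W ≗-refl) m) (mon-zero (e - + suc u) (*ₚ-zeroˡ W ≗-refl) m)))
  Γ-pascal (+ zero) -[1+ v ] W e m _ = trans (mon-zero e (*ₚ-zeroˡ W ≗-refl) m)
    (sym (cong₂ _+_ (mon-zero e (*ₚ-zeroˡ W ≗-refl) m) (mon-zero (e + 0ℤ) (*ₚ-zeroˡ W ≗-refl) m)))
  Γ-pascal (+ suc u) -[1+ v ] W e m _ = trans (mon-zero e (*ₚ-zeroˡ W ≗-refl) m)
    (sym (cong₂ _+_ (mon-zero e (*ₚ-zeroˡ W ≗-refl) m) (mon-zero (e + + suc u) (*ₚ-zeroˡ W ≗-refl) m)))
  Γ-pascal (+ zero) (+ zero) W e m W≗0 = trans (mon-zero e (*ₚ-zeroʳ 1ₚ (W≗0 refl refl)) m)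
    (sym (cong₂ _+_ (mon-zero e (*ₚ-zeroˡ W ≗-refl) m) (mon-zero (e + 0ℤ) (*ₚ-zeroˡ W ≗-refl) m)))
  Γ-pascal (+ zero) (+ suc v) W e m _ = trans (cong (λ x → mon x (1ₚ *ₚ W) m) (sym (ℤₚ.+-identityʳ e)))
    (trans (sym (ℤₚ.+-identityˡ _)) (cong (_+ mon (e + 0ℤ) (1ₚ *ₚ W) m) (sym (mon-zero e (*ₚ-zeroˡ W ≗-refl) m))))
  Γ-pascal (+ suc u) (+ zero) W e m _ = trans (cong (λ f → mon e (f *ₚ W) m) (sym (Γℕ-zeroʳ u)))
    (trans (sym (ℤₚ.+-identityʳ _)) (+-congˡ (mon e (Γℕ u 0 *ₚ W) m) (sym (mon-zero (e + + suc u) (*ₚ-zeroˡ W ≗-refl) m))))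
  Γ-pascal (+ suc u) (+ suc v) W e m _ = begin
    mon e ((Γℕ u (suc v) +ₚ shiftₚ (suc u) (Γℕ (suc u) v)) *ₚ W) m
      ≡⟨ mon-cong {e} refl (*ₚ-distribʳ W (Γℕ u (suc v)) (shiftₚ (suc u) (Γℕ (suc u) v))) m ⟩
    mon e ((Γℕ u (suc v) *ₚ W) +ₚ (shiftₚ (suc u) (Γℕ (suc u) v) *ₚ W)) m
      ≡⟨ mon-+ e (Γℕ u (suc v) *ₚ W) (shiftₚ (suc u) (Γℕ (suc u) v) *ₚ W) m ⟩
    mon e (Γℕ u (suc v) *ₚ W) m + mon e (shiftₚ (suc u) (Γℕ (suc u) v) *ₚ W) m
      ≡⟨ +-congˡ (mon e (Γℕ u (suc v) *ₚ W) m) (trans (mon-cong {e} refl (shift-*ˡ (suc u) (Γℕ (suc u) v) W) m) (mon-shift e (suc u) (Γℕ (suc u) v *ₚ W) m)) ⟩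
    mon e (Γℕ u (suc v) *ₚ W) m + mon (e + + suc u) (Γℕ (suc u) v *ₚ W) m ∎
    where open ≡-Reasoning

  Γ-pascal′ : ∀ u v W e m → (u ≡ 0ℤ → v ≡ 0ℤ → W ≗ 0ₚ) →
    mon e (Γ u v *ₚ W) m ≡ mon e (Γ u (v - 1ℤ) *ₚ W) m + mon (e + v) (Γ (u - 1ℤ) v *ₚ W) m
  Γ-pascal′ u v W e m W≗0 = trans (mon-cong {e} refl (*ₚ-cong {g = W} (Γ-sym u v) ≗-refl) m)
    (trans (Γ-pascal v u W e m (λ p q → W≗0 q p))
      (cong₂ _+_ (mon-cong {e} refl (*ₚ-cong {g = W} (Γ-sym (v - 1ℤ) u) ≗-refl) m)
                 (mon-cong {e + v} refl (*ₚ-cong {g = W} (Γ-sym v (u - 1ℤ)) ≗-refl) m)))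

  qBinom≗Γ : ∀ N b → qBinom (+ N) b ≗ Γ b (+ N - b)
  qBinom≗Γ N -[1+ b ] m = refl
  qBinom≗Γ N (+ b)    m with b ≤ᵇ N in eq
  ... | true  = begin
    (qPoch N *ₚ (invₚ (qPoch b) *ₚ invₚ (qPoch (N ∸ b)))) m      ≡⟨ *ₚ-Properties.x∙yz≈y∙zx (qPoch N) (invₚ (qPoch b)) (invₚ (qPoch (N ∸ b))) m ⟩
    (invₚ (qPoch b) *ₚ (invₚ (qPoch (N ∸ b)) *ₚ qPoch N)) m      ≡⟨ sym (invₚ-cancel (qPoch b) (qPoch-const b) (invₚ-cancel (qPoch (N ∸ b)) (qPoch-const (N ∸ b)) core) m) ⟩
    Γℕ b (N ∸ b) m                                               ≡⟨ cong (λ z → Γ (+ b) z m) (sym (trans (ℤₚ.m-n≡m⊖n N b) (ℤₚ.⊖-≥ b≤N))) ⟩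
    Γ (+ b) (+ N - + b) m ∎
    where
    open ≡-Reasoning
    b≤N : b ℕ.≤ N
    b≤N = ℕₚ.≤ᵇ⇒≤ b N (subst (λ x → Data.Bool.T x) (sym eq) _)
    core : qPoch (N ∸ b) *ₚ (qPoch b *ₚ Γℕ b (N ∸ b)) ≗ qPoch N
    core m = trans (*ₚ-Properties.x∙yz≈yx∙z (qPoch (N ∸ b)) (qPoch b) (Γℕ b (N ∸ b)) m)
      (trans (qPoch-Γℕ b (N ∸ b) m) (cong (λ n → qPoch n m) (ℕₚ.m+[n∸m]≡n b≤N)))
  ... | false = cong (λ f → f m) (sym (trans (cong (Γ (+ b)) (proj₂ neg)) (Γ-negʳ (+ b) (proj₁ neg))))
    where
    open import Data.Product using (proj₁; proj₂)
    N<b : N ℕ.< b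
    N<b = ℕₚ.≰⇒> (λ b≤N → subst (λ x → Data.Bool.T x) eq (ℕₚ.≤⇒≤ᵇ b≤N))
    neg : ∃ λ n → + N - + b ≡ -[1+ n ]
    neg with b ∸ N in eq′ | trans (ℤₚ.m-n≡m⊖n N b) (ℤₚ.⊖-< N<b)
    ... | suc n | p = n , p
    ... | zero  | p = ⊥-elim (ℕₚ.<⇒≱ N<b (ℕₚ.m∸n≡0⇒m≤n eq′))

  -- Γ′ d v is the modified coefficient [d+v ; d]′.
  Γ′ : ℕ → ℤ → PS
  Γ′ d       (+ v)    = Γℕ d v
  Γ′ zero    -[1+ v ] = 1ₚ
  Γ′ (suc d) -[1+ v ] = 0ₚ

  -- The convention looks at the sign of the top a, `Γ′` at the sign of a - d. These signs coincide
  -- for d = 0, and for d > 0 both coefficients vanish whenever a < d.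
  qBinom'≗Γ′ : ∀ a d → qBinom' a (+ d) ≗ Γ′ d (a - + d)
  qBinom'≗Γ′ (+ a) d m = trans (qBinom≗Γ a (+ d) m) (lem d (+ a - + d) refl)
    where
    lem : ∀ d z → + a - + d ≡ z → Γ (+ d) z m ≡ Γ′ d z m
    lem d       (+ v)    _ = refl
    lem (suc d) -[1+ v ] _ = refl
    lem zero    -[1+ v ] ()
  qBinom'≗Γ′ -[1+ a ] zero    m = refl
  qBinom'≗Γ′ -[1+ a ] (suc d) m = refl

-- Sign certificates; the q-Pfaff-Saalschütz and q-Vandermonde sums.

module Summations where

  open PowerSeries
  open GaussianBinomials
  open import Data.Integer using (ℤ; +_; -[1+_]; _+_; _*_; _-_; -_; 0ℤ; 1ℤ; _≤_; +≤+)

  -- Inequalities are proved by certificates: an expression assembled from nonnegative pieces is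
  -- matched by the ring solver with the required one (`nn-≡`), or with -1 to get a contradiction
  -- (`nn-absurd`). Accordingly x < 0 is written as nonnegativity of -1 - x.
  NN : ℤ → Set
  NN x = 0ℤ ≤ x

  nn : ∀ n → NN (+ n)
  nn n = +≤+ z≤n

  nn-+ : ∀ {x y} → NN x → NN y → NN (x + y)
  nn-+ = ℤₚ.+-mono-≤

  nn-* : ∀ {x y} → NN x → NN y → NN (x * y)
  nn-* {+ x} {+ y} _ _ = subst NN (ℤₚ.pos-* x y) (nn (x ℕ.* y))

  nn-≡ : ∀ {x y} → NN x → x ≡ y → NN y
  nn-≡ p refl = p

  nn-absurd : ∀ {x} → NN x → x ≡ - 1ℤ → ⊥
  nn-absurd () refl

  sign? : ∀ x → NN x ⊎ NN (- 1ℤ - x)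
  sign? (+ n)    = inj₁ (nn n)
  sign? -[1+ n ] = inj₂ (nn n)

  by-sign : ∀ x {A : Set} → (NN x → A) → (NN (- 1ℤ - x) → A) → A
  by-sign x f g = [ f , g ]′ (sign? x)

  sign-absurd : ∀ {x} → NN x → NN (- 1ℤ - x) → ⊥
  sign-absurd {x} p q = nn-absurd (nn-+ p q) (lem x)
    where
    lem : ∀ x → x + (- 1ℤ - x) ≡ - 1ℤ
    lem = solve-∀

  nn-antisym : ∀ s → NN s → NN (- s) → s ≡ 0ℤ
  nn-antisym (+ zero) _ _ = refl
  nn-antisym (+ suc s) _ ()

  nn-pos : ∀ {x} → NN x → ∃ λ n → x ≡ + n
  nn-pos {+ n} _ = n , refl

  Γ-vanish : ∀ u v → (NN u → NN v → ⊥) → Γ u v ≗ 0ₚ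
  Γ-vanish (+ u)    (+ v)    p = ⊥-elim (p (nn u) (nn v))
  Γ-vanish (+ u)    -[1+ v ] p = ≗-refl
  Γ-vanish -[1+ u ] v        p = ≗-refl

  ΓΓ-vanish : ∀ u v w x → (NN u → NN v → NN w → NN x → ⊥) → Γ u v *ₚ Γ w x ≗ 0ₚ
  ΓΓ-vanish (+ u)    (+ v)    w x p = *ₚ-zeroʳ (Γℕ u v) (Γ-vanish w x (p (nn u) (nn v)))
  ΓΓ-vanish (+ u)    -[1+ v ] w x p = *ₚ-zeroˡ (Γ w x) ≗-refl
  ΓΓ-vanish -[1+ u ] v        w x p = *ₚ-zeroˡ (Γ w x) ≗-refl

  t₁ : (e u v : ℤ) → PS
  t₁ e u v = mon e (Γ u v)

  t₂ : (e u v w x : ℤ) → PS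
  t₂ e u v w x = mon e (Γ u v *ₚ Γ w x)

  t₃ : (e u v w x y z : ℤ) → PS
  t₃ e u v w x y z = mon e (Γ u v *ₚ (Γ w x *ₚ Γ y z))

  t₁-cong : ∀ {e u v e′ u′ v′} → e ≡ e′ → u ≡ u′ → v ≡ v′ → ∀ m → t₁ e u v m ≡ t₁ e′ u′ v′ m
  t₁-cong refl refl refl m = refl

  t₂-cong : ∀ {e u v w x e′ u′ v′ w′ x′} → e ≡ e′ → u ≡ u′ → v ≡ v′ → w ≡ w′ → x ≡ x′ →
    ∀ m → t₂ e u v w x m ≡ t₂ e′ u′ v′ w′ x′ m
  t₂-cong refl refl refl refl refl m = refl

  t₃-cong : ∀ {e u v w x y z e′ u′ v′ w′ x′ y′ z′} → e ≡ e′ → u ≡ u′ → v ≡ v′ → w ≡ w′ → x ≡ x′ → y ≡ y′ → z ≡ z′ →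
    ∀ m → t₃ e u v w x y z m ≡ t₃ e′ u′ v′ w′ x′ y′ z′ m
  t₃-cong refl refl refl refl refl refl refl m = refl

  t₂-comm : ∀ e u v w x → t₂ e u v w x ≗ t₂ e w x u v
  t₂-comm e u v w x = mon-cong {e} refl (*ₚ-comm (Γ u v) (Γ w x))

  t₃-rotate : ∀ e u v w x y z → t₃ e u v w x y z ≗ t₃ e y z u v w x
  t₃-rotate e u v w x y z = mon-cong {e} refl (*ₚ-Properties.x∙yz≈z∙xy (Γ u v) (Γ w x) (Γ y z))

  t₁-vanish : ∀ e u v → (NN u → NN v → ⊥) → t₁ e u v ≗ 0ₚ
  t₁-vanish e u v p = mon-zero e (Γ-vanish u v p)

  t₂-vanish : ∀ e u v w x → (NN u → NN v → NN w → NN x → ⊥) → t₂ e u v w x ≗ 0ₚ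
  t₂-vanish e u v w x p = mon-zero e (ΓΓ-vanish u v w x p)

  -- The q-Pfaff–Saalschütz and q-Vandermonde sums.  The two shifts b, c are there so that Pascal's
  -- rule, applied to the first factor, only changes X and b and never reindexes the sum.

  module _ (c : ℤ) (I : ℕ) (W : ℤ → PS) where

    qTerm : (X b e i : ℤ) → PS
    qTerm X b e i = mon (e + (i - b) * (i + c)) (Γ (i - b) (X - i + b) *ₚ W i)

    qSum : (X b e : ℤ) → PS
    qSum X b e m = ∑ (suc I) (λ i → qTerm X b e (+ i) m)

    -- Pascal's rule adds X-i+b to the exponent of its second term, and (i-b)(i+c) + X-i+b =
    -- (i-b-1)(i+c) + X+b+c. So b becomes b+1 and the extra power of q does not depend on i.
    qTerm-rec : ∀ X b e i m → X ≢ 0ℤ →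
      qTerm X b e i m ≡ qTerm (X - 1ℤ) b e i m + qTerm (X - 1ℤ) (b + 1ℤ) (e + X + b + c) i m
    qTerm-rec X b e i m X≢0 =
      trans (Γ-pascal′ (i - b) (X - i + b) (W i) (e + (i - b) * (i + c)) m
              (λ p q → ⊥-elim (X≢0 (trans (lem₀ X i b) (cong₂ _+_ p q)))))
        (cong₂ _+_ (cong (λ v → mon (e + (i - b) * (i + c)) (Γ (i - b) v *ₚ W i) m) (lem₁ X i b))
                   (term-cong (lem₂ e X i b c) (lem₃ i b) (lem₄ X i b)))
      where
      term-cong : ∀ {e e′ u u′ v v′} → e ≡ e′ → u ≡ u′ → v ≡ v′ → mon e (Γ u v *ₚ W i) m ≡ mon e′ (Γ u′ v′ *ₚ W i) m
      term-cong refl refl refl = refl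
      lem₀ : ∀ X i b → X ≡ (i - b) + (X - i + b)
      lem₀ = solve-∀
      lem₁ : ∀ X i b → X - i + b - 1ℤ ≡ X - 1ℤ - i + b
      lem₁ = solve-∀
      lem₂ : ∀ e X i b c → e + (i - b) * (i + c) + (X - i + b) ≡ e + X + b + c + (i - (b + 1ℤ)) * (i + c)
      lem₂ = solve-∀
      lem₃ : ∀ i b → i - b - 1ℤ ≡ i - (b + 1ℤ)
      lem₃ = solve-∀
      lem₄ : ∀ X i b → X - i + b ≡ X - 1ℤ - i + (b + 1ℤ)
      lem₄ = solve-∀

    qSum-rec : ∀ X b e m → X ≢ 0ℤ → qSum X b e m ≡ qSum (X - 1ℤ) b e m + qSum (X - 1ℤ) (b + 1ℤ) (e + X + b + c) m
    qSum-rec X b e m X≢0 = trans (∑-cong (suc I) (λ i → qTerm-rec X b e (+ i) m X≢0))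
      (∑-+ (suc I) (λ i → qTerm (X - 1ℤ) b e (+ i) m) (λ i → qTerm (X - 1ℤ) (b + 1ℤ) (e + X + b + c) (+ i) m))

    private
      qTerm-off : ∀ b e i m → i ≢ b → qTerm 0ℤ b e i m ≡ 0ℤ
      qTerm-off b e i m i≢b = mon-zero (e + (i - b) * (i + c)) (*ₚ-zeroˡ (W i) (Γ-vanish (i - b) (0ℤ - i + b)
          (λ p q → i≢b (ℤₚ.i-j≡0⇒i≡j i b (nn-antisym (i - b) p (nn-≡ q (lem i b))))))) m
        where
        lem : ∀ i b → 0ℤ - i + b ≡ - (i - b)
        lem = solve-∀

      qTerm-on : ∀ b e m → qTerm 0ℤ b e b m ≡ mon e (W b) m
      qTerm-on b e m = trans (term-cong (lem₁ e b c) (lem₂ b) (lem₃ b)) (mon-cong {e} refl (*ₚ-identityˡ (W b)) m)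
        where
        term-cong : ∀ {e e′ u u′ v v′} → e ≡ e′ → u ≡ u′ → v ≡ v′ → mon e (Γ u v *ₚ W b) m ≡ mon e′ (Γ u′ v′ *ₚ W b) m
        term-cong refl refl refl = refl
        lem₁ : ∀ e b c → e + (b - b) * (b + c) ≡ e
        lem₁ = solve-∀
        lem₂ : ∀ b → b - b ≡ 0ℤ
        lem₂ = solve-∀
        lem₃ : ∀ b → 0ℤ - b + b ≡ 0ℤ
        lem₃ = solve-∀

    -- For X = 0 the first factor is 1 at i = b and 0 elsewhere. If b is outside the range of
    -- summation, nothing is left, and the last hypothesis makes the right-hand side 0 as well.
    qSum-0 : ∀ b e m {f} → W b ≗ f → (¬ (NN b × NN (+ I - b)) → f ≗ 0ₚ) → qSum 0ℤ b e m ≡ mon e f m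
    qSum-0 b e m W≗f f≗0 with sign? b | sign? (+ I - b)
    ... | inj₂ b<0 | _ = trans (∑-zero (suc I) (λ i → qTerm-off b e (+ i) m (λ { refl → sign-absurd (nn i) b<0 })))
                           (sym (mon-zero e (f≗0 (λ (b≥0 , _) → sign-absurd b≥0 b<0)) m))
    ... | inj₁ _   | inj₂ I<b = trans (trans (∑-cong-< (suc I) (λ i i≤I → qTerm-off b e (+ i) m
                                    (λ { refl → sign-absurd (ℤₚ.i≤j⇒0≤j-i (+≤+ (ℕₚ.≤-pred i≤I))) I<b }))) (∑-zero (suc I) (λ _ → refl)))
                           (sym (mon-zero e (f≗0 (λ (_ , I≥b) → sign-absurd I≥b I<b)) m))
    ... | inj₁ b≥0 | inj₁ I≥b with nn-pos b≥0
    ...   | b′ , refl = trans (∑-single (suc I) b′ (λ i → qTerm 0ℤ (+ b′) e (+ i) m) (s≤s (ℤₚ.drop‿+≤+ (ℤₚ.0≤i-j⇒j≤i I≥b)))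
                          (λ i i≢b → qTerm-off (+ b′) e (+ i) m (i≢b ∘ ℤₚ.+-injective)))
                          (trans (qTerm-on (+ b′) e m) (mon-cong {e} refl W≗f m))

  module _ (Y c : ℤ) (I : ℕ) where

    private
      W : (N M i : ℤ) → PS
      W N M i = Γ (i + c) (Y - i - c) *ₚ Γ (M - i) N

    -- In brackets, this sums q^(e+(i-b)(i+c)) [X; i-b] [Y; i+c] [M-i+N; N] over 0 ≤ i ≤ I. The
    -- q-Pfaff-Saalschütz evaluation needs the balance N = X + Y.
    saalSum : (N X b M e : ℤ) → PS
    saalSum N X b M e = qSum c I (W N M) X b e

    saalProd : (X b M e : ℤ) → PS
    saalProd X b M e = t₂ e (M - b) (X + b + c) (M + c) (Y - b - c)

    private
      saalTerm-N : ∀ N X b M e i m → N ≢ 0ℤ →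
        qTerm c I (W N M) X b e i m ≡ qTerm c I (W (N - 1ℤ) M) X b e i m + qTerm c I (W N (M - 1ℤ)) X b (e + N) i m
      saalTerm-N N X b M e i m N≢0 = begin
        t₃ (e + (i - b) * (i + c)) (i - b) (X - i + b) (i + c) (Y - i - c) (M - i) N m
          ≡⟨ t₃-rotate (e + (i - b) * (i + c)) (i - b) (X - i + b) (i + c) (Y - i - c) (M - i) N m ⟩
        t₃ (e + (i - b) * (i + c)) (M - i) N (i - b) (X - i + b) (i + c) (Y - i - c) m
          ≡⟨ Γ-pascal′ (M - i) N (Γ (i - b) (X - i + b) *ₚ Γ (i + c) (Y - i - c)) (e + (i - b) * (i + c)) m (λ _ N≡0 → ⊥-elim (N≢0 N≡0)) ⟩
        t₃ (e + (i - b) * (i + c)) (M - i) (N - 1ℤ) (i - b) (X - i + b) (i + c) (Y - i - c) m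
          + t₃ (e + (i - b) * (i + c) + N) (M - i - 1ℤ) N (i - b) (X - i + b) (i + c) (Y - i - c) m
          ≡⟨ cong₂ _+_ (sym (t₃-rotate (e + (i - b) * (i + c)) (i - b) (X - i + b) (i + c) (Y - i - c) (M - i) (N - 1ℤ) m))
              (trans (sym (t₃-rotate (e + (i - b) * (i + c) + N) (i - b) (X - i + b) (i + c) (Y - i - c) (M - i - 1ℤ) N m))
                (t₃-cong {u = i - b} {X - i + b} {i + c} {Y - i - c} (lem₁ e i b c N) refl refl refl refl (lem₂ M i) refl m)) ⟩
        qTerm c I (W (N - 1ℤ) M) X b e i m + qTerm c I (W N (M - 1ℤ)) X b (e + N) i m ∎
        where
        open ≡-Reasoning
        lem₁ : ∀ e i b c N → e + (i - b) * (i + c) + N ≡ e + N + (i - b) * (i + c)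
        lem₁ = solve-∀
        lem₂ : ∀ M i → M - i - 1ℤ ≡ M - 1ℤ - i
        lem₂ = solve-∀

    -- Pascal's rule is applied to the factor with N, giving a part with M-1 and a part with N-1.
    -- The latter is split again by Pascal's rule in X, so that all three sums keep N = X + Y.
    saalSum-rec : ∀ N X b M e m → N ≢ 0ℤ → X ≢ 0ℤ → saalSum N X b M e m ≡
      saalSum (N - 1ℤ) (X - 1ℤ) b M e m + saalSum (N - 1ℤ) (X - 1ℤ) (b + 1ℤ) M (e + X + b + c) m
        + saalSum N X b (M - 1ℤ) (e + N) m
    saalSum-rec N X b M e m N≢0 X≢0 =
      trans (∑-cong (suc I) (λ i → saalTerm-N N X b M e (+ i) m N≢0))
        (trans (∑-+ (suc I) (λ i → qTerm c I (W (N - 1ℤ) M) X b e (+ i) m) (λ i → qTerm c I (W N (M - 1ℤ)) X b (e + N) (+ i) m))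
          (cong (_+ saalSum N X b (M - 1ℤ) (e + N) m) (qSum-rec c I (W (N - 1ℤ) M) X b e m X≢0)))

    -- Pascal's rule is applied to the first factor, and then to the second factor of the second
    -- term. The powers of q collected on the way multiply to exponent (X+b+c) + (Y-b-c) = N. At the
    -- exceptional point of either application the other factor has a negative argument.
    saalProd-rec : ∀ N X b M e m → N ≡ X + Y → NN (X - 1ℤ) → NN Y → saalProd X b M e m ≡
      saalProd (X - 1ℤ) b M e m + saalProd (X - 1ℤ) (b + 1ℤ) M (e + X + b + c) m
        + saalProd X b (M - 1ℤ) (e + N) m
    saalProd-rec N X b M e m N≡ X>0 Y≥0 = begin
      t₂ e (M - b) (X + b + c) (M + c) (Y - b - c) m
        ≡⟨ Γ-pascal′ (M - b) (X + b + c) (Γ (M + c) (Y - b - c)) e m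
             (λ p q → Γ-vanish (M + c) (Y - b - c) (λ r _ → nn-absurd (nn-+ r X>0) (trans (lem₁ M X b c) (cong₂ (λ x y → x + y - 1ℤ) p q)))) ⟩
      t₂ e (M - b) (X + b + c - 1ℤ) (M + c) (Y - b - c) m + t₂ (e + (X + b + c)) (M - b - 1ℤ) (X + b + c) (M + c) (Y - b - c) m
        ≡⟨ cong₂ _+_ (t₂-cong {e} {M - b} {w = M + c} {Y - b - c} refl refl (lem₂ X b c) refl refl m) second ⟩
      saalProd (X - 1ℤ) b M e m + (saalProd (X - 1ℤ) (b + 1ℤ) M (e + X + b + c) m + saalProd X b (M - 1ℤ) (e + N) m)
        ≡⟨ sym (ℤₚ.+-assoc (saalProd (X - 1ℤ) b M e m) _ _) ⟩
      saalProd (X - 1ℤ) b M e m + saalProd (X - 1ℤ) (b + 1ℤ) M (e + X + b + c) m + saalProd X b (M - 1ℤ) (e + N) m ∎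
      where
      open ≡-Reasoning
      lem₁ : ∀ M X b c → M + c + (X - 1ℤ) ≡ M - b + (X + b + c) - 1ℤ
      lem₁ = solve-∀
      lem₂ : ∀ X b c → X + b + c - 1ℤ ≡ X - 1ℤ + b + c
      lem₂ = solve-∀
      E = e + (X + b + c)
      lem₃ : ∀ M b c Y → M - b - 1ℤ + Y ≡ M + c + (Y - b - c) - 1ℤ
      lem₃ = solve-∀
      lem₄ : ∀ M b → M - b - 1ℤ ≡ M - (b + 1ℤ)
      lem₄ = solve-∀
      lem₅ : ∀ X b c → X + b + c ≡ X - 1ℤ + (b + 1ℤ) + c
      lem₅ = solve-∀
      lem₆ : ∀ Y b c → Y - b - c - 1ℤ ≡ Y - (b + 1ℤ) - c
      lem₆ = solve-∀
      lem₇ : ∀ e X b c → e + (X + b + c) ≡ e + X + b + c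
      lem₇ = solve-∀
      lem₈ : ∀ e X Y b c → e + (X + b + c) + (Y - b - c) ≡ e + (X + Y)
      lem₈ = solve-∀
      lem₉ : ∀ M b → M - b - 1ℤ ≡ M - 1ℤ - b
      lem₉ = solve-∀
      lem₁₀ : ∀ M c → M + c - 1ℤ ≡ M - 1ℤ + c
      lem₁₀ = solve-∀
      second : t₂ E (M - b - 1ℤ) (X + b + c) (M + c) (Y - b - c) m ≡
        saalProd (X - 1ℤ) (b + 1ℤ) M (e + X + b + c) m + saalProd X b (M - 1ℤ) (e + N) m
      second = begin
        t₂ E (M - b - 1ℤ) (X + b + c) (M + c) (Y - b - c) m
          ≡⟨ t₂-comm E (M - b - 1ℤ) (X + b + c) (M + c) (Y - b - c) m ⟩
        t₂ E (M + c) (Y - b - c) (M - b - 1ℤ) (X + b + c) m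
          ≡⟨ Γ-pascal′ (M + c) (Y - b - c) (Γ (M - b - 1ℤ) (X + b + c)) E m
               (λ p q → Γ-vanish (M - b - 1ℤ) (X + b + c) (λ r _ → nn-absurd (nn-+ r Y≥0) (trans (lem₃ M b c Y) (cong₂ (λ x y → x + y - 1ℤ) p q)))) ⟩
        t₂ E (M + c) (Y - b - c - 1ℤ) (M - b - 1ℤ) (X + b + c) m + t₂ (E + (Y - b - c)) (M + c - 1ℤ) (Y - b - c) (M - b - 1ℤ) (X + b + c) m
          ≡⟨ cong₂ _+_
               (trans (t₂-comm E (M + c) (Y - b - c - 1ℤ) (M - b - 1ℤ) (X + b + c) m)
                      (t₂-cong {w = M + c} (lem₇ e X b c) (lem₄ M b) (lem₅ X b c) refl (lem₆ Y b c) m))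
               (trans (t₂-comm (E + (Y - b - c)) (M + c - 1ℤ) (Y - b - c) (M - b - 1ℤ) (X + b + c) m)
                      (t₂-cong {v = X + b + c} {x = Y - b - c} (trans (lem₈ e X Y b c) (cong (λ n → e + n) (sym N≡))) (lem₉ M b) refl (lem₁₀ M c) refl m)) ⟩
        saalProd (X - 1ℤ) (b + 1ℤ) M (e + X + b + c) m + saalProd X b (M - 1ℤ) (e + N) m ∎

    -- Only i = b is left, and its two remaining factors are regrouped by `Γ-trinomial`. When the
    -- product is nonzero, b ≤ M and b + c ≥ 0; the hypothesis on b and c then yields b ≥ 0, and I ≥
    -- M yields b ≤ I, so the index b is in range.
    saalSum-base : ∀ b M e m → NN b ⊎ NN (- c) → NN (+ I - M) → saalSum Y 0ℤ b M e m ≡ saalProd 0ℤ b M e m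
    saalSum-base b M e m supp I≥M = qSum-0 c I (W Y M) b e m
      (λ m → trans (cong (λ N → (Γ (b + c) (Y - b - c) *ₚ Γ (M - b) N) m) (lem₁ Y b c))
        (trans (Γ-trinomial (M - b) (b + c) (Y - b - c) m)
          (cong₂ (λ v w → (Γ (M - b) v *ₚ Γ w (Y - b - c)) m) (lem₂ b c) (lem₃ M b c))))
      (λ ¬b → ΓΓ-vanish (M - b) (0ℤ + b + c) (M + c) (Y - b - c) (λ p q _ _ → ¬b
        ( [ id , (λ c≤0 → nn-≡ (nn-+ q c≤0) (lem₄ b c)) ]′ supp
        , nn-≡ (nn-+ p I≥M) (lem₅ M b (+ I)) )))
      where
      lem₁ : ∀ Y b c → Y ≡ b + c + (Y - b - c)
      lem₁ = solve-∀
      lem₂ : ∀ b c → b + c ≡ 0ℤ + b + c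
      lem₂ = solve-∀
      lem₃ : ∀ M b c → M - b + (b + c) ≡ M + c
      lem₃ = solve-∀
      lem₄ : ∀ b c → 0ℤ + b + c + - c ≡ b
      lem₄ = solve-∀
      lem₅ : ∀ M b I → M - b + (I - M) ≡ I - b
      lem₅ = solve-∀

    saalSum-neg : ∀ N X b M e m → NN b ⊎ NN (- c) → NN (- 1ℤ - M) → saalSum N X b M e m ≡ saalProd X b M e m
    saalSum-neg N X b M e m supp M<0 =
      trans (∑-zero (suc I) (λ i → mon-zero (e + (+ i - b) * (+ i + c)) (*ₚ-zeroʳ (Γ (+ i - b) (X - + i + b)) (*ₚ-zeroʳ (Γ (+ i + c) (Y - + i - c))
               (Γ-vanish (M - + i) N (λ p _ → nn-absurd (nn-+ (nn-+ p M<0) (nn i)) (lem₁ M (+ i)))))) m))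
            (sym (t₂-vanish e (M - b) (X + b + c) (M + c) (Y - b - c)
               (λ p _ q _ → [ (λ b≥0 → nn-absurd (nn-+ (nn-+ p M<0) b≥0) (lem₂ M b))
                            , (λ c≤0 → nn-absurd (nn-+ (nn-+ q M<0) c≤0) (lem₃ M c)) ]′ supp) m))
      where
      lem₁ : ∀ M i → M - i + (- 1ℤ - M) + i ≡ - 1ℤ
      lem₁ = solve-∀
      lem₂ : ∀ M b → M - b + (- 1ℤ - M) + b ≡ - 1ℤ
      lem₂ = solve-∀
      lem₃ : ∀ M c → M + c + (- 1ℤ - M) + - c ≡ - 1ℤ
      lem₃ = solve-∀

    private
      b+1≥0 : ∀ {b} → NN b ⊎ NN (- c) → NN (b + 1ℤ) ⊎ NN (- c)
      b+1≥0 (inj₁ b≥0) = inj₁ (nn-+ b≥0 (nn 1))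
      b+1≥0 (inj₂ c≤0) = inj₂ c≤0

    -- Each term of the common recurrence has a smaller X or a smaller M. The argument `M` stands
    -- for the parameter M - 1, so that the induction starts at -1, where both sides are 0.
    saalschütz-ℕ : NN Y → ∀ X b M e m → NN b ⊎ NN (- c) → NN (+ I - + M + 1ℤ) →
      saalSum (+ X + Y) (+ X) b (+ M - 1ℤ) e m ≡ saalProd (+ X) b (+ M - 1ℤ) e m
    saalschütz-ℕ Y≥0 X b zero e m supp I≥M = saalSum-neg (+ X + Y) (+ X) b (- 1ℤ) e m supp (nn 0)
    saalschütz-ℕ Y≥0 zero b (suc M) e m supp I≥M =
      trans (cong (λ N → saalSum N 0ℤ b (+ M) e m) (ℤₚ.+-identityˡ Y)) (saalSum-base b (+ M) e m supp (nn-≡ I≥M (lem (+ I) (+ M))))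
      where
      lem : ∀ I M → I - (1ℤ + M) + 1ℤ ≡ I - M
      lem = solve-∀
    saalschütz-ℕ Y≥0 (suc X) b (suc M) e m supp I≥M = begin
      saalSum N (+ suc X) b (+ M) e m
        ≡⟨ saalSum-rec N (+ suc X) b (+ M) e m N≢0 (λ ()) ⟩
      saalSum (N - 1ℤ) (+ X) b (+ M) e m + saalSum (N - 1ℤ) (+ X) (b + 1ℤ) (+ M) e′ m + saalSum N (+ suc X) b (+ M - 1ℤ) (e + N) m
        ≡⟨ cong₂ _+_
             (cong₂ _+_ (trans (cong (λ n → saalSum n (+ X) b (+ M) e m) N-1) (saalschütz-ℕ Y≥0 X b (suc M) e m supp I≥M))
                        (trans (cong (λ n → saalSum n (+ X) (b + 1ℤ) (+ M) e′ m) N-1) (saalschütz-ℕ Y≥0 X (b + 1ℤ) (suc M) e′ m (b+1≥0 supp) I≥M)))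
             (saalschütz-ℕ Y≥0 (suc X) b M (e + N) m supp (nn-≡ (nn-+ I≥M (nn 1)) (lem₂ (+ I) (+ M)))) ⟩
      saalProd (+ X) b (+ M) e m + saalProd (+ X) (b + 1ℤ) (+ M) e′ m + saalProd (+ suc X) b (+ M - 1ℤ) (e + N) m
        ≡⟨ sym (saalProd-rec N (+ suc X) b (+ M) e m refl (nn X) Y≥0) ⟩
      saalProd (+ suc X) b (+ M) e m ∎
      where
      open ≡-Reasoning
      N = + suc X + Y
      e′ = e + + suc X + b + c
      lem₁ : ∀ X Y → 1ℤ + X + Y - 1ℤ ≡ X + Y
      lem₁ = solve-∀
      N-1 : N - 1ℤ ≡ + X + Y
      N-1 = lem₁ (+ X) Y
      lem₂ : ∀ I M → I - (1ℤ + M) + 1ℤ + 1ℤ ≡ I - M + 1ℤ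
      lem₂ = solve-∀
      N≢0 : N ≢ 0ℤ
      N≢0 N≡0 = nn-absurd (nn-+ (nn X) Y≥0) (trans (sym N-1) (cong (_- 1ℤ) N≡0))

  saalschütz : ∀ X Y b c M I e m → NN X → NN Y → NN b ⊎ NN (- c) → M ℕ.≤ I →
    saalSum Y c I (X + Y) X b (+ M) e m ≡ t₂ e (+ M - b) (X + b + c) (+ M + c) (Y - b - c) m
  saalschütz (+ X) Y b c M I e m _ Y≥0 supp M≤I =
    saalschütz-ℕ Y c I Y≥0 X b (suc M) e m supp (nn-≡ (ℤₚ.i≤j⇒0≤j-i (+≤+ M≤I)) (lem (+ I) (+ M)))
    where
    lem : ∀ I M → I - M ≡ I - (1ℤ + M) + 1ℤ
    lem = solve-∀

  -- q-Vandermonde is the limit M → ∞ of q-Pfaff–Saalschütz.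

  module _ (Y c : ℤ) (I : ℕ) where

    private
      W : ℤ → PS
      W i = Γ (i + c) (Y - i - c)

    vandSum : (X b e : ℤ) → PS
    vandSum = qSum c I W

    private
      -- The limit is not taken; the same induction on X works with Pascal's rule alone. The last
      -- hypothesis says that the range of summation reaches the end of the support, either i = X +
      -- b of the first factor or i = Y - c of the second.
      vandermonde-ℕ : NN Y → ∀ X b e m → NN b ⊎ NN (- c) → NN (+ I - + X - b) ⊎ NN (+ I - Y + c) →
        vandSum (+ X) b e m ≡ t₁ e (+ X + b + c) (Y - b - c) m
      vandermonde-ℕ Y≥0 zero b e m supp bound = qSum-0 c I W b e m
        (λ m → cong (λ u → Γ u (Y - b - c) m) (lem₁ b c))
        (λ ¬b → Γ-vanish (0ℤ + b + c) (Y - b - c) (λ p q → ¬b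
          ( [ id , (λ c≤0 → nn-≡ (nn-+ p c≤0) (lem₂ b c)) ]′ supp
          , [ (λ r → nn-≡ r (lem₃ (+ I) b)) , (λ r → nn-≡ (nn-+ q r) (lem₄ Y c b (+ I))) ]′ bound )))
        where
        lem₁ : ∀ b c → b + c ≡ 0ℤ + b + c
        lem₁ = solve-∀
        lem₂ : ∀ b c → 0ℤ + b + c + - c ≡ b
        lem₂ = solve-∀
        lem₃ : ∀ I b → I - 0ℤ - b ≡ I - b
        lem₃ = solve-∀
        lem₄ : ∀ Y c b I → Y - b - c + (I - Y + c) ≡ I - b
        lem₄ = solve-∀
      vandermonde-ℕ Y≥0 (suc X) b e m supp bound = begin
        vandSum (+ suc X) b e m
          ≡⟨ qSum-rec c I W (+ suc X) b e m (λ ()) ⟩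
        vandSum (+ X) b e m + vandSum (+ X) (b + 1ℤ) (e + + suc X + b + c) m
          ≡⟨ cong₂ _+_ (vandermonde-ℕ Y≥0 X b e m supp ([ (λ p → inj₁ (nn-≡ (nn-+ p (nn 1)) (lem₁ (+ I) (+ X) b))) , inj₂ ]′ bound))
                       (vandermonde-ℕ Y≥0 X (b + 1ℤ) (e + + suc X + b + c) m supp′ ([ (λ p → inj₁ (nn-≡ p (lem₂ (+ I) (+ X) b))) , inj₂ ]′ bound)) ⟩
        t₁ e (+ X + b + c) (Y - b - c) m + t₁ (e + + suc X + b + c) (+ X + (b + 1ℤ) + c) (Y - (b + 1ℤ) - c) m
          ≡⟨ cong₂ _+_ (trans (t₁-cong {e} {v = Y - b - c} refl (lem₃ (+ X) b c) refl m) (unit e (u - 1ℤ) (Y - b - c)))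
                       (trans (t₁-cong (lem₄ e (+ X) b c) (lem₅ (+ X) b c) (lem₆ Y b c) m) (unit (e + u) u (Y - b - c - 1ℤ))) ⟩
        mon e (Γ (u - 1ℤ) (Y - b - c) *ₚ 1ₚ) m + mon (e + u) (Γ u (Y - b - c - 1ℤ) *ₚ 1ₚ) m
          ≡⟨ sym (Γ-pascal u (Y - b - c) 1ₚ e m (λ p q → ⊥-elim (nn-absurd (nn-+ (nn X) Y≥0) (trans (lem₇ (+ X) Y b c) (cong₂ (λ x y → x + y - 1ℤ) p q))))) ⟩
        mon e (Γ u (Y - b - c) *ₚ 1ₚ) m
          ≡⟨ sym (unit e u (Y - b - c)) ⟩
        t₁ e u (Y - b - c) m ∎
        where
        open ≡-Reasoning
        u = + suc X + b + c
        unit : ∀ e u v → t₁ e u v m ≡ mon e (Γ u v *ₚ 1ₚ) m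
        unit e u v = mon-cong {e} refl (≗-sym (*ₚ-identityʳ (Γ u v))) m
        lem₁ : ∀ I X b → I - (1ℤ + X) - b + 1ℤ ≡ I - X - b
        lem₁ = solve-∀
        lem₂ : ∀ I X b → I - (1ℤ + X) - b ≡ I - X - (b + 1ℤ)
        lem₂ = solve-∀
        lem₃ : ∀ X b c → X + b + c ≡ 1ℤ + X + b + c - 1ℤ
        lem₃ = solve-∀
        lem₄ : ∀ e X b c → e + (1ℤ + X) + b + c ≡ e + (1ℤ + X + b + c)
        lem₄ = solve-∀
        lem₅ : ∀ X b c → X + (b + 1ℤ) + c ≡ 1ℤ + X + b + c
        lem₅ = solve-∀
        lem₆ : ∀ Y b c → Y - (b + 1ℤ) - c ≡ Y - b - c - 1ℤ
        lem₆ = solve-∀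
        lem₇ : ∀ X Y b c → X + Y ≡ 1ℤ + X + b + c + (Y - b - c) - 1ℤ
        lem₇ = solve-∀
        supp′ : NN (b + 1ℤ) ⊎ NN (- c)
        supp′ = [ (λ b≥0 → inj₁ (nn-+ b≥0 (nn 1))) , inj₂ ]′ supp

    vandermonde : ∀ X b e m → NN X → NN Y → NN b ⊎ NN (- c) → NN (+ I - X - b) ⊎ NN (+ I - Y + c) →
      vandSum X b e m ≡ t₁ e (X + b + c) (Y - b - c) m
    vandermonde (+ X) b e m _ Y≥0 supp bound = vandermonde-ℕ Y≥0 X b e m supp bound

-- Truncated bilateral sums and the signed sums built from them.

module BosonicSums where

  open PowerSeries
  open GaussianBinomials
  open Summations
  open import Data.Integer using (ℤ; +_; -[1+_]; _+_; _*_; _-_; -_; 0ℤ; 1ℤ; _≤_)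

  -- The terms at s and -s are paired, so that reflecting s costs only commutativity; translating s
  -- leaves one boundary term at each end.
  Σℤ : ℕ → (ℤ → ℤ) → ℤ
  Σℤ B f = f 0ℤ + ∑ B (λ t → f (+ suc t) + f -[1+ t ])

  Σℤ-cong : ∀ B {f g : ℤ → ℤ} → f ≗ g → Σℤ B f ≡ Σℤ B g
  Σℤ-cong B eq = cong₂ _+_ (eq 0ℤ) (∑-cong B (λ t → cong₂ _+_ (eq (+ suc t)) (eq -[1+ t ])))

  Σℤ-zero : ∀ B {f : ℤ → ℤ} → (∀ s → f s ≡ 0ℤ) → Σℤ B f ≡ 0ℤ
  Σℤ-zero B eq = cong₂ _+_ (eq 0ℤ) (∑-zero B (λ t → cong₂ _+_ (eq (+ suc t)) (eq -[1+ t ])))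

  private
    interchange : ∀ a b c d → (a + b) + (c + d) ≡ (a + c) + (b + d)
    interchange = solve-∀

  Σℤ-+ : ∀ B (f g : ℤ → ℤ) → Σℤ B (λ s → f s + g s) ≡ Σℤ B f + Σℤ B g
  Σℤ-+ B f g = trans (+-congˡ (f 0ℤ + g 0ℤ)
      (trans (∑-cong B (λ t → interchange (f (+ suc t)) (g (+ suc t)) (f -[1+ t ]) (g -[1+ t ])))
             (∑-+ B (λ t → f (+ suc t) + f -[1+ t ]) (λ t → g (+ suc t) + g -[1+ t ]))))
    (interchange (f 0ℤ) (g 0ℤ) _ _)

  Σℤ-* : ∀ B c (f : ℤ → ℤ) → Σℤ B (λ s → c * f s) ≡ c * Σℤ B f
  Σℤ-* B c f = trans (+-congˡ (c * f 0ℤ) (trans (∑-cong B (λ t → sym (ℤₚ.*-distribˡ-+ c (f (+ suc t)) (f -[1+ t ]))))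
      (∑-* B c (λ t → f (+ suc t) + f -[1+ t ]))))
    (sym (ℤₚ.*-distribˡ-+ c (f 0ℤ) _))

  Σℤ-neg : ∀ B (f : ℤ → ℤ) → Σℤ B (λ s → - f s) ≡ - Σℤ B f
  Σℤ-neg B f = trans (+-congˡ (- f 0ℤ) (trans (∑-cong B (λ t → sym (ℤₚ.neg-distrib-+ (f (+ suc t)) (f -[1+ t ]))))
      (∑-neg B (λ t → f (+ suc t) + f -[1+ t ]))))
    (sym (ℤₚ.neg-distrib-+ (f 0ℤ) _))

  Σℤ-- : ∀ B (f g : ℤ → ℤ) → Σℤ B (λ s → f s - g s) ≡ Σℤ B f - Σℤ B g
  Σℤ-- B f g = trans (Σℤ-+ B f (λ s → - g s)) (+-congˡ (Σℤ B f) (Σℤ-neg B g))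

  Σℤ-reflect : ∀ B (f : ℤ → ℤ) → Σℤ B (λ s → f (- s)) ≡ Σℤ B f
  Σℤ-reflect B f = +-congˡ (f 0ℤ) (∑-cong B (λ t → ℤₚ.+-comm (f -[1+ t ]) (f (+ suc t))))

  Σℤ-suc : ∀ B (f : ℤ → ℤ) → Σℤ (suc B) f ≡ Σℤ B f + (f (+ suc B) + f -[1+ B ])
  Σℤ-suc B f = trans (+-congˡ (f 0ℤ) (∑-snoc B (λ t → f (+ suc t) + f -[1+ t ]))) (sym (ℤₚ.+-assoc (f 0ℤ) _ _))

  Σℤ-shift : ∀ B (f : ℤ → ℤ) → Σℤ B (λ s → f (s + 1ℤ)) + f (- + B) ≡ Σℤ B f + f (+ suc B)
  Σℤ-shift zero    f = lem (f 1ℤ) (f 0ℤ)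
    where
    lem : ∀ x y → (x + 0ℤ) + y ≡ (y + 0ℤ) + x
    lem = solve-∀
  Σℤ-shift (suc B) f = begin
    Σℤ (suc B) (λ s → f (s + 1ℤ)) + f -[1+ B ]
      ≡⟨ cong (_+ f -[1+ B ]) (trans (Σℤ-suc B (λ s → f (s + 1ℤ))) (+-congˡ S (cong₂ _+_ (cong f (ℤₚ.+-comm (+ suc B) 1ℤ)) (cong f (lem₁ B))))) ⟩
    S + (f (+ suc (suc B)) + f (- + B)) + f -[1+ B ]
      ≡⟨ lem₂ S (f (+ suc (suc B))) (f (- + B)) (f -[1+ B ]) ⟩
    S + f (- + B) + (f (+ suc (suc B)) + f -[1+ B ])
      ≡⟨ cong (_+ (f (+ suc (suc B)) + f -[1+ B ])) (Σℤ-shift B f) ⟩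
    Σℤ B f + f (+ suc B) + (f (+ suc (suc B)) + f -[1+ B ])
      ≡⟨ lem₃ (Σℤ B f) (f (+ suc B)) (f (+ suc (suc B))) (f -[1+ B ]) ⟩
    Σℤ B f + (f (+ suc B) + f -[1+ B ]) + f (+ suc (suc B))
      ≡⟨ cong (_+ f (+ suc (suc B))) (sym (Σℤ-suc B f)) ⟩
    Σℤ (suc B) f + f (+ suc (suc B)) ∎
    where
    open ≡-Reasoning
    S = Σℤ B (λ s → f (s + 1ℤ))
    lem₁ : ∀ B → -[1+ B ] + 1ℤ ≡ - + B
    lem₁ zero    = refl
    lem₁ (suc B) = refl
    lem₂ : ∀ a b c d → a + (b + c) + d ≡ a + c + (b + d)
    lem₂ = solve-∀
    lem₃ : ∀ a b c d → a + b + (c + d) ≡ a + (b + d) + c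
    lem₃ = solve-∀

  Σℤ-shift₀ : ∀ B (f : ℤ → ℤ) → f (- + B) ≡ 0ℤ → f (+ suc B) ≡ 0ℤ → Σℤ B (λ s → f (s + 1ℤ)) ≡ Σℤ B f
  Σℤ-shift₀ B f low high = begin
    Σℤ B (λ s → f (s + 1ℤ))                ≡⟨ sym (ℤₚ.+-identityʳ _) ⟩
    Σℤ B (λ s → f (s + 1ℤ)) + 0ℤ           ≡⟨ +-congˡ (Σℤ B (λ s → f (s + 1ℤ))) (sym low) ⟩
    Σℤ B (λ s → f (s + 1ℤ)) + f (- + B)    ≡⟨ Σℤ-shift B f ⟩
    Σℤ B f + f (+ suc B)                   ≡⟨ +-congˡ (Σℤ B f) high ⟩
    Σℤ B f + 0ℤ                            ≡⟨ ℤₚ.+-identityʳ _ ⟩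
    Σℤ B f                                 ∎
    where open ≡-Reasoning

  ∑-Σℤ-swap : ∀ n B (f : ℕ → ℤ → ℤ) → ∑ n (λ i → Σℤ B (f i)) ≡ Σℤ B (λ s → ∑ n (λ i → f i s))
  ∑-Σℤ-swap n B f = trans (∑-+ n (λ i → f i 0ℤ) (λ i → ∑ B (λ t → f i (+ suc t) + f i -[1+ t ])))
    (+-congˡ (∑ n (λ i → f i 0ℤ)) (trans (∑-swap n B (λ i t → f i (+ suc t) + f i -[1+ t ]))
      (∑-cong B (λ t → ∑-+ n (λ i → f i (+ suc t)) (λ i → f i -[1+ t ])))))

  Σℤ-extend : ∀ B n (f : ℤ → ℤ) → (∀ t → B ℕ.≤ t → f (+ suc t) ≡ 0ℤ) → (∀ t → B ℕ.≤ t → f -[1+ t ] ≡ 0ℤ) →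
    Σℤ (B ℕ.+ n) f ≡ Σℤ B f
  Σℤ-extend B n f p q = +-congˡ (f 0ℤ) (∑-extend B n (λ t → f (+ suc t) + f -[1+ t ]) (λ t B≤t → cong₂ _+_ (p t B≤t) (q t B≤t)))

  -- The exponents of the right-hand side at r = 2s and at r = 2s - 1, where K = 2k + 1

  e₁ e₂ : (K i s : ℤ) → ℤ
  e₁ K i s = s * (+ 2 * K * s + K - + 2 * i)
  e₂ K i s = (+ 2 * s - 1ℤ) * (K * s - i)

  e₁-nonneg : ∀ {K i} → NN i → NN (K - + 2 * i) → ∀ s → NN (e₁ K i s)
  e₁-nonneg {K} {i} i≥0 K≥2i s = by-sign s pos neg
    where
    lem₀ : ∀ K i → K - + 2 * i + + 2 * i ≡ K
    lem₀ = solve-∀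
    K≥0 : NN K
    K≥0 = nn-≡ (nn-+ K≥2i (nn-* (nn 2) i≥0)) (lem₀ K i)
    lem₁ : ∀ K i s → s * (+ 2 * K * s + (K - + 2 * i)) ≡ s * (+ 2 * K * s + K - + 2 * i)
    lem₁ = solve-∀
    lem₂ : ∀ K i s → (1ℤ + (- 1ℤ - s)) * (+ 2 * K * (- 1ℤ - s) + (K + + 2 * i)) ≡ s * (+ 2 * K * s + K - + 2 * i)
    lem₂ = solve-∀
    pos : NN s → NN (e₁ K i s)
    pos s≥0 = nn-≡ (nn-* s≥0 (nn-+ (nn-* (nn-* (nn 2) K≥0) s≥0) K≥2i)) (lem₁ K i s)
    neg : NN (- 1ℤ - s) → NN (e₁ K i s)
    neg s<0 = nn-≡ (nn-* (nn-+ (nn 1) s<0) (nn-+ (nn-* (nn-* (nn 2) K≥0) s<0) (nn-+ K≥0 (nn-* (nn 2) i≥0)))) (lem₂ K i s)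

  e₂-nonneg : ∀ {K i} → NN i → NN (K - + 2 * i) → ∀ s → NN (e₂ K i s)
  e₂-nonneg {K} {i} i≥0 K≥2i s = by-sign (s - 1ℤ) pos neg
    where
    lem₀ : ∀ K i → K - + 2 * i + + 2 * i ≡ K
    lem₀ = solve-∀
    K≥0 : NN K
    K≥0 = nn-≡ (nn-+ K≥2i (nn-* (nn 2) i≥0)) (lem₀ K i)
    lem₁ : ∀ K i s → (+ 2 * (s - 1ℤ) + 1ℤ) * (K * (s - 1ℤ) + ((K - + 2 * i) + i)) ≡ (+ 2 * s - 1ℤ) * (K * s - i)
    lem₁ = solve-∀
    lem₂ : ∀ K i s → (+ 2 * (- 1ℤ - (s - 1ℤ)) + 1ℤ) * (K * (- 1ℤ - (s - 1ℤ)) + i) ≡ (+ 2 * s - 1ℤ) * (K * s - i)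
    lem₂ = solve-∀
    pos : NN (s - 1ℤ) → NN (e₂ K i s)
    pos s≥1 = nn-≡ (nn-* (nn-+ (nn-* (nn 2) s≥1) (nn 1)) (nn-+ (nn-* K≥0 s≥1) (nn-+ K≥2i i≥0))) (lem₁ K i s)
    neg : NN (- 1ℤ - (s - 1ℤ)) → NN (e₂ K i s)
    neg s≤0 = nn-≡ (nn-* (nn-+ (nn-* (nn 2) s≤0) (nn 1)) (nn-+ (nn-* K≥0 s≤0) i≥0)) (lem₂ K i s)

  -- `f` belongs to the even indices r = 2s and `g` to the odd indices r = 2s - 1, which carry the
  -- sign -1.
  Bos : (K i : ℤ) (B : ℕ) (f g : ℤ → PS) → PS
  Bos K i B f g m = Σℤ B (λ s → mon (e₁ K i s) (f s) m - mon (e₂ K i s) (g s) m)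

  *ₚ-Σℤ : ∀ B W (F : ℤ → PS) m → (W *ₚ (λ m → Σℤ B (λ s → F s m))) m ≡ Σℤ B (λ s → (W *ₚ F s) m)
  *ₚ-Σℤ B W F m = begin
    (W *ₚ (λ m → Σℤ B (λ s → F s m))) m                         ≡⟨ conv W (λ m → Σℤ B (λ s → F s m)) m ⟩
    ∑ (suc m) (λ t → W t * Σℤ B (λ s → F s (m ∸ t)))            ≡⟨ ∑-cong (suc m) (λ t → sym (Σℤ-* B (W t) (λ s → F s (m ∸ t)))) ⟩
    ∑ (suc m) (λ t → Σℤ B (λ s → W t * F s (m ∸ t)))            ≡⟨ ∑-Σℤ-swap (suc m) B (λ t s → W t * F s (m ∸ t)) ⟩
    Σℤ B (λ s → ∑ (suc m) (λ t → W t * F s (m ∸ t)))            ≡⟨ Σℤ-cong B (λ s → sym (conv W (F s) m)) ⟩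
    Σℤ B (λ s → (W *ₚ F s) m)                                   ∎
    where open ≡-Reasoning

  shift-Σℤ : ∀ B n (F : ℤ → PS) m → shiftₚ n (λ m → Σℤ B (λ s → F s m)) m ≡ Σℤ B (λ s → shiftₚ n (F s) m)
  shift-Σℤ B n F m with n ≤ᵇ m
  ... | true  = refl
  ... | false = sym (Σℤ-zero B (λ _ → refl))

  module _ {K i : ℤ} (i≥0 : NN i) (K≥2i : NN (K - + 2 * i)) where

    private
      shift-mon : ∀ {e} n f → NN e → shiftₚ n (mon e f) ≗ mon (+ n + e) f
      shift-mon {+ e} n f _ = mon-mon n e f

    -- Nonnegativity of `e₁` and `e₂` enters here: a power of q may be moved inside `mon` only if
    -- `mon` has discarded nothing.
    shift-Bos : ∀ B n f g m → shiftₚ n (Bos K i B f g) m ≡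
      Σℤ B (λ s → mon (+ n + e₁ K i s) (f s) m - mon (+ n + e₂ K i s) (g s) m)
    shift-Bos B n f g m = trans (shift-Σℤ B n (λ s → mon (e₁ K i s) (f s) -ₚ mon (e₂ K i s) (g s)) m)
      (Σℤ-cong B (λ s → trans (shift-+ n (mon (e₁ K i s) (f s)) (negₚ (mon (e₂ K i s) (g s))) m)
        (cong₂ _+_ (shift-mon n (f s) (e₁-nonneg {K} i≥0 K≥2i s) m)
          (trans (shift-neg n (mon (e₂ K i s) (g s)) m) (cong -_ (shift-mon n (g s) (e₂-nonneg {K} i≥0 K≥2i s) m))))))

    private
      *ₚ-mon′ : ∀ {e} W f → NN e → W *ₚ mon e f ≗ mon e (W *ₚ f)
      *ₚ-mon′ {+ e} W f _ = *ₚ-mon e W f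

      *ₚ-negʳ : ∀ f g → f *ₚ negₚ g ≗ negₚ (f *ₚ g)
      *ₚ-negʳ f g m = trans (*ₚ-comm f (negₚ g) m) (trans (neg-*ˡ g f m) (cong -_ (*ₚ-comm g f m)))

    *ₚ-shift-Bos : ∀ W B n f g m → (W *ₚ shiftₚ n (Bos K i B f g)) m ≡
      Σℤ B (λ s → mon (+ n + e₁ K i s) (W *ₚ f s) m - mon (+ n + e₂ K i s) (W *ₚ g s) m)
    *ₚ-shift-Bos W B n f g m = begin
      (W *ₚ shiftₚ n (Bos K i B f g)) m
        ≡⟨ *ₚ-cong {W} ≗-refl (shift-Bos B n f g) m ⟩
      (W *ₚ (λ m → Σℤ B (λ s → mon (+ n + e₁ K i s) (f s) m - mon (+ n + e₂ K i s) (g s) m))) m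
        ≡⟨ *ₚ-Σℤ B W (λ s → mon (+ n + e₁ K i s) (f s) -ₚ mon (+ n + e₂ K i s) (g s)) m ⟩
      Σℤ B (λ s → (W *ₚ (mon (+ n + e₁ K i s) (f s) -ₚ mon (+ n + e₂ K i s) (g s))) m)
        ≡⟨ Σℤ-cong B (λ s → trans (*ₚ-distribˡ W (mon (+ n + e₁ K i s) (f s)) (negₚ (mon (+ n + e₂ K i s) (g s))) m)
             (cong₂ _+_ (*ₚ-mon′ W (f s) (nn-+ (nn n) (e₁-nonneg {K} i≥0 K≥2i s)) m)
               (trans (*ₚ-negʳ W (mon (+ n + e₂ K i s) (g s)) m) (cong -_ (*ₚ-mon′ W (g s) (nn-+ (nn n) (e₂-nonneg {K} i≥0 K≥2i s)) m))))) ⟩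
      Σℤ B (λ s → mon (+ n + e₁ K i s) (W *ₚ f s) m - mon (+ n + e₂ K i s) (W *ₚ g s) m) ∎
      where open ≡-Reasoning

  module _ (K i L M : ℤ) where

    -- In terms of r and a: r = 2s, a = K s in `R₁`, and r = 2s - 1, a = K s - i in `R₂`.
    R₁ R₂ : ℤ → PS
    R₁ s = Γ (M - + 2 * s) (L + K * s) *ₚ Γ (M + + 2 * s) (L - K * s)
    R₂ s = Γ (M - + 2 * s + 1ℤ) (L + K * s - i) *ₚ Γ (M + + 2 * s - 1ℤ) (L - K * s + i)

  module _ (K L M : ℤ) where

    -- The exponent x²+x arises in the q-Pfaff-Saalschütz sum as (x-r)(x+r+1) + r(r+1), which calls
    -- for binomials with x-r and x+r+1 as first arguments. `Q` has this shape and is the input of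
    -- the shifted transform; `P` is its output and lies between `Q` and `R`.
    P₁ P₂ Q₁ Q₂ : ℤ → PS
    P₁ s = Γ (M - + 2 * s) (L + K * s) *ₚ Γ (M + + 2 * s + 1ℤ) (L - K * s)
    P₂ s = Γ (M - + 2 * s + 1ℤ) (L + K * s - 1ℤ) *ₚ Γ (M + + 2 * s) (L + 1ℤ - K * s)
    Q₁ s = Γ (M - + 2 * s) (L + K * s) *ₚ Γ (M + + 2 * s + 1ℤ) (L + 1ℤ - K * s)
    Q₂ s = Γ (M - + 2 * s + 1ℤ) (L + K * s) *ₚ Γ (M + + 2 * s) (L + 1ℤ - K * s)

  R : (K i : ℤ) (B : ℕ) (L M : ℤ) → PS
  R K i B L M = Bos K i B (R₁ K i L M) (R₂ K i L M)

  P Q : (K : ℤ) (B : ℕ) (L M : ℤ) → PS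
  P K B L M = Bos K 1ℤ B (P₁ K L M) (P₂ K L M)
  Q K B L M = Bos K 1ℤ B (Q₁ K L M) (Q₂ K L M)

-- Equality of the forms P, Q and R, and the sum of modulus 1.

module BosonicForms where

  open PowerSeries
  open GaussianBinomials
  open Summations
  open BosonicSums
  open import Data.Integer using (ℤ; +_; -[1+_]; _+_; _*_; _-_; -_; 0ℤ; 1ℤ; _≤_; +≤+)

  private
    x-x : ∀ x → x - x ≡ 0ℤ
    x-x = solve-∀

  -- P and Q agree term by term: the differences P₁ - Q₁ and P₂ - Q₂ are the same monomial.
  P≡Q : ∀ K B L M → NN (K - 1ℤ) → NN L → NN M → P K B L M ≗ Q K B L M
  P≡Q K B L M K≥1 L≥0 M≥0 m = sym (Σℤ-cong B (λ s → begin
      mon (e₁ K 1ℤ s) (Q₁ K L M s) m - mon (e₂ K 1ℤ s) (Q₂ K L M s) m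
        ≡⟨ cong₂ _-_ (first s) (second s) ⟩
      (mon (e₁ K 1ℤ s) (P₁ K L M s) m + Z s) - (mon (e₂ K 1ℤ s) (P₂ K L M s) m + Z s)
        ≡⟨ lem₀ (mon (e₁ K 1ℤ s) (P₁ K L M s) m) (mon (e₂ K 1ℤ s) (P₂ K L M s) m) (Z s) ⟩
      mon (e₁ K 1ℤ s) (P₁ K L M s) m - mon (e₂ K 1ℤ s) (P₂ K L M s) m ∎))
    where
    open ≡-Reasoning
    lem₀ : ∀ a b z → (a + z) - (b + z) ≡ a - b
    lem₀ = solve-∀
    Z : ℤ → ℤ
    Z s = t₂ (e₂ K 1ℤ s + (L + K * s)) (M - + 2 * s) (L + K * s) (M + + 2 * s) (L + 1ℤ - K * s) m
    lem₁ : ∀ L K s → L + 1ℤ - K * s - 1ℤ ≡ L - K * s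
    lem₁ = solve-∀
    lem₂ : ∀ M s → M + + 2 * s + 1ℤ - 1ℤ ≡ M + + 2 * s
    lem₂ = solve-∀
    lem₃ : ∀ K L s → s * (+ 2 * K * s + K - + 2 * 1ℤ) + (L + 1ℤ - K * s) ≡ (+ 2 * s - 1ℤ) * (K * s - 1ℤ) + (L + K * s)
    lem₃ = solve-∀
    lem₄ : ∀ M s → M - + 2 * s + 1ℤ - 1ℤ ≡ M - + 2 * s
    lem₄ = solve-∀
    lem₅ : ∀ M s → M + (s + s) ≡ M + + 2 * s + 1ℤ - 1ℤ
    lem₅ = solve-∀
    lem₆ : ∀ K L s → L + ((1ℤ + (K - 1ℤ)) * (- 1ℤ - s) + (1ℤ + (K - 1ℤ))) ≡ L + 1ℤ - K * s - 1ℤ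
    lem₆ = solve-∀
    lem₇ : ∀ K L s → L + ((1ℤ + (K - 1ℤ)) * (s - 1ℤ) + (K - 1ℤ)) ≡ L + K * s - 1ℤ
    lem₇ = solve-∀
    lem₈ : ∀ M s → M + ((- 1ℤ - (s - 1ℤ)) + (- 1ℤ - (s - 1ℤ))) ≡ M - + 2 * s + 1ℤ - 1ℤ
    lem₈ = solve-∀
    first : ∀ s → mon (e₁ K 1ℤ s) (Q₁ K L M s) m ≡ mon (e₁ K 1ℤ s) (P₁ K L M s) m + Z s
    first s = begin
      t₂ (e₁ K 1ℤ s) (M - + 2 * s) (L + K * s) (M + + 2 * s + 1ℤ) (L + 1ℤ - K * s) m
        ≡⟨ t₂-comm (e₁ K 1ℤ s) (M - + 2 * s) (L + K * s) (M + + 2 * s + 1ℤ) (L + 1ℤ - K * s) m ⟩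
      t₂ (e₁ K 1ℤ s) (M + + 2 * s + 1ℤ) (L + 1ℤ - K * s) (M - + 2 * s) (L + K * s) m
        ≡⟨ Γ-pascal′ (M + + 2 * s + 1ℤ) (L + 1ℤ - K * s) (Γ (M - + 2 * s) (L + K * s)) (e₁ K 1ℤ s) m exc ⟩
      t₂ (e₁ K 1ℤ s) (M + + 2 * s + 1ℤ) (L + 1ℤ - K * s - 1ℤ) (M - + 2 * s) (L + K * s) m
        + t₂ (e₁ K 1ℤ s + (L + 1ℤ - K * s)) (M + + 2 * s + 1ℤ - 1ℤ) (L + 1ℤ - K * s) (M - + 2 * s) (L + K * s) m
        ≡⟨ cong₂ _+_
            (trans (t₂-comm (e₁ K 1ℤ s) (M + + 2 * s + 1ℤ) (L + 1ℤ - K * s - 1ℤ) (M - + 2 * s) (L + K * s) m)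
                   (t₂-cong {e₁ K 1ℤ s} {M - + 2 * s} {L + K * s} {M + + 2 * s + 1ℤ} refl refl refl refl (lem₁ L K s) m))
            (trans (t₂-comm (e₁ K 1ℤ s + (L + 1ℤ - K * s)) (M + + 2 * s + 1ℤ - 1ℤ) (L + 1ℤ - K * s) (M - + 2 * s) (L + K * s) m)
                   (t₂-cong {u = M - + 2 * s} {L + K * s} {x = L + 1ℤ - K * s} (lem₃ K L s) refl refl (lem₂ M s) refl m)) ⟩
      mon (e₁ K 1ℤ s) (P₁ K L M s) m + Z s ∎
      where
      exc : M + + 2 * s + 1ℤ ≡ 0ℤ → L + 1ℤ - K * s ≡ 0ℤ → Γ (M - + 2 * s) (L + K * s) ≗ 0ₚ
      -- The exceptional point of Pascal's rule is not reached: the first argument is positive for s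
      -- ≥ 0 and the second for s < 0.
      exc p q = ⊥-elim (by-sign s (λ s≥0 → nn-absurd (nn-+ M≥0 (nn-+ s≥0 s≥0)) (trans (lem₅ M s) (cong (_- 1ℤ) p)))
            (λ s<0 → nn-absurd (nn-+ L≥0 (nn-+ (nn-* (nn-+ (nn 1) K≥1) s<0) (nn-+ (nn 1) K≥1))) (trans (lem₆ K L s) (cong (_- 1ℤ) q))))
    second : ∀ s → mon (e₂ K 1ℤ s) (Q₂ K L M s) m ≡ mon (e₂ K 1ℤ s) (P₂ K L M s) m + Z s
    second s = trans (Γ-pascal′ (M - + 2 * s + 1ℤ) (L + K * s) (Γ (M + + 2 * s) (L + 1ℤ - K * s)) (e₂ K 1ℤ s) m exc)
      (+-congˡ (mon (e₂ K 1ℤ s) (P₂ K L M s) m)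
        (t₂-cong {e₂ K 1ℤ s + (L + K * s)} {v = L + K * s} {M + + 2 * s} {L + 1ℤ - K * s} refl (lem₄ M s) refl refl refl m))
      where
      exc : M - + 2 * s + 1ℤ ≡ 0ℤ → L + K * s ≡ 0ℤ → Γ (M + + 2 * s) (L + 1ℤ - K * s) ≗ 0ₚ
      exc p q = ⊥-elim (by-sign (s - 1ℤ) (λ s≥1 → nn-absurd (nn-+ L≥0 (nn-+ (nn-* (nn-+ (nn 1) K≥1) s≥1) K≥1)) (trans (lem₇ K L s) (cong (_- 1ℤ) q)))
            (λ s≤0 → nn-absurd (nn-+ M≥0 (nn-+ s≤0 s≤0)) (trans (lem₈ M s) (cong (_- 1ℤ) p))))

  -- The differences P₁ - R₁ and P₂ - R₂ are exchanged by s ↦ - s.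
  P≡R : ∀ K B L M → NN (K - 1ℤ) → NN L → NN M → P K B L M ≗ R K 1ℤ B L M
  P≡R K B L M K≥1 L≥0 M≥0 m = begin
    P K B L M m
      ≡⟨ Σℤ-cong B (λ s → trans (cong₂ _-_ (first s) (second s)) (lem₀ (r₁ s) (V (- s)) (r₂ s) (V s))) ⟩
    Σℤ B (λ s → (r₁ s - r₂ s) + (V (- s) - V s))
      ≡⟨ Σℤ-+ B (λ s → r₁ s - r₂ s) (λ s → V (- s) - V s) ⟩
    R K 1ℤ B L M m + Σℤ B (λ s → V (- s) - V s)
      ≡⟨ +-congˡ (R K 1ℤ B L M m) (trans (Σℤ-- B (λ s → V (- s)) V) (trans (cong (_- Σℤ B V) (Σℤ-reflect B V)) (x-x (Σℤ B V)))) ⟩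
    R K 1ℤ B L M m + 0ℤ
      ≡⟨ ℤₚ.+-identityʳ _ ⟩
    R K 1ℤ B L M m ∎
    where
    open ≡-Reasoning
    lem₀ : ∀ a b c d → (a + b) - (c + d) ≡ (a - c) + (b - d)
    lem₀ = solve-∀
    r₁ r₂ V : ℤ → ℤ
    r₁ s = mon (e₁ K 1ℤ s) (R₁ K 1ℤ L M s) m
    r₂ s = mon (e₂ K 1ℤ s) (R₂ K 1ℤ L M s) m
    V s = t₂ (e₂ K 1ℤ s + (M + + 2 * s)) (M - + 2 * s + 1ℤ) (L + K * s - 1ℤ) (M + + 2 * s) (L - K * s) m
    lem₁ : ∀ M s → M + + 2 * s + 1ℤ - 1ℤ ≡ M + + 2 * s
    lem₁ = solve-∀
    lem₂ : ∀ K M s → s * (+ 2 * K * s + K - + 2 * 1ℤ) + (M + + 2 * s + 1ℤ) ≡ (+ 2 * - s - 1ℤ) * (K * - s - 1ℤ) + (M + + 2 * - s)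
    lem₂ = solve-∀
    lem₃ : ∀ M s → M + + 2 * s + 1ℤ ≡ M - + 2 * - s + 1ℤ
    lem₃ = solve-∀
    lem₄ : ∀ K L s → L - K * s - 1ℤ ≡ L + K * - s - 1ℤ
    lem₄ = solve-∀
    lem₅ : ∀ M s → M - + 2 * s ≡ M + + 2 * - s
    lem₅ = solve-∀
    lem₆ : ∀ K L s → L + K * s ≡ L - K * - s
    lem₆ = solve-∀
    lem₇ : ∀ K L s → L + 1ℤ - K * s ≡ L - K * s + 1ℤ
    lem₇ = solve-∀
    lem₈ : ∀ K L s → L + 1ℤ - K * s - 1ℤ ≡ L - K * s
    lem₈ = solve-∀
    lem₉ : ∀ M s → M + (s + s) ≡ M + + 2 * s + 1ℤ - 1ℤ
    lem₉ = solve-∀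
    lem₁₀ : ∀ K L s → L + ((1ℤ + (K - 1ℤ)) * (- 1ℤ - s) + (K - 1ℤ)) ≡ L - K * s - 1ℤ
    lem₁₀ = solve-∀
    lem₁₁ : ∀ M s → M + (s - 1ℤ + (s - 1ℤ)) + 1ℤ ≡ M + + 2 * s - 1ℤ
    lem₁₁ = solve-∀
    lem₁₂ : ∀ K L s → L + (1ℤ + (K - 1ℤ)) * (- 1ℤ - (s - 1ℤ)) ≡ L + 1ℤ - K * s - 1ℤ
    lem₁₂ = solve-∀
    first : ∀ s → mon (e₁ K 1ℤ s) (P₁ K L M s) m ≡ r₁ s + V (- s)
    first s = begin
      t₂ (e₁ K 1ℤ s) (M - + 2 * s) (L + K * s) (M + + 2 * s + 1ℤ) (L - K * s) m
        ≡⟨ t₂-comm (e₁ K 1ℤ s) (M - + 2 * s) (L + K * s) (M + + 2 * s + 1ℤ) (L - K * s) m ⟩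
      t₂ (e₁ K 1ℤ s) (M + + 2 * s + 1ℤ) (L - K * s) (M - + 2 * s) (L + K * s) m
        ≡⟨ Γ-pascal (M + + 2 * s + 1ℤ) (L - K * s) (Γ (M - + 2 * s) (L + K * s)) (e₁ K 1ℤ s) m exc ⟩
      t₂ (e₁ K 1ℤ s) (M + + 2 * s + 1ℤ - 1ℤ) (L - K * s) (M - + 2 * s) (L + K * s) m
        + t₂ (e₁ K 1ℤ s + (M + + 2 * s + 1ℤ)) (M + + 2 * s + 1ℤ) (L - K * s - 1ℤ) (M - + 2 * s) (L + K * s) m
        ≡⟨ cong₂ _+_
            (trans (t₂-comm (e₁ K 1ℤ s) (M + + 2 * s + 1ℤ - 1ℤ) (L - K * s) (M - + 2 * s) (L + K * s) m)
                   (t₂-cong {e₁ K 1ℤ s} {M - + 2 * s} {L + K * s} {x = L - K * s} refl refl refl (lem₁ M s) refl m))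
            (t₂-cong (lem₂ K M s) (lem₃ M s) (lem₄ K L s) (lem₅ M s) (lem₆ K L s) m) ⟩
      r₁ s + V (- s) ∎
      where
      exc : M + + 2 * s + 1ℤ ≡ 0ℤ → L - K * s ≡ 0ℤ → Γ (M - + 2 * s) (L + K * s) ≗ 0ₚ
      exc p q = ⊥-elim (by-sign s (λ s≥0 → nn-absurd (nn-+ M≥0 (nn-+ s≥0 s≥0)) (trans (lem₉ M s) (cong (_- 1ℤ) p)))
            (λ s<0 → nn-absurd (nn-+ L≥0 (nn-+ (nn-* (nn-+ (nn 1) K≥1) s<0) K≥1)) (trans (lem₁₀ K L s) (cong (_- 1ℤ) q))))
    second : ∀ s → mon (e₂ K 1ℤ s) (P₂ K L M s) m ≡ r₂ s + V s
    second s = begin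
      t₂ (e₂ K 1ℤ s) (M - + 2 * s + 1ℤ) (L + K * s - 1ℤ) (M + + 2 * s) (L + 1ℤ - K * s) m
        ≡⟨ t₂-comm (e₂ K 1ℤ s) (M - + 2 * s + 1ℤ) (L + K * s - 1ℤ) (M + + 2 * s) (L + 1ℤ - K * s) m ⟩
      t₂ (e₂ K 1ℤ s) (M + + 2 * s) (L + 1ℤ - K * s) (M - + 2 * s + 1ℤ) (L + K * s - 1ℤ) m
        ≡⟨ Γ-pascal (M + + 2 * s) (L + 1ℤ - K * s) (Γ (M - + 2 * s + 1ℤ) (L + K * s - 1ℤ)) (e₂ K 1ℤ s) m exc ⟩
      t₂ (e₂ K 1ℤ s) (M + + 2 * s - 1ℤ) (L + 1ℤ - K * s) (M - + 2 * s + 1ℤ) (L + K * s - 1ℤ) m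
        + t₂ (e₂ K 1ℤ s + (M + + 2 * s)) (M + + 2 * s) (L + 1ℤ - K * s - 1ℤ) (M - + 2 * s + 1ℤ) (L + K * s - 1ℤ) m
        ≡⟨ cong₂ _+_
            (trans (t₂-comm (e₂ K 1ℤ s) (M + + 2 * s - 1ℤ) (L + 1ℤ - K * s) (M - + 2 * s + 1ℤ) (L + K * s - 1ℤ) m)
                   (t₂-cong {e₂ K 1ℤ s} {M - + 2 * s + 1ℤ} {L + K * s - 1ℤ} {M + + 2 * s - 1ℤ} refl refl refl refl (lem₇ K L s) m))
            (trans (t₂-comm (e₂ K 1ℤ s + (M + + 2 * s)) (M + + 2 * s) (L + 1ℤ - K * s - 1ℤ) (M - + 2 * s + 1ℤ) (L + K * s - 1ℤ) m)
                   (t₂-cong {e₂ K 1ℤ s + (M + + 2 * s)} {M - + 2 * s + 1ℤ} {L + K * s - 1ℤ} {M + + 2 * s} refl refl refl refl (lem₈ K L s) m)) ⟩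
      r₂ s + V s ∎
      where
      exc : M + + 2 * s ≡ 0ℤ → L + 1ℤ - K * s ≡ 0ℤ → Γ (M - + 2 * s + 1ℤ) (L + K * s - 1ℤ) ≗ 0ₚ
      exc p q = ⊥-elim (by-sign (s - 1ℤ) (λ s≥1 → nn-absurd (nn-+ (nn-+ M≥0 (nn-+ s≥1 s≥1)) (nn 1)) (trans (lem₁₁ M s) (cong (_- 1ℤ) p)))
            (λ s≤0 → nn-absurd (nn-+ L≥0 (nn-* (nn-+ (nn 1) K≥1) s≤0)) (trans (lem₁₂ K L s) (cong (_- 1ℤ) q))))

  -- The modulus 1 sum: increasing L changes each term by a telescoping difference.

  δ : ℕ → PS
  δ zero    = 1ₚ
  δ (suc _) = 0ₚ

  module _ (B : ℕ) (M : ℤ) (M≥0 : NN M) where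

    private
      r₁ r₂ D : (L : ℤ) (m : ℕ) (s : ℤ) → ℤ
      r₁ L m s = mon (e₁ 1ℤ 0ℤ s) (R₁ 1ℤ 0ℤ L M s) m
      r₂ L m s = mon (e₂ 1ℤ 0ℤ s) (R₂ 1ℤ 0ℤ L M s) m
      D L m s = t₂ (e₂ 1ℤ 0ℤ s + (L - s)) (M - + 2 * s + 1ℤ) (L + s - 1ℤ) (M + + 2 * s - + 2) (L - s) m

      module _ (L : ℤ) (L≥1 : NN (L - 1ℤ)) (m : ℕ) (s : ℤ) where
        E₁ = e₁ 1ℤ 0ℤ s
        E₂ = e₂ 1ℤ 0ℤ s
        a = M - + 2 * s
        b = M + + 2 * s
        u = L + s
        v = L - s
        A Bₛ C Z : ℤ
        A  = t₂ (E₁ + u) (a - 1ℤ) u b v m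
        Bₛ = t₂ (E₁ + v) a (u - 1ℤ) (b - 1ℤ) v m
        C  = t₂ (E₂ + u) a u (b - 1ℤ) v m
        Z  = t₂ (E₁ + + 2 * L) (a - 1ℤ) u (b - 1ℤ) v m

        pascal₁ : ∀ e a u b v → (a ≡ 0ℤ → u ≡ 0ℤ → ⊥) → t₂ e a u b v m ≡ t₂ e a (u - 1ℤ) b v m + t₂ (e + u) (a - 1ℤ) u b v m
        pascal₁ e a u b v exc = Γ-pascal′ a u (Γ b v) e m (λ p q → ⊥-elim (exc p q))

        pascal₂ : ∀ e a u b v → (b ≡ 0ℤ → v ≡ 0ℤ → ⊥) → t₂ e a u b v m ≡ t₂ e a u b (v - 1ℤ) m + t₂ (e + v) a u (b - 1ℤ) v m
        pascal₂ e a u b v exc = trans (t₂-comm e a u b v m) (trans (pascal₁ e b v a u exc)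
          (cong₂ _+_ (t₂-comm e b (v - 1ℤ) a u m) (t₂-comm (e + v) (b - 1ℤ) v a u m)))

        -- Since a + 2u = b + 2v = M + 2L and L ≥ 1, the arguments a, u and b, v cannot vanish
        -- together, nor can they after a or b is changed by 1 as below; Pascal's rule is thus
        -- always available.
        ml : NN (M + ((L - 1ℤ) + (L - 1ℤ)))
        ml = nn-+ M≥0 (nn-+ L≥1 L≥1)
        lem₁ : ∀ M L s → M + ((L - 1ℤ) + (L - 1ℤ)) + 1ℤ ≡ (M - + 2 * s) + ((L + s) + (L + s)) - 1ℤ
        lem₁ = solve-∀
        lem₂ : ∀ M L s → M + ((L - 1ℤ) + (L - 1ℤ)) + 1ℤ ≡ (M + + 2 * s) + ((L - s) + (L - s)) - 1ℤ
        lem₂ = solve-∀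
        lem₃ : ∀ M L s → M + ((L - 1ℤ) + (L - 1ℤ)) + + 2 ≡ (M - + 2 * s + 1ℤ) + ((L + s) + (L + s)) - 1ℤ
        lem₃ = solve-∀
        lem₄ : ∀ M L s → M + ((L - 1ℤ) + (L - 1ℤ)) ≡ (M + + 2 * s - 1ℤ) + ((L - s) + (L - s)) - 1ℤ
        lem₄ = solve-∀
        at0 : ∀ {x y z} → x ≡ y + (z + z) - 1ℤ → y ≡ 0ℤ → z ≡ 0ℤ → x ≡ - 1ℤ
        at0 eq refl refl = eq
        exc₁ : a ≡ 0ℤ → u ≡ 0ℤ → ⊥
        exc₁ p q = nn-absurd (nn-+ ml (nn 1)) (at0 (lem₁ M L s) p q)
        exc₂ : b ≡ 0ℤ → v ≡ 0ℤ → ⊥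
        exc₂ p q = nn-absurd (nn-+ ml (nn 1)) (at0 (lem₂ M L s) p q)
        exc₃ : a + 1ℤ ≡ 0ℤ → u ≡ 0ℤ → ⊥
        exc₃ p q = nn-absurd (nn-+ ml (nn 2)) (at0 (lem₃ M L s) p q)
        exc₄ : b - 1ℤ ≡ 0ℤ → v ≡ 0ℤ → ⊥
        exc₄ p q = nn-absurd ml (at0 (lem₄ M L s) p q)

        r₁≡ : r₁ L m s ≡ t₂ E₁ a u b v m
        r₁≡ = t₂-cong {E₁} {a} {w = b} refl refl (k L s) refl (k′ L s) m
          where
          k : ∀ L s → L + 1ℤ * s ≡ L + s
          k = solve-∀
          k′ : ∀ L s → L - 1ℤ * s ≡ L - s
          k′ = solve-∀
        r₁′≡ : r₁ (L - 1ℤ) m s ≡ t₂ E₁ a (u - 1ℤ) b (v - 1ℤ) m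
        r₁′≡ = t₂-cong {E₁} {a} {w = b} refl refl (k L s) refl (k′ L s) m
          where
          k : ∀ L s → L - 1ℤ + 1ℤ * s ≡ L + s - 1ℤ
          k = solve-∀
          k′ : ∀ L s → L - 1ℤ - 1ℤ * s ≡ L - s - 1ℤ
          k′ = solve-∀
        r₂≡ : r₂ L m s ≡ t₂ E₂ (a + 1ℤ) u (b - 1ℤ) v m
        r₂≡ = t₂-cong {E₂} {a + 1ℤ} {w = b - 1ℤ} refl refl (k L s) refl (k′ L s) m
          where
          k : ∀ L s → L + 1ℤ * s - 0ℤ ≡ L + s
          k = solve-∀
          k′ : ∀ L s → L - 1ℤ * s + 0ℤ ≡ L - s
          k′ = solve-∀
        r₂′≡ : r₂ (L - 1ℤ) m s ≡ t₂ E₂ (a + 1ℤ) (u - 1ℤ) (b - 1ℤ) (v - 1ℤ) m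
        r₂′≡ = t₂-cong {E₂} {a + 1ℤ} {w = b - 1ℤ} refl refl (k L s) refl (k′ L s) m
          where
          k : ∀ L s → L - 1ℤ + 1ℤ * s - 0ℤ ≡ L + s - 1ℤ
          k = solve-∀
          k′ : ∀ L s → L - 1ℤ - 1ℤ * s + 0ℤ ≡ L - s - 1ℤ
          k′ = solve-∀

        r₁-step : r₁ L m s ≡ (r₁ (L - 1ℤ) m s + Bₛ) + A
        r₁-step = trans r₁≡ (trans (pascal₁ E₁ a u b v exc₁) (cong (_+ A)
          (trans (pascal₂ E₁ a (u - 1ℤ) b v exc₂) (cong (_+ Bₛ) (sym r₁′≡)))))

        r₂-step : r₂ L m s ≡ (r₂ (L - 1ℤ) m s + D L m s) + C
        r₂-step = trans r₂≡ (trans (pascal₁ E₂ (a + 1ℤ) u (b - 1ℤ) v exc₃) (cong₂ _+_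
            (trans (pascal₂ E₂ (a + 1ℤ) (u - 1ℤ) (b - 1ℤ) v exc₄) (cong₂ _+_ (sym r₂′≡)
              (t₂-cong {E₂ + v} {a + 1ℤ} {u - 1ℤ} {x = v} refl refl refl (k M s) refl m)))
            (t₂-cong {E₂ + u} {v = u} {b - 1ℤ} {v} refl (k′ M s) refl refl refl m)))
          where
          k : ∀ M s → M + + 2 * s - 1ℤ - 1ℤ ≡ M + + 2 * s - + 2
          k = solve-∀
          k′ : ∀ M s → M - + 2 * s + 1ℤ - 1ℤ ≡ M - + 2 * s
          k′ = solve-∀

        A≡ : A ≡ D L m (s + 1ℤ) + Z
        A≡ = trans (pascal₂ (E₁ + u) (a - 1ℤ) u b v exc₂) (cong₂ _+_
            (t₂-cong (k₁ L s) (k₂ M s) (k₃ L s) (k₄ M s) (k₅ L s) m)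
            (t₂-cong {u = a - 1ℤ} {u} {b - 1ℤ} {v} (k₆ L s) refl refl refl refl m))
          where
          k₁ : ∀ L s → s * (+ 2 * 1ℤ * s + 1ℤ - + 2 * 0ℤ) + (L + s) ≡ (+ 2 * (s + 1ℤ) - 1ℤ) * (1ℤ * (s + 1ℤ) - 0ℤ) + (L - (s + 1ℤ))
          k₁ = solve-∀
          k₂ : ∀ M s → M - + 2 * s - 1ℤ ≡ M - + 2 * (s + 1ℤ) + 1ℤ
          k₂ = solve-∀
          k₃ : ∀ L s → L + s ≡ L + (s + 1ℤ) - 1ℤ
          k₃ = solve-∀
          k₄ : ∀ M s → M + + 2 * s ≡ M + + 2 * (s + 1ℤ) - + 2
          k₄ = solve-∀
          k₅ : ∀ L s → L - s - 1ℤ ≡ L - (s + 1ℤ)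
          k₅ = solve-∀
          k₆ : ∀ L s → s * (+ 2 * 1ℤ * s + 1ℤ - + 2 * 0ℤ) + (L + s) + (L - s) ≡ s * (+ 2 * 1ℤ * s + 1ℤ - + 2 * 0ℤ) + + 2 * L
          k₆ = solve-∀

        C≡ : C ≡ Bₛ + Z
        C≡ = trans (pascal₁ (E₂ + u) a u (b - 1ℤ) v exc₁) (cong₂ _+_
            (t₂-cong {u = a} {u - 1ℤ} {b - 1ℤ} {v} (k₁ L s) refl refl refl refl m)
            (t₂-cong {u = a - 1ℤ} {u} {b - 1ℤ} {v} (k₂ L s) refl refl refl refl m))
          where
          k₁ : ∀ L s → (+ 2 * s - 1ℤ) * (1ℤ * s - 0ℤ) + (L + s) ≡ s * (+ 2 * 1ℤ * s + 1ℤ - + 2 * 0ℤ) + (L - s)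
          k₁ = solve-∀
          k₂ : ∀ L s → (+ 2 * s - 1ℤ) * (1ℤ * s - 0ℤ) + (L + s) + (L + s) ≡ s * (+ 2 * 1ℤ * s + 1ℤ - + 2 * 0ℤ) + + 2 * L
          k₂ = solve-∀

        -- Lowering L in both factors leaves the remainders A + `Bₛ` for `r₁` and D(s) + C for `r₂`.
        -- One more use of Pascal's rule gives A = D(s+1) + Z and C = `Bₛ` + Z, so in the difference
        -- all but D(s+1) - D(s) cancels.
        step : r₁ L m s - r₂ L m s ≡ (r₁ (L - 1ℤ) m s - r₂ (L - 1ℤ) m s) + (D L m (s + 1ℤ) - D L m s)
        step = trans (cong₂ _-_ (trans r₁-step (+-congˡ (r₁ (L - 1ℤ) m s + Bₛ) A≡)) (trans r₂-step (+-congˡ (r₂ (L - 1ℤ) m s + D L m s) C≡)))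
          (k (r₁ (L - 1ℤ) m s) (r₂ (L - 1ℤ) m s) Bₛ (D L m (s + 1ℤ)) (D L m s) Z)
          where
          k : ∀ r r′ b d′ d z → ((r + b) + (d′ + z)) - ((r′ + d) + (b + z)) ≡ (r - r′) + (d′ - d)
          k = solve-∀

    -- The telescoping sum of D has its ends at s = -B and s = B + 1, where a binomial has the
    -- argument L - B - 1, negative for L ≤ B.
    R-step : ∀ L → NN (L - 1ℤ) → NN (+ B - L) → R 1ℤ 0ℤ B L M ≗ R 1ℤ 0ℤ B (L - 1ℤ) M
    R-step L L≥1 B≥L m = begin
      R 1ℤ 0ℤ B L M m
        ≡⟨ Σℤ-cong B (step L L≥1 m) ⟩
      Σℤ B (λ s → (r₁ (L - 1ℤ) m s - r₂ (L - 1ℤ) m s) + (D L m (s + 1ℤ) - D L m s))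
        ≡⟨ Σℤ-+ B (λ s → r₁ (L - 1ℤ) m s - r₂ (L - 1ℤ) m s) (λ s → D L m (s + 1ℤ) - D L m s) ⟩
      R 1ℤ 0ℤ B (L - 1ℤ) M m + Σℤ B (λ s → D L m (s + 1ℤ) - D L m s)
        ≡⟨ +-congˡ (R 1ℤ 0ℤ B (L - 1ℤ) M m) telescope ⟩
      R 1ℤ 0ℤ B (L - 1ℤ) M m + 0ℤ
        ≡⟨ ℤₚ.+-identityʳ _ ⟩
      R 1ℤ 0ℤ B (L - 1ℤ) M m ∎
      where
      open ≡-Reasoning
      low : ∀ L B → L + - B - 1ℤ + (B - L) ≡ - 1ℤ
      low = solve-∀
      high : ∀ L B → L - (1ℤ + B) + (B - L) ≡ - 1ℤ
      high = solve-∀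
      D-low : D L m (- + B) ≡ 0ℤ
      D-low = t₂-vanish (e₂ 1ℤ 0ℤ (- + B) + (L - - + B)) (M - + 2 * - + B + 1ℤ) (L + - + B - 1ℤ) (M + + 2 * - + B - + 2) (L - - + B)
        (λ _ p _ _ → nn-absurd (nn-+ p B≥L) (low L (+ B))) m
      D-high : D L m (+ suc B) ≡ 0ℤ
      D-high = t₂-vanish (e₂ 1ℤ 0ℤ (+ suc B) + (L - + suc B)) (M - + 2 * + suc B + 1ℤ) (L + + suc B - 1ℤ) (M + + 2 * + suc B - + 2) (L - + suc B)
        (λ _ _ _ p → nn-absurd (nn-+ p B≥L) (high L (+ B))) m
      telescope : Σℤ B (λ s → D L m (s + 1ℤ) - D L m s) ≡ 0ℤ
      telescope = trans (Σℤ-- B (λ s → D L m (s + 1ℤ)) (D L m))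
        (trans (cong (_- Σℤ B (D L m)) (Σℤ-shift₀ B (D L m) D-low D-high)) (x-x (Σℤ B (D L m))))

  -- At L = 0 only s = 0 survives. Its even term is 1; its odd term is 1 for M > 0, but for M = 0 it
  -- contains the argument M - 1 = -1 and vanishes.
  R-base : ∀ B M → R 1ℤ 0ℤ B 0ℤ (+ M) ≗ δ M
  R-base B M m = trans (+-congˡ (r 0ℤ) (∑-zero B (λ t → cong₂ _+_ (off (+ suc t) (λ ())) (off -[1+ t ] (λ ()))))) (trans (ℤₚ.+-identityʳ _) (on M))
    where
    r₁ r₂ r : ℤ → ℤ
    r₁ s = mon (e₁ 1ℤ 0ℤ s) (R₁ 1ℤ 0ℤ 0ℤ (+ M) s) m
    r₂ s = mon (e₂ 1ℤ 0ℤ s) (R₂ 1ℤ 0ℤ 0ℤ (+ M) s) m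
    r s = r₁ s - r₂ s
    lem₁ : ∀ s → 0ℤ + 1ℤ * s ≡ s
    lem₁ = solve-∀
    lem₂ : ∀ s → 0ℤ - 1ℤ * s ≡ - s
    lem₂ = solve-∀
    lem₃ : ∀ s → 0ℤ + 1ℤ * s - 0ℤ ≡ s
    lem₃ = solve-∀
    lem₄ : ∀ s → 0ℤ - 1ℤ * s + 0ℤ ≡ - s
    lem₄ = solve-∀
    off : ∀ s → s ≢ 0ℤ → r s ≡ 0ℤ
    off s s≢0 = cong₂ _-_
      (t₂-vanish (e₁ 1ℤ 0ℤ s) (+ M - + 2 * s) (0ℤ + 1ℤ * s) (+ M + + 2 * s) (0ℤ - 1ℤ * s) (λ _ p _ q → s≢0 (nn-antisym s (nn-≡ p (lem₁ s)) (nn-≡ q (lem₂ s)))) m)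
      (t₂-vanish (e₂ 1ℤ 0ℤ s) (+ M - + 2 * s + 1ℤ) (0ℤ + 1ℤ * s - 0ℤ) (+ M + + 2 * s - 1ℤ) (0ℤ - 1ℤ * s + 0ℤ) (λ _ p _ q → s≢0 (nn-antisym s (nn-≡ p (lem₃ s)) (nn-≡ q (lem₄ s)))) m)
    on : ∀ M → mon (e₁ 1ℤ 0ℤ 0ℤ) (R₁ 1ℤ 0ℤ 0ℤ (+ M) 0ℤ) m - mon (e₂ 1ℤ 0ℤ 0ℤ) (R₂ 1ℤ 0ℤ 0ℤ (+ M) 0ℤ) m ≡ δ M m
    on zero    = trans (cong₂ _-_ (trans (mon-0 (1ₚ *ₚ 1ₚ) m) (*ₚ-identityˡ 1ₚ m)) (mon-zero 0ℤ (*ₚ-zeroʳ 1ₚ ≗-refl) m)) (ℤₚ.+-identityʳ (1ₚ m))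
    on (suc M) = trans (cong₂ _-_ (one (suc M ℕ.+ 0) (suc M ℕ.+ 0)) (one (suc M ℕ.+ 0 ℕ.+ 1) (M ℕ.+ 0))) (x-x (1ₚ m))
      where
      one : ∀ u v → mon 0ℤ (Γℕ u 0 *ₚ Γℕ v 0) m ≡ 1ₚ m
      one u v = trans (mon-0 (Γℕ u 0 *ₚ Γℕ v 0) m) (trans (cong₂ (λ f g → (f *ₚ g) m) (Γℕ-zeroʳ u) (Γℕ-zeroʳ v)) (*ₚ-identityˡ 1ₚ m))

  R₁₀≡δ : ∀ B L M → L ℕ.≤ B → R 1ℤ 0ℤ B (+ L) (+ M) ≗ δ M
  R₁₀≡δ B zero    M L≤B   = R-base B M
  R₁₀≡δ B (suc L) M L<B m = trans (R-step B (+ M) (nn M) (+ suc L) (nn L) (ℤₚ.i≤j⇒0≤j-i (+≤+ L<B)) m) (R₁₀≡δ B L M (ℕₚ.<⇒≤ L<B) m)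

-- The Burge transform, its shifted version, and their limits.

module BurgeTransform where

  open PowerSeries
  open GaussianBinomials
  open Summations
  open BosonicSums
  open BosonicForms
  open import Data.Integer using (ℤ; +_; _+_; _*_; _-_; -_; 1ℤ)

  -- Two parameters are kept because the recurrence for cylindric partitions lowers a and b
  -- separately. The first family sits at the translates (a + K s, b - K s); up to the symmetry of
  -- `Γ` the second sits at the reflected points (b + K s - i, a - K s + i).
  H : (K i : ℤ) (B : ℕ) (a b : ℤ) → PS
  H K i B a b = Bos K i B (λ s → Γ (a + K * s) (b - K * s)) (λ s → Γ (a - K * s + i) (b + K * s - i))

  private
    ∑-- : ∀ n (f g : ℕ → ℤ) → ∑ n (λ t → f t - g t) ≡ ∑ n f - ∑ n g
    ∑-- n f g = trans (∑-+ n f (λ t → - g t)) (+-congˡ (∑ n f) (∑-neg n g))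

    -- Both identities below also hold for negative X or Y, provided that this does not happen
    -- while the right-hand side is nonzero.
    Adm : (X Y d : ℤ) → Set
    Adm X Y d = NN (X + d) → NN (Y - d) → NN X × NN Y

    adm? : ∀ X Y d → Adm X Y d → (NN X × NN Y) ⊎ (NN (X + d) → NN (Y - d) → ⊥)
    adm? X Y d adm with sign? (X + d) | sign? (Y - d)
    ... | inj₁ p | inj₁ q = inj₁ (adm p q)
    ... | inj₂ p | _      = inj₂ (λ p′ _ → sign-absurd p′ p)
    ... | inj₁ _ | inj₂ q = inj₂ (λ _ q′ → sign-absurd q′ q)

    sum-U : ∀ x b c X → x + c + (X - x + b) ≡ X + (b + c)
    sum-U = solve-∀
    sum-V : ∀ x b c Y → x - b + (Y - x - c) ≡ Y - (b + c)
    sum-V = solve-∀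
    assoc-U : ∀ X b c → X + b + c ≡ X + (b + c)
    assoc-U = solve-∀
    assoc-V : ∀ Y b c → Y - b - c ≡ Y - (b + c)
    assoc-V = solve-∀

  saalschütz′ : ∀ X Y b c M e m → Adm X Y (b + c) → NN b ⊎ NN (- c) →
    ∑ (suc M) (λ x → t₃ (e + (+ x - b) * (+ x + c)) (+ M - + x) (X + Y) (+ x - b) (X - + x + b) (+ x + c) (Y - + x - c) m)
      ≡ t₂ e (+ M - b) (X + b + c) (+ M + c) (Y - b - c) m
  saalschütz′ X Y b c M e m adm supp with adm? X Y (b + c) adm
  ... | inj₁ (X≥0 , Y≥0) = trans (∑-cong (suc M) (λ x → sym (t₃-rotate (e + (+ x - b) * (+ x + c)) (+ x - b) (X - + x + b) (+ x + c) (Y - + x - c) (+ M - + x) (X + Y) m)))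
                             (saalschütz X Y b c M M e m X≥0 Y≥0 supp ℕₚ.≤-refl)
  ... | inj₂ neg = trans (∑-zero (suc M) (λ x → mon-zero (e + (+ x - b) * (+ x + c)) (*ₚ-zeroʳ (Γ (+ M - + x) (X + Y))
            (ΓΓ-vanish (+ x - b) (X - + x + b) (+ x + c) (Y - + x - c)
              (λ p q r s → neg (nn-≡ (nn-+ r q) (sum-U (+ x) b c X)) (nn-≡ (nn-+ p s) (sum-V (+ x) b c Y))))) m))
        (sym (t₂-vanish e (+ M - b) (X + b + c) (+ M + c) (Y - b - c)
              (λ _ p _ q → neg (nn-≡ p (assoc-U X b c)) (nn-≡ q (assoc-V Y b c))) m))

  vandermonde′ : ∀ X Y b c I e m → Adm X Y (b + c) → NN b ⊎ NN (- c) → NN (+ I - X - b) ⊎ NN (+ I - Y + c) →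
    vandSum Y c I X b e m ≡ t₁ e (X + b + c) (Y - b - c) m
  vandermonde′ X Y b c I e m adm supp bound with adm? X Y (b + c) adm
  ... | inj₁ (X≥0 , Y≥0) = vandermonde Y c I X b e m X≥0 Y≥0 supp bound
  ... | inj₂ neg = trans (∑-zero (suc I) (λ x → t₂-vanish (e + (+ x - b) * (+ x + c)) (+ x - b) (X - + x + b) (+ x + c) (Y - + x - c)
              (λ p q r s → neg (nn-≡ (nn-+ r q) (sum-U (+ x) b c X)) (nn-≡ (nn-+ p s) (sum-V (+ x) b c Y))) m))
        (sym (t₁-vanish e (X + b + c) (Y - b - c) (λ p q → neg (nn-≡ p (assoc-U X b c)) (nn-≡ q (assoc-V Y b c))) m))

  -- The Burge transform (L, M) ↦ Σₓ q^(x²) [M-x+2L ; 2L] (L-x, x) and its limit M → ∞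

  module _ {K i : ℤ} (i≥0 : NN i) (K≥2i : NN (K - + 2 * i)) where

    private
      K≥0 : NN K
      K≥0 = nn-≡ (nn-+ K≥2i (nn-* (nn 2) i≥0)) (lem K i)
        where
        lem : ∀ K i → K - + 2 * i + + 2 * i ≡ K
        lem = solve-∀

      module _ (L s : ℤ) where

        adm₁-l₁ : ∀ K L s → L - K * s + + 2 * s - (+ 2 * s + + 2 * s) + + 2 * (K * s) ≡ L + K * s - + 2 * s
        adm₁-l₁ = solve-∀
        adm₁-l₂ : ∀ K L s → L - K * s + + 2 * s - (+ 2 * s + + 2 * s) + + 4 * s ≡ L - K * s + + 2 * s
        adm₁-l₂ = solve-∀
        adm₁-l₃ : ∀ K L s → L + K * s - + 2 * s + (+ 2 * s + + 2 * s) + (+ 4 * (- 1ℤ - s) + + 4) ≡ L + K * s - + 2 * s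
        adm₁-l₃ = solve-∀
        adm₁-l₄ : ∀ K L s → L + K * s - + 2 * s + (+ 2 * s + + 2 * s) + + 2 * (K * (- 1ℤ - s + 1ℤ)) ≡ L - K * s + + 2 * s
        adm₁-l₄ = solve-∀

        adm₁ : Adm (L + K * s - + 2 * s) (L - K * s + + 2 * s) (+ 2 * s + + 2 * s)
        -- For s ≥ 0 both X and Y are at least Y - d, and for s < 0 both are at least X + d.
        adm₁ U≥0 V≥0 with sign? s
        ... | inj₁ s≥0 = nn-≡ (nn-+ V≥0 (nn-* (nn 2) (nn-* K≥0 s≥0))) (adm₁-l₁ K L s) , nn-≡ (nn-+ V≥0 (nn-* (nn 4) s≥0)) (adm₁-l₂ K L s)
        ... | inj₂ s<0 = nn-≡ (nn-+ U≥0 (nn-+ (nn-* (nn 4) s<0) (nn 4))) (adm₁-l₃ K L s) , nn-≡ (nn-+ U≥0 (nn-* (nn 2) (nn-* K≥0 (nn-+ s<0 (nn 1))))) (adm₁-l₄ K L s)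

        supp₁-l : ∀ s → + 2 * (- 1ℤ - s + 1ℤ) ≡ - (+ 2 * s)
        supp₁-l = solve-∀

        supp₁ : NN (+ 2 * s) ⊎ NN (- (+ 2 * s))
        supp₁ = by-sign s (λ s≥0 → inj₁ (nn-* (nn 2) s≥0)) (λ s<0 → inj₂ (nn-≡ (nn-* (nn 2) (nn-+ s<0 (nn 1))) (supp₁-l s)))

        adm₂-l₁ : ∀ K L i s → L - K * s + i + (+ 2 * s - 1ℤ) - ((+ 2 * s - 1ℤ) + (+ 2 * s - 1ℤ)) + + 2 * (K * (s - 1ℤ) + ((K - + 2 * i) + i)) ≡ L + K * s - i - (+ 2 * s - 1ℤ)
        adm₂-l₁ = solve-∀
        adm₂-l₂ : ∀ K L i s → L - K * s + i + (+ 2 * s - 1ℤ) - ((+ 2 * s - 1ℤ) + (+ 2 * s - 1ℤ)) + (+ 4 * (s - 1ℤ) + + 2) ≡ L - K * s + i + (+ 2 * s - 1ℤ)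
        adm₂-l₂ = solve-∀
        adm₂-l₃ : ∀ K L i s → L + K * s - i - (+ 2 * s - 1ℤ) + ((+ 2 * s - 1ℤ) + (+ 2 * s - 1ℤ)) + (+ 4 * (- 1ℤ - (s - 1ℤ)) + + 2) ≡ L + K * s - i - (+ 2 * s - 1ℤ)
        adm₂-l₃ = solve-∀
        adm₂-l₄ : ∀ K L i s → L + K * s - i - (+ 2 * s - 1ℤ) + ((+ 2 * s - 1ℤ) + (+ 2 * s - 1ℤ)) + + 2 * (K * (- 1ℤ - (s - 1ℤ)) + i) ≡ L - K * s + i + (+ 2 * s - 1ℤ)
        adm₂-l₄ = solve-∀

        adm₂ : Adm (L + K * s - i - (+ 2 * s - 1ℤ)) (L - K * s + i + (+ 2 * s - 1ℤ)) ((+ 2 * s - 1ℤ) + (+ 2 * s - 1ℤ))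
        adm₂ U≥0 V≥0 with sign? (s - 1ℤ)
        ... | inj₁ s≥1 = nn-≡ (nn-+ V≥0 (nn-* (nn 2) (nn-+ (nn-* K≥0 s≥1) (nn-+ K≥2i i≥0)))) (adm₂-l₁ K L i s) , nn-≡ (nn-+ V≥0 (nn-+ (nn-* (nn 4) s≥1) (nn 2))) (adm₂-l₂ K L i s)
        ... | inj₂ s≤0 = nn-≡ (nn-+ U≥0 (nn-+ (nn-* (nn 4) s≤0) (nn 2))) (adm₂-l₃ K L i s) , nn-≡ (nn-+ U≥0 (nn-* (nn 2) (nn-+ (nn-* K≥0 s≤0) i≥0))) (adm₂-l₄ K L i s)

        supp₂-l₁ : ∀ s → + 2 * (s - 1ℤ) + 1ℤ ≡ + 2 * s - 1ℤ
        supp₂-l₁ = solve-∀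
        supp₂-l₂ : ∀ s → + 2 * (- 1ℤ - (s - 1ℤ)) + 1ℤ ≡ - (+ 2 * s - 1ℤ)
        supp₂-l₂ = solve-∀

        supp₂ : NN (+ 2 * s - 1ℤ) ⊎ NN (- (+ 2 * s - 1ℤ))
        supp₂ = by-sign (s - 1ℤ) (λ s≥1 → inj₁ (nn-≡ (nn-+ (nn-* (nn 2) s≥1) (nn 1)) (supp₂-l₁ s))) (λ s≤0 → inj₂ (nn-≡ (nn-+ (nn-* (nn 2) s≤0) (nn 1)) (supp₂-l₂ s)))

      exp₁ : ∀ x s → + (x ℕ.* x) + e₁ K i s ≡ e₁ (K + + 2) (i + 1ℤ) s + (+ x - + 2 * s) * (+ x + + 2 * s)
      exp₁ x s = trans (cong (_+ e₁ K i s) (ℤₚ.pos-* x x)) (l (+ x) K i s)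
        where
        l : ∀ x K i s → x * x + s * (+ 2 * K * s + K - + 2 * i) ≡ s * (+ 2 * (K + + 2) * s + (K + + 2) - + 2 * (i + 1ℤ)) + (x - + 2 * s) * (x + + 2 * s)
        l = solve-∀

      exp₂ : ∀ x s → + (x ℕ.* x) + e₂ K i s ≡ e₂ (K + + 2) (i + 1ℤ) s + (+ x - (+ 2 * s - 1ℤ)) * (+ x + (+ 2 * s - 1ℤ))
      exp₂ x s = trans (cong (_+ e₂ K i s) (ℤₚ.pos-* x x)) (l (+ x) K i s)
        where
        l : ∀ x K i s → x * x + (+ 2 * s - 1ℤ) * (K * s - i) ≡ (+ 2 * s - 1ℤ) * ((K + + 2) * s - (i + 1ℤ)) + (x - (+ 2 * s - 1ℤ)) * (x + (+ 2 * s - 1ℤ))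
        l = solve-∀

      a₁ : ∀ L K x s → L - x + K * s ≡ L + K * s - + 2 * s - x + + 2 * s
      a₁ = solve-∀
      a₂ : ∀ L K x s → L - x - K * s ≡ L - K * s + + 2 * s - x - + 2 * s
      a₂ = solve-∀
      a₃ : ∀ L K i x s → L - x + K * s - i ≡ L + K * s - i - (+ 2 * s - 1ℤ) - x + (+ 2 * s - 1ℤ)
      a₃ = solve-∀
      a₄ : ∀ L K i x s → L - x - K * s + i ≡ L - K * s + i + (+ 2 * s - 1ℤ) - x - (+ 2 * s - 1ℤ)
      a₄ = solve-∀
      a₅ : ∀ x s → x - + 2 * s + 1ℤ ≡ x - (+ 2 * s - 1ℤ)
      a₅ = solve-∀
      a₆ : ∀ x s → x + + 2 * s - 1ℤ ≡ x + (+ 2 * s - 1ℤ)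
      a₆ = solve-∀
      u₁ : ∀ L K s → L + K * s - + 2 * s + + 2 * s + + 2 * s ≡ L + (K + + 2) * s
      u₁ = solve-∀
      v₁ : ∀ L K s → L - K * s + + 2 * s - + 2 * s - + 2 * s ≡ L - (K + + 2) * s
      v₁ = solve-∀
      u₂ : ∀ L K i s → L + K * s - i - (+ 2 * s - 1ℤ) + (+ 2 * s - 1ℤ) + (+ 2 * s - 1ℤ) ≡ L + (K + + 2) * s - (i + 1ℤ)
      u₂ = solve-∀
      v₂ : ∀ L K i s → L - K * s + i + (+ 2 * s - 1ℤ) - (+ 2 * s - 1ℤ) - (+ 2 * s - 1ℤ) ≡ L - (K + + 2) * s + (i + 1ℤ)
      v₂ = solve-∀

    -- For each s this is q-Pfaff-Saalschütz with b = c = r, X = L + a - r and Y = L - a + r, so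
    -- that X + Y = 2L is the lower entry of the extra binomial. Since x² = (x-r)(x+r) + r², the new
    -- data a + r and e + r² are those of K + 2 and i + 1.
    burge : ∀ B L M m →
      ∑ (suc M) (λ x → (Γ (+ M - + x) (+ 2 * L) *ₚ shiftₚ (x ℕ.* x) (R K i B (L - + x) (+ x))) m)
        ≡ R (K + + 2) (i + 1ℤ) B L (+ M) m
    burge B L M m = begin
      ∑ (suc M) (λ x → (W x *ₚ shiftₚ (x ℕ.* x) (R K i B (L - + x) (+ x))) m)
        ≡⟨ ∑-cong (suc M) (λ x → *ₚ-shift-Bos {K} {i} i≥0 K≥2i (W x) B (x ℕ.* x) (R₁ K i (L - + x) (+ x)) (R₂ K i (L - + x) (+ x)) m) ⟩
      ∑ (suc M) (λ x → Σℤ B (λ s → f x s - g x s))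
        ≡⟨ ∑-Σℤ-swap (suc M) B (λ x s → f x s - g x s) ⟩
      Σℤ B (λ s → ∑ (suc M) (λ x → f x s - g x s))
        ≡⟨ Σℤ-cong B (λ s → trans (∑-- (suc M) (λ x → f x s) (λ x → g x s)) (cong₂ _-_ (first s) (second s))) ⟩
      R (K + + 2) (i + 1ℤ) B L (+ M) m ∎
      where
      open ≡-Reasoning
      W : ℕ → PS
      W x = Γ (+ M - + x) (+ 2 * L)
      f g : ℕ → ℤ → ℤ
      f x s = mon (+ (x ℕ.* x) + e₁ K i s) (W x *ₚ R₁ K i (L - + x) (+ x) s) m
      g x s = mon (+ (x ℕ.* x) + e₂ K i s) (W x *ₚ R₂ K i (L - + x) (+ x) s) m
      n₁ : ∀ L K s → + 2 * L ≡ L + K * s - + 2 * s + (L - K * s + + 2 * s)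
      n₁ = solve-∀
      n₂ : ∀ L K i s → + 2 * L ≡ L + K * s - i - (+ 2 * s - 1ℤ) + (L - K * s + i + (+ 2 * s - 1ℤ))
      n₂ = solve-∀
      first : ∀ s → ∑ (suc M) (λ x → f x s) ≡ mon (e₁ (K + + 2) (i + 1ℤ) s) (R₁ (K + + 2) (i + 1ℤ) L (+ M) s) m
      first s = trans
        (∑-cong (suc M) (λ x → t₃-cong {u = + M - + x} {w = + x - + 2 * s} {y = + x + + 2 * s} (exp₁ x s) refl (n₁ L K s) refl (a₁ L K (+ x) s) refl (a₂ L K (+ x) s) m))
        (trans (saalschütz′ (L + K * s - + 2 * s) (L - K * s + + 2 * s) (+ 2 * s) (+ 2 * s) M (e₁ (K + + 2) (i + 1ℤ) s) m (adm₁ L s) (supp₁ L s))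
          (t₂-cong {e₁ (K + + 2) (i + 1ℤ) s} {+ M - + 2 * s} {w = + M + + 2 * s} refl refl (u₁ L K s) refl (v₁ L K s) m))
      second : ∀ s → ∑ (suc M) (λ x → g x s) ≡ mon (e₂ (K + + 2) (i + 1ℤ) s) (R₂ (K + + 2) (i + 1ℤ) L (+ M) s) m
      second s = trans
        (∑-cong (suc M) (λ x → t₃-cong {u = + M - + x} (exp₂ x s) refl (n₂ L K i s) (a₅ (+ x) s) (a₃ L K i (+ x) s) (a₆ (+ x) s) (a₄ L K i (+ x) s) m))
        (trans (saalschütz′ (L + K * s - i - (+ 2 * s - 1ℤ)) (L - K * s + i + (+ 2 * s - 1ℤ)) (+ 2 * s - 1ℤ) (+ 2 * s - 1ℤ) M (e₂ (K + + 2) (i + 1ℤ) s) m (adm₂ L s) (supp₂ L s))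
          (t₂-cong {e₂ (K + + 2) (i + 1ℤ) s} refl (sym (a₅ (+ M) s)) (u₂ L K i s) (sym (a₆ (+ M) s)) (v₂ L K i s) m))

    -- The range I ≥ L suffices: the terms end at x = X + b = L + a and at x = Y - c = L - a, and
    -- one of the two is at most L.
    burge∞ : ∀ B L I m → NN (+ I - L) →
      ∑ (suc I) (λ x → shiftₚ (x ℕ.* x) (R K i B (L - + x) (+ x)) m) ≡ H (K + + 2) (i + 1ℤ) B L L m
    burge∞ B L I m I≥L = begin
      ∑ (suc I) (λ x → shiftₚ (x ℕ.* x) (R K i B (L - + x) (+ x)) m)
        ≡⟨ ∑-cong (suc I) (λ x → shift-Bos {K} {i} i≥0 K≥2i B (x ℕ.* x) (R₁ K i (L - + x) (+ x)) (R₂ K i (L - + x) (+ x)) m) ⟩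
      ∑ (suc I) (λ x → Σℤ B (λ s → f x s - g x s))
        ≡⟨ ∑-Σℤ-swap (suc I) B (λ x s → f x s - g x s) ⟩
      Σℤ B (λ s → ∑ (suc I) (λ x → f x s - g x s))
        ≡⟨ Σℤ-cong B (λ s → trans (∑-- (suc I) (λ x → f x s) (λ x → g x s)) (cong₂ _-_ (first s) (second s))) ⟩
      H (K + + 2) (i + 1ℤ) B L L m ∎
      where
      open ≡-Reasoning
      f g : ℕ → ℤ → ℤ
      f x s = mon (+ (x ℕ.* x) + e₁ K i s) (R₁ K i (L - + x) (+ x) s) m
      g x s = mon (+ (x ℕ.* x) + e₂ K i s) (R₂ K i (L - + x) (+ x) s) m
      bound : ∀ X b Y c y → + I - X - b ≡ + I - L + (- 1ℤ - y + 1ℤ) → + I - Y + c ≡ + I - L + y → NN (+ I - X - b) ⊎ NN (+ I - Y + c)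
      bound X b Y c y p q = by-sign y (λ y≥0 → inj₂ (nn-≡ (nn-+ I≥L y≥0) (sym q))) (λ y<0 → inj₁ (nn-≡ (nn-+ I≥L (nn-+ y<0 (nn 1))) (sym p)))
      b₁ : ∀ I L K s → I - (L + K * s - + 2 * s) - + 2 * s ≡ I - L + (- 1ℤ - K * s + 1ℤ)
      b₁ = solve-∀
      b₂ : ∀ I L K s → I - (L - K * s + + 2 * s) + + 2 * s ≡ I - L + K * s
      b₂ = solve-∀
      b₃ : ∀ I L K i s → I - (L + K * s - i - (+ 2 * s - 1ℤ)) - (+ 2 * s - 1ℤ) ≡ I - L + (- 1ℤ - (K * s - i) + 1ℤ)
      b₃ = solve-∀
      b₄ : ∀ I L K i s → I - (L - K * s + i + (+ 2 * s - 1ℤ)) + (+ 2 * s - 1ℤ) ≡ I - L + (K * s - i)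
      b₄ = solve-∀
      first : ∀ s → ∑ (suc I) (λ x → f x s) ≡ t₁ (e₁ (K + + 2) (i + 1ℤ) s) (L + (K + + 2) * s) (L - (K + + 2) * s) m
      first s = trans
        (∑-cong (suc I) (λ x → t₂-cong {u = + x - + 2 * s} {w = + x + + 2 * s} (exp₁ x s) refl (a₁ L K (+ x) s) refl (a₂ L K (+ x) s) m))
        (trans (vandermonde′ (L + K * s - + 2 * s) (L - K * s + + 2 * s) (+ 2 * s) (+ 2 * s) I (e₁ (K + + 2) (i + 1ℤ) s) m (adm₁ L s) (supp₁ L s)
                 (bound (L + K * s - + 2 * s) (+ 2 * s) (L - K * s + + 2 * s) (+ 2 * s) (K * s) (b₁ (+ I) L K s) (b₂ (+ I) L K s)))
          (t₁-cong {e₁ (K + + 2) (i + 1ℤ) s} refl (u₁ L K s) (v₁ L K s) m))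
      second : ∀ s → ∑ (suc I) (λ x → g x s) ≡ t₁ (e₂ (K + + 2) (i + 1ℤ) s) (L - (K + + 2) * s + (i + 1ℤ)) (L + (K + + 2) * s - (i + 1ℤ)) m
      second s = trans
        (∑-cong (suc I) (λ x → t₂-cong (exp₂ x s) (a₅ (+ x) s) (a₃ L K i (+ x) s) (a₆ (+ x) s) (a₄ L K i (+ x) s) m))
        (trans (vandermonde′ (L + K * s - i - (+ 2 * s - 1ℤ)) (L - K * s + i + (+ 2 * s - 1ℤ)) (+ 2 * s - 1ℤ) (+ 2 * s - 1ℤ) I (e₂ (K + + 2) (i + 1ℤ) s) m (adm₂ L s) (supp₂ L s)
                 (bound (L + K * s - i - (+ 2 * s - 1ℤ)) (+ 2 * s - 1ℤ) (L - K * s + i + (+ 2 * s - 1ℤ)) (+ 2 * s - 1ℤ) (K * s - i) (b₃ (+ I) L K i s) (b₄ (+ I) L K i s)))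
          (trans (t₁-cong {e₂ (K + + 2) (i + 1ℤ) s} refl (u₂ L K i s) (v₂ L K i s) m)
            (mon-cong {e₂ (K + + 2) (i + 1ℤ) s} refl (Γ-sym (L + (K + + 2) * s - (i + 1ℤ)) (L - (K + + 2) * s + (i + 1ℤ))) m)))

  -- The transform with q^(x²+x) in place of q^(x²) and L-1-x in place of L-x

  module _ {K : ℤ} (K≥2 : NN (K - + 2)) {L : ℤ} (L≥1 : NN (L - 1ℤ)) where

    private
      K≥2·1 : NN (K - + 2 * 1ℤ)
      K≥2·1 = K≥2

      module _ (s : ℤ) where

        adm₁-l₁ : ∀ K L s → L - 1ℤ + (K - + 2) * s ≡ L - 1ℤ + K * s - + 2 * s
        adm₁-l₁ = solve-∀
        adm₁-l₂ : ∀ K L s → L - K * s + (+ 2 * s + 1ℤ) - (+ 2 * s + (+ 2 * s + 1ℤ)) + (+ 4 * s + 1ℤ) ≡ L - K * s + (+ 2 * s + 1ℤ)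
        adm₁-l₂ = solve-∀
        adm₁-l₃ : ∀ K L s → L - 1ℤ + K * s - + 2 * s + (+ 2 * s + (+ 2 * s + 1ℤ)) + (+ 4 * (- 1ℤ - s) + + 3) ≡ L - 1ℤ + K * s - + 2 * s
        adm₁-l₃ = solve-∀
        adm₁-l₄ : ∀ K L s → L - 1ℤ + + 2 + (K - + 2) * (- 1ℤ - s + 1ℤ) ≡ L - K * s + (+ 2 * s + 1ℤ)
        adm₁-l₄ = solve-∀

        adm₁ : Adm (L - 1ℤ + K * s - + 2 * s) (L - K * s + (+ 2 * s + 1ℤ)) (+ 2 * s + (+ 2 * s + 1ℤ))
        -- For s ≥ 0, X = L - 1 + (K-2)s is nonnegative because L ≥ 1 and K ≥ 2. At L = 0 and s = 0
        -- it would be -1, and the summation would fail there.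
        adm₁ U≥0 V≥0 with sign? s
        ... | inj₁ s≥0 = nn-≡ (nn-+ L≥1 (nn-* K≥2 s≥0)) (adm₁-l₁ K L s) , nn-≡ (nn-+ V≥0 (nn-+ (nn-* (nn 4) s≥0) (nn 1))) (adm₁-l₂ K L s)
        ... | inj₂ s<0 = nn-≡ (nn-+ U≥0 (nn-+ (nn-* (nn 4) s<0) (nn 3))) (adm₁-l₃ K L s) , nn-≡ (nn-+ (nn-+ L≥1 (nn 2)) (nn-* K≥2 (nn-+ s<0 (nn 1)))) (adm₁-l₄ K L s)

        supp₁-l : ∀ s → + 2 * (- 1ℤ - s) + 1ℤ ≡ - (+ 2 * s + 1ℤ)
        supp₁-l = solve-∀

        supp₁ : NN (+ 2 * s) ⊎ NN (- (+ 2 * s + 1ℤ))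
        supp₁ = by-sign s (λ s≥0 → inj₁ (nn-* (nn 2) s≥0)) (λ s<0 → inj₂ (nn-≡ (nn-+ (nn-* (nn 2) s<0) (nn 1)) (supp₁-l s)))

        adm₂-l₁ : ∀ K L s → L - 1ℤ + 1ℤ + (K - + 2) * (s - 1ℤ + 1ℤ) ≡ L - 1ℤ + K * s - (+ 2 * s - 1ℤ)
        adm₂-l₁ = solve-∀
        adm₂-l₂ : ∀ K L s → L - K * s + + 2 * s - ((+ 2 * s - 1ℤ) + + 2 * s) + (+ 4 * (s - 1ℤ) + + 3) ≡ L - K * s + + 2 * s
        adm₂-l₂ = solve-∀
        adm₂-l₃ : ∀ K L s → L - 1ℤ + K * s - (+ 2 * s - 1ℤ) + ((+ 2 * s - 1ℤ) + + 2 * s) + (+ 4 * (- 1ℤ - (s - 1ℤ)) + 1ℤ) ≡ L - 1ℤ + K * s - (+ 2 * s - 1ℤ)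
        adm₂-l₃ = solve-∀
        adm₂-l₄ : ∀ K L s → L - 1ℤ + 1ℤ + (K - + 2) * (- 1ℤ - (s - 1ℤ)) ≡ L - K * s + + 2 * s
        adm₂-l₄ = solve-∀

        adm₂ : Adm (L - 1ℤ + K * s - (+ 2 * s - 1ℤ)) (L - K * s + + 2 * s) ((+ 2 * s - 1ℤ) + + 2 * s)
        adm₂ U≥0 V≥0 with sign? (s - 1ℤ)
        ... | inj₁ s≥1 = nn-≡ (nn-+ (nn-+ L≥1 (nn 1)) (nn-* K≥2 (nn-+ s≥1 (nn 1)))) (adm₂-l₁ K L s) , nn-≡ (nn-+ V≥0 (nn-+ (nn-* (nn 4) s≥1) (nn 3))) (adm₂-l₂ K L s)
        ... | inj₂ s≤0 = nn-≡ (nn-+ U≥0 (nn-+ (nn-* (nn 4) s≤0) (nn 1))) (adm₂-l₃ K L s) , nn-≡ (nn-+ (nn-+ L≥1 (nn 1)) (nn-* K≥2 s≤0)) (adm₂-l₄ K L s)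

        supp₂-l₁ : ∀ s → + 2 * (s - 1ℤ) + 1ℤ ≡ + 2 * s - 1ℤ
        supp₂-l₁ = solve-∀
        supp₂-l₂ : ∀ s → + 2 * (- 1ℤ - (s - 1ℤ)) ≡ - (+ 2 * s)
        supp₂-l₂ = solve-∀

        supp₂ : NN (+ 2 * s - 1ℤ) ⊎ NN (- (+ 2 * s))
        supp₂ = by-sign (s - 1ℤ) (λ s≥1 → inj₁ (nn-≡ (nn-+ (nn-* (nn 2) s≥1) (nn 1)) (supp₂-l₁ s))) (λ s≤0 → inj₂ (nn-≡ (nn-* (nn 2) s≤0) (supp₂-l₂ s)))

      exp₁ : ∀ x s → + (x ℕ.* x ℕ.+ x) + e₁ K 1ℤ s ≡ e₁ (K + + 2) 1ℤ s + (+ x - + 2 * s) * (+ x + (+ 2 * s + 1ℤ))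
      exp₁ x s = trans (cong (λ z → z + + x + e₁ K 1ℤ s) (ℤₚ.pos-* x x)) (l (+ x) K s)
        where
        l : ∀ x K s → x * x + x + s * (+ 2 * K * s + K - + 2 * 1ℤ) ≡ s * (+ 2 * (K + + 2) * s + (K + + 2) - + 2 * 1ℤ) + (x - + 2 * s) * (x + (+ 2 * s + 1ℤ))
        l = solve-∀

      exp₂ : ∀ x s → + (x ℕ.* x ℕ.+ x) + e₂ K 1ℤ s ≡ e₂ (K + + 2) 1ℤ s + (+ x - (+ 2 * s - 1ℤ)) * (+ x + + 2 * s)
      exp₂ x s = trans (cong (λ z → z + + x + e₂ K 1ℤ s) (ℤₚ.pos-* x x)) (l (+ x) K s)
        where
        l : ∀ x K s → x * x + x + (+ 2 * s - 1ℤ) * (K * s - 1ℤ) ≡ (+ 2 * s - 1ℤ) * ((K + + 2) * s - 1ℤ) + (x - (+ 2 * s - 1ℤ)) * (x + + 2 * s)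
        l = solve-∀

      a₁ : ∀ L K x s → L - 1ℤ - x + K * s ≡ L - 1ℤ + K * s - + 2 * s - x + + 2 * s
      a₁ = solve-∀
      a₂ : ∀ L K x s → L - 1ℤ - x + 1ℤ - K * s ≡ L - K * s + (+ 2 * s + 1ℤ) - x - (+ 2 * s + 1ℤ)
      a₂ = solve-∀
      a₃ : ∀ L K x s → L - 1ℤ - x + K * s ≡ L - 1ℤ + K * s - (+ 2 * s - 1ℤ) - x + (+ 2 * s - 1ℤ)
      a₃ = solve-∀
      a₄ : ∀ L K x s → L - 1ℤ - x + 1ℤ - K * s ≡ L - K * s + + 2 * s - x - + 2 * s
      a₄ = solve-∀
      a₅ : ∀ x s → x - + 2 * s + 1ℤ ≡ x - (+ 2 * s - 1ℤ)
      a₅ = solve-∀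
      a₆ : ∀ x s → x + + 2 * s + 1ℤ ≡ x + (+ 2 * s + 1ℤ)
      a₆ = solve-∀
      u₁ : ∀ L K s → L - 1ℤ + K * s - + 2 * s + + 2 * s + (+ 2 * s + 1ℤ) ≡ L + (K + + 2) * s
      u₁ = solve-∀
      v₁ : ∀ L K s → L - K * s + (+ 2 * s + 1ℤ) - + 2 * s - (+ 2 * s + 1ℤ) ≡ L - (K + + 2) * s
      v₁ = solve-∀
      u₂ : ∀ L K s → L - 1ℤ + K * s - (+ 2 * s - 1ℤ) + (+ 2 * s - 1ℤ) + + 2 * s ≡ L + (K + + 2) * s - 1ℤ
      u₂ = solve-∀
      v₂ : ∀ L K s → L - K * s + + 2 * s - (+ 2 * s - 1ℤ) - + 2 * s ≡ L + 1ℤ - (K + + 2) * s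
      v₂ = solve-∀
      v₂′ : ∀ L K s → L - K * s + + 2 * s - (+ 2 * s - 1ℤ) - + 2 * s ≡ L - (K + + 2) * s + 1ℤ
      v₂′ = solve-∀

    -- Here b = r and c = r + 1, and x²+x = (x-r)(x+r+1) + r(r+1). The increment r(r+1) is the one
    -- that raises K by 2 and leaves i = 1; the entries X and Y again add up to 2L.
    burge¹ : ∀ B M m →
      ∑ (suc M) (λ x → (Γ (+ M - + x) (+ 2 * L) *ₚ shiftₚ (x ℕ.* x ℕ.+ x) (Q K B (L - 1ℤ - + x) (+ x))) m)
        ≡ P (K + + 2) B L (+ M) m
    burge¹ B M m = begin
      ∑ (suc M) (λ x → (W x *ₚ shiftₚ (x ℕ.* x ℕ.+ x) (Q K B (L - 1ℤ - + x) (+ x))) m)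
        ≡⟨ ∑-cong (suc M) (λ x → *ₚ-shift-Bos {K} {1ℤ} (nn 1) K≥2·1 (W x) B (x ℕ.* x ℕ.+ x) (Q₁ K (L - 1ℤ - + x) (+ x)) (Q₂ K (L - 1ℤ - + x) (+ x)) m) ⟩
      ∑ (suc M) (λ x → Σℤ B (λ s → f x s - g x s))
        ≡⟨ ∑-Σℤ-swap (suc M) B (λ x s → f x s - g x s) ⟩
      Σℤ B (λ s → ∑ (suc M) (λ x → f x s - g x s))
        ≡⟨ Σℤ-cong B (λ s → trans (∑-- (suc M) (λ x → f x s) (λ x → g x s)) (cong₂ _-_ (first s) (second s))) ⟩
      P (K + + 2) B L (+ M) m ∎
      where
      open ≡-Reasoning
      W : ℕ → PS
      W x = Γ (+ M - + x) (+ 2 * L)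
      f g : ℕ → ℤ → ℤ
      f x s = mon (+ (x ℕ.* x ℕ.+ x) + e₁ K 1ℤ s) (W x *ₚ Q₁ K (L - 1ℤ - + x) (+ x) s) m
      g x s = mon (+ (x ℕ.* x ℕ.+ x) + e₂ K 1ℤ s) (W x *ₚ Q₂ K (L - 1ℤ - + x) (+ x) s) m
      n₁ : ∀ L K s → + 2 * L ≡ L - 1ℤ + K * s - + 2 * s + (L - K * s + (+ 2 * s + 1ℤ))
      n₁ = solve-∀
      n₂ : ∀ L K s → + 2 * L ≡ L - 1ℤ + K * s - (+ 2 * s - 1ℤ) + (L - K * s + + 2 * s)
      n₂ = solve-∀
      first : ∀ s → ∑ (suc M) (λ x → f x s) ≡ mon (e₁ (K + + 2) 1ℤ s) (P₁ (K + + 2) L (+ M) s) m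
      first s = trans
        (∑-cong (suc M) (λ x → t₃-cong {u = + M - + x} {w = + x - + 2 * s} (exp₁ x s) refl (n₁ L K s) refl (a₁ L K (+ x) s) (a₆ (+ x) s) (a₂ L K (+ x) s) m))
        (trans (saalschütz′ (L - 1ℤ + K * s - + 2 * s) (L - K * s + (+ 2 * s + 1ℤ)) (+ 2 * s) (+ 2 * s + 1ℤ) M (e₁ (K + + 2) 1ℤ s) m (adm₁ s) (supp₁ s))
          (t₂-cong {e₁ (K + + 2) 1ℤ s} {+ M - + 2 * s} refl refl (u₁ L K s) (sym (a₆ (+ M) s)) (v₁ L K s) m))
      second : ∀ s → ∑ (suc M) (λ x → g x s) ≡ mon (e₂ (K + + 2) 1ℤ s) (P₂ (K + + 2) L (+ M) s) m
      second s = trans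
        (∑-cong (suc M) (λ x → t₃-cong {u = + M - + x} {y = + x + + 2 * s} (exp₂ x s) refl (n₂ L K s) (a₅ (+ x) s) (a₃ L K (+ x) s) refl (a₄ L K (+ x) s) m))
        (trans (saalschütz′ (L - 1ℤ + K * s - (+ 2 * s - 1ℤ)) (L - K * s + + 2 * s) (+ 2 * s - 1ℤ) (+ 2 * s) M (e₂ (K + + 2) 1ℤ s) m (adm₂ s) (supp₂ s))
          (t₂-cong {e₂ (K + + 2) 1ℤ s} {w = + M + + 2 * s} refl (sym (a₅ (+ M) s)) (u₂ L K s) refl (v₂ L K s) m))

    burge¹∞ : ∀ B I m → NN (+ I - L) →
      ∑ (suc I) (λ x → shiftₚ (x ℕ.* x ℕ.+ x) (Q K B (L - 1ℤ - + x) (+ x)) m) ≡ H (K + + 2) 1ℤ B L L m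
    burge¹∞ B I m I≥L = begin
      ∑ (suc I) (λ x → shiftₚ (x ℕ.* x ℕ.+ x) (Q K B (L - 1ℤ - + x) (+ x)) m)
        ≡⟨ ∑-cong (suc I) (λ x → shift-Bos {K} {1ℤ} (nn 1) K≥2·1 B (x ℕ.* x ℕ.+ x) (Q₁ K (L - 1ℤ - + x) (+ x)) (Q₂ K (L - 1ℤ - + x) (+ x)) m) ⟩
      ∑ (suc I) (λ x → Σℤ B (λ s → f x s - g x s))
        ≡⟨ ∑-Σℤ-swap (suc I) B (λ x s → f x s - g x s) ⟩
      Σℤ B (λ s → ∑ (suc I) (λ x → f x s - g x s))
        ≡⟨ Σℤ-cong B (λ s → trans (∑-- (suc I) (λ x → f x s) (λ x → g x s)) (cong₂ _-_ (first s) (second s))) ⟩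
      H (K + + 2) 1ℤ B L L m ∎
      where
      open ≡-Reasoning
      f g : ℕ → ℤ → ℤ
      f x s = mon (+ (x ℕ.* x ℕ.+ x) + e₁ K 1ℤ s) (Q₁ K (L - 1ℤ - + x) (+ x) s) m
      g x s = mon (+ (x ℕ.* x ℕ.+ x) + e₂ K 1ℤ s) (Q₂ K (L - 1ℤ - + x) (+ x) s) m
      bound : ∀ X b Y c y → + I - X - b ≡ + I - L + (- 1ℤ - y + + 2) → + I - Y + c ≡ + I - L + y → NN (+ I - X - b) ⊎ NN (+ I - Y + c)
      bound X b Y c y p q = by-sign y (λ y≥0 → inj₂ (nn-≡ (nn-+ I≥L y≥0) (sym q))) (λ y<0 → inj₁ (nn-≡ (nn-+ I≥L (nn-+ y<0 (nn 2))) (sym p)))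
      b₁ : ∀ I L K s → I - (L - 1ℤ + K * s - + 2 * s) - + 2 * s ≡ I - L + (- 1ℤ - K * s + + 2)
      b₁ = solve-∀
      b₂ : ∀ I L K s → I - (L - K * s + (+ 2 * s + 1ℤ)) + (+ 2 * s + 1ℤ) ≡ I - L + K * s
      b₂ = solve-∀
      b₃ : ∀ I L K s → I - (L - 1ℤ + K * s - (+ 2 * s - 1ℤ)) - (+ 2 * s - 1ℤ) ≡ I - L + (- 1ℤ - K * s + + 2)
      b₃ = solve-∀
      b₄ : ∀ I L K s → I - (L - K * s + + 2 * s) + + 2 * s ≡ I - L + K * s
      b₄ = solve-∀
      first : ∀ s → ∑ (suc I) (λ x → f x s) ≡ t₁ (e₁ (K + + 2) 1ℤ s) (L + (K + + 2) * s) (L - (K + + 2) * s) m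
      first s = trans
        (∑-cong (suc I) (λ x → t₂-cong {u = + x - + 2 * s} (exp₁ x s) refl (a₁ L K (+ x) s) (a₆ (+ x) s) (a₂ L K (+ x) s) m))
        (trans (vandermonde′ (L - 1ℤ + K * s - + 2 * s) (L - K * s + (+ 2 * s + 1ℤ)) (+ 2 * s) (+ 2 * s + 1ℤ) I (e₁ (K + + 2) 1ℤ s) m (adm₁ s) (supp₁ s)
                 (bound (L - 1ℤ + K * s - + 2 * s) (+ 2 * s) (L - K * s + (+ 2 * s + 1ℤ)) (+ 2 * s + 1ℤ) (K * s) (b₁ (+ I) L K s) (b₂ (+ I) L K s)))
          (t₁-cong {e₁ (K + + 2) 1ℤ s} refl (u₁ L K s) (v₁ L K s) m))
      second : ∀ s → ∑ (suc I) (λ x → g x s) ≡ t₁ (e₂ (K + + 2) 1ℤ s) (L - (K + + 2) * s + 1ℤ) (L + (K + + 2) * s - 1ℤ) m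
      second s = trans
        (∑-cong (suc I) (λ x → t₂-cong {w = + x + + 2 * s} (exp₂ x s) (a₅ (+ x) s) (a₃ L K (+ x) s) refl (a₄ L K (+ x) s) m))
        (trans (vandermonde′ (L - 1ℤ + K * s - (+ 2 * s - 1ℤ)) (L - K * s + + 2 * s) (+ 2 * s - 1ℤ) (+ 2 * s) I (e₂ (K + + 2) 1ℤ s) m (adm₂ s) (supp₂ s)
                 (bound (L - 1ℤ + K * s - (+ 2 * s - 1ℤ)) (+ 2 * s - 1ℤ) (L - K * s + + 2 * s) (+ 2 * s) (K * s) (b₃ (+ I) L K s) (b₄ (+ I) L K s)))
          (trans (t₁-cong {e₂ (K + + 2) 1ℤ s} refl (u₂ L K s) (v₂′ L K s) m)
            (mon-cong {e₂ (K + + 2) 1ℤ s} refl (Γ-sym (L + (K + + 2) * s - 1ℤ) (L - (K + + 2) * s + 1ℤ)) m)))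

-- Nested sums evaluated by iterating the transforms.

module Multisums where

  open PowerSeries
  open GaussianBinomials
  open Summations
  open BosonicSums
  open BosonicForms
  open BurgeTransform
  open import Data.Integer using (ℤ; +_; -[1+_]; _+_; _*_; _-_; -_; 0ℤ; 1ℤ; _≤_; +≤+)

  -- These are 2j + 3 and a + 1. The recursive form makes the parameters K + 2 and i + 1 produced by
  -- the transforms match by computation.
  modulus idx : ℕ → ℤ
  modulus zero    = + 3
  modulus (suc j) = modulus j + + 2
  idx zero    = 1ℤ
  idx (suc a) = idx a + 1ℤ

  modulus≥3 : ∀ j → NN (modulus j - + 3)
  modulus≥3 zero    = nn 0
  modulus≥3 (suc j) = nn-≡ (nn-+ (modulus≥3 j) (nn 2)) (lem (modulus j))
    where
    lem : ∀ K → K - + 3 + + 2 ≡ K + + 2 - + 3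
    lem = solve-∀

  modulus≥1 : ∀ j → NN (modulus j - 1ℤ)
  modulus≥1 j = nn-≡ (nn-+ (modulus≥3 j) (nn 2)) (lem (modulus j))
    where
    lem : ∀ K → K - + 3 + + 2 ≡ K - 1ℤ
    lem = solve-∀

  modulus≥2 : ∀ j → NN (modulus j - + 2)
  modulus≥2 j = nn-≡ (nn-+ (modulus≥3 j) (nn 1)) (lem (modulus j))
    where
    lem : ∀ K → K - + 3 + + 1 ≡ K - + 2
    lem = solve-∀

  idx≥0 : ∀ a → NN (idx a)
  idx≥0 zero    = nn 1
  idx≥0 (suc a) = nn-+ (idx≥0 a) (nn 1)

  modulus≥2idx : ∀ a j → NN (modulus (a ℕ.+ j) - + 2 * idx a)
  modulus≥2idx zero    j = modulus≥2 j
  modulus≥2idx (suc a) j = nn-≡ (modulus≥2idx a j) (lem (modulus (a ℕ.+ j)) (idx a))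
    where
    lem : ∀ K i → K - + 2 * i ≡ K + + 2 - + 2 * (i + 1ℤ)
    lem = solve-∀

  -- The multisums with q^(x²+x) at j indices, preceded by q^(x²) at a indices in F a j;
  -- M plays the role of the index preceding the outermost one.

  G : ℕ → ℤ → ℕ → PS
  G zero    L M   = Γ′ M (+ 2 * L)
  G (suc j) L M m = ∑ (suc M) (λ x → (Γ′ (M ∸ x) (+ 2 * L) *ₚ shiftₚ (x ℕ.* x ℕ.+ x) (G j (L - 1ℤ - + x) x)) m)

  F : ℕ → ℕ → ℤ → ℕ → PS
  F zero    j L M   = G j L M
  F (suc a) j L M m = ∑ (suc M) (λ x → (Γ′ (M ∸ x) (+ 2 * L) *ₚ shiftₚ (x ℕ.* x) (F a j (L - + x) x)) m)

  private
    Γ′-suc-neg : ∀ d L → NN (- 1ℤ - L) → Γ′ (suc d) (+ 2 * L) ≗ 0ₚ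
    Γ′-suc-neg d (+ l)    L<0 = ⊥-elim (sign-absurd {+ l} (nn l) L<0)
    Γ′-suc-neg d -[1+ l ] _   = ≗-refl

    Γ′-zero-neg : ∀ L → NN (- 1ℤ - L) → Γ′ 0 (+ 2 * L) ≗ 1ₚ
    Γ′-zero-neg (+ l)    L<0 = ⊥-elim (sign-absurd {+ l} (nn l) L<0)
    Γ′-zero-neg -[1+ l ] _   = ≗-refl

    Γ′-neg : ∀ M L → NN (- 1ℤ - L) → Γ′ M (+ 2 * L) ≗ δ M
    Γ′-neg zero    L L<0 = Γ′-zero-neg L L<0
    Γ′-neg (suc M) L L<0 = Γ′-suc-neg M L L<0

    -- For negative L the modified binomial is 1 if its lower entry M - x is 0 and 0 otherwise, so
    -- the sum collapses to x = M. Iterated, this forces all indices to be equal, hence equal to the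
    -- final 0.
    sum-neg : ∀ M L (e : ℕ → ℕ) (f : ℕ → PS) → e 0 ≡ 0 → (∀ x → f x ≗ δ x) → NN (- 1ℤ - L) →
      ∀ m → ∑ (suc M) (λ x → (Γ′ (M ∸ x) (+ 2 * L) *ₚ shiftₚ (e x) (f x)) m) ≡ δ M m
    sum-neg M L e f e0 f≗δ L<0 m = begin
      ∑ (suc M) t
        ≡⟨ ∑-snoc M t ⟩
      ∑ M t + t M
        ≡⟨ cong₂ _+_ (trans (∑-cong-< M (λ x x<M → *ₚ-zeroˡ (shiftₚ (e x) (f x)) (low x x<M) m)) (∑-zero M (λ _ → refl)))
                     (*ₚ-cong (λ m → trans (cong (λ d → Γ′ d (+ 2 * L) m) (ℕₚ.n∸n≡0 M)) (Γ′-zero-neg L L<0 m)) (shift-cong (e M) (f≗δ M)) m) ⟩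
      0ℤ + (1ₚ *ₚ shiftₚ (e M) (δ M)) m
        ≡⟨ trans (ℤₚ.+-identityˡ _) (trans (*ₚ-identityˡ (shiftₚ (e M) (δ M)) m) (shift-δ M)) ⟩
      δ M m ∎
      where
      open ≡-Reasoning
      t : ℕ → ℤ
      t x = (Γ′ (M ∸ x) (+ 2 * L) *ₚ shiftₚ (e x) (f x)) m
      low : ∀ x → x ℕ.< M → Γ′ (M ∸ x) (+ 2 * L) ≗ 0ₚ
      low x x<M m = trans (cong (λ d → Γ′ d (+ 2 * L) m) (trans (ℕₚ.+-∸-assoc 1 x<M) refl)) (Γ′-suc-neg (M ∸ suc x) L L<0 m)
      shift-δ : ∀ M → shiftₚ (e M) (δ M) m ≡ δ M m
      shift-δ zero    = cong (λ n → shiftₚ n 1ₚ m) e0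
      shift-δ (suc M) = trans (shift≗mon (e (suc M)) 0ₚ m) (mon-zero (+ e (suc M)) ≗-refl m)

    lower₁ : ∀ {L} x → NN (- 1ℤ - L) → NN (- 1ℤ - (L - 1ℤ - + x))
    lower₁ {L} x L<0 = nn-≡ (nn-+ L<0 (nn-+ (nn 1) (nn x))) (lem L (+ x))
      where
      lem : ∀ L x → - 1ℤ - L + (1ℤ + x) ≡ - 1ℤ - (L - 1ℤ - x)
      lem = solve-∀

    lower₀ : ∀ {L} x → NN (- 1ℤ - L) → NN (- 1ℤ - (L - + x))
    lower₀ {L} x L<0 = nn-≡ (nn-+ L<0 (nn x)) (lem L (+ x))
      where
      lem : ∀ L x → - 1ℤ - L + x ≡ - 1ℤ - (L - x)
      lem = solve-∀

  G-neg : ∀ j L M → NN (- 1ℤ - L) → G j L M ≗ δ M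
  G-neg zero    L M L<0 = Γ′-neg M L L<0
  G-neg (suc j) L M L<0 = sum-neg M L (λ x → x ℕ.* x ℕ.+ x) (λ x → G j (L - 1ℤ - + x) x) refl (λ x → G-neg j (L - 1ℤ - + x) x (lower₁ {L} x L<0)) L<0

  F-neg : ∀ a j L M → NN (- 1ℤ - L) → F a j L M ≗ δ M
  F-neg zero    j L M L<0 = G-neg j L M L<0
  F-neg (suc a) j L M L<0 = sum-neg M L (λ x → x ℕ.* x) (λ x → F a j (L - + x) x) refl (λ x → F-neg a j (L - + x) x (lower₀ {L} x L<0)) L<0

  R-neg : ∀ K i B L M → NN (- 1ℤ - L) → R K i B L M ≗ 0ₚ
  R-neg K i B L M L<0 m = Σℤ-zero B (λ s → cong₂ _-_
      (t₂-vanish (e₁ K i s) (M - + 2 * s) (L + K * s) (M + + 2 * s) (L - K * s)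
        (λ _ p _ q → nn-absurd (nn-+ (nn-+ p q) (nn-+ (nn-+ L<0 L<0) (nn 1))) (lem₁ L K s)) m)
      (t₂-vanish (e₂ K i s) (M - + 2 * s + 1ℤ) (L + K * s - i) (M + + 2 * s - 1ℤ) (L - K * s + i)
        (λ _ p _ q → nn-absurd (nn-+ (nn-+ p q) (nn-+ (nn-+ L<0 L<0) (nn 1))) (lem₂ L K i s)) m))
    where
    lem₁ : ∀ L K s → L + K * s + (L - K * s) + (- 1ℤ - L + (- 1ℤ - L) + + 1) ≡ - 1ℤ
    lem₁ = solve-∀
    lem₂ : ∀ L K i s → L + K * s - i + (L - K * s + i) + (- 1ℤ - L + (- 1ℤ - L) + + 1) ≡ - 1ℤ
    lem₂ = solve-∀

  Q-neg : ∀ K B L M → NN (- 1ℤ - L) → Q K B L M ≗ 0ₚ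
  Q-neg K B L M L<0 m = Σℤ-zero B (λ s → cong₂ _-_
      (t₂-vanish (e₁ K 1ℤ s) (M - + 2 * s) (L + K * s) (M + + 2 * s + 1ℤ) (L + 1ℤ - K * s)
        (λ _ p _ q → nn-absurd (nn-+ (nn-+ p q) (nn-+ L<0 L<0)) (lem L K s)) m)
      (t₂-vanish (e₂ K 1ℤ s) (M - + 2 * s + 1ℤ) (L + K * s) (M + + 2 * s) (L + 1ℤ - K * s)
        (λ _ p _ q → nn-absurd (nn-+ (nn-+ p q) (nn-+ L<0 L<0)) (lem L K s)) m))
    where
    lem : ∀ L K s → L + K * s + (L + 1ℤ - K * s) + (- 1ℤ - L + (- 1ℤ - L)) ≡ - 1ℤ
    lem = solve-∀

  private
    Γ′-nonneg : ∀ M {v} → NN v → Γ′ M v ≗ Γ (+ M) v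
    Γ′-nonneg M {+ v} _ = ≗-refl

    Γ′≗Γ : ∀ M x L → x ℕ.≤ M → NN L → Γ′ (M ∸ x) (+ 2 * L) ≗ Γ (+ M - + x) (+ 2 * L)
    Γ′≗Γ M x L x≤M L≥0 m = trans (Γ′-nonneg (M ∸ x) (nn-* (nn 2) L≥0) m)
      (cong (λ u → Γ u (+ 2 * L) m) (sym (trans (ℤₚ.m-n≡m⊖n M x) (ℤₚ.⊖-≥ x≤M))))

    δ-pos : ∀ x → NN (+ x - 1ℤ) → δ x ≗ 0ₚ
    δ-pos (suc x) _ = ≗-refl

    pos-part : ∀ {L} B → NN L → NN (+ B - L) → ∃ λ l → L ≡ + l × l ℕ.≤ B
    pos-part {+ l} B _ p = l , refl , ℤₚ.drop‿+≤+ (ℤₚ.0≤i-j⇒j≤i p)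

  -- If L - x is negative then x ≥ 1, and both sides are 0; otherwise the evaluation for natural
  -- arguments applies.
  R₁₀≗δ : ∀ B L x → L ℕ.≤ B → R 1ℤ 0ℤ B (+ L - + x) (+ x) ≗ δ x
  R₁₀≗δ B L x L≤B m with sign? (+ L - + x)
  ... | inj₁ p = let l , eq , l≤B = pos-part B p (nn-≡ (nn-+ (ℤₚ.i≤j⇒0≤j-i (+≤+ L≤B)) (nn x)) (lem (+ B) (+ L) (+ x)))
                 in trans (cong (λ z → R 1ℤ 0ℤ B z (+ x) m) eq) (R₁₀≡δ B l x l≤B m)
    where
    lem : ∀ B L x → B - L + x ≡ B - (L - x)
    lem = solve-∀
  ... | inj₂ p = trans (R-neg 1ℤ 0ℤ B (+ L - + x) (+ x) p m) (sym (δ-pos x (nn-≡ (nn-+ p (nn L)) (lem (+ L) (+ x))) m))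
    where
    lem : ∀ L x → - 1ℤ - (L - x) + L ≡ x - 1ℤ
    lem = solve-∀

  -- This is the transform of the modulus 1 sum: being 1 at x = 0 and 0 for x > 0, that sum leaves
  -- only the binomial in front. It supplies the innermost factor of every multisum.
  Γ≡R₃₁ : ∀ B L M → L ℕ.≤ B → Γ (+ M) (+ 2 * + L) ≗ R (+ 3) 1ℤ B (+ L) (+ M)
  Γ≡R₃₁ B L M L≤B m = sym (begin
    R (+ 3) 1ℤ B (+ L) (+ M) m
      ≡⟨ sym (burge {1ℤ} {0ℤ} (nn 0) (nn 1) B (+ L) M m) ⟩
    ∑ (suc M) (λ x → (W x *ₚ shiftₚ (x ℕ.* x) (R 1ℤ 0ℤ B (+ L - + x) (+ x))) m)
      ≡⟨ ∑-cong (suc M) (λ x → *ₚ-cong {W x} ≗-refl (shift-cong (x ℕ.* x) (R₁₀≗δ B L x L≤B)) m) ⟩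
    ∑ (suc M) (λ x → (W x *ₚ shiftₚ (x ℕ.* x) (δ x)) m)
      ≡⟨ ∑-single (suc M) 0 (λ x → (W x *ₚ shiftₚ (x ℕ.* x) (δ x)) m) (s≤s z≤n) off ⟩
    (Γ (+ M - 0ℤ) (+ 2 * + L) *ₚ 1ₚ) m
      ≡⟨ trans (*ₚ-identityʳ (Γ (+ M - 0ℤ) (+ 2 * + L)) m) (cong (λ u → Γ u (+ 2 * + L) m) (ℤₚ.+-identityʳ (+ M))) ⟩
    Γ (+ M) (+ 2 * + L) m ∎)
    where
    open ≡-Reasoning
    W : ℕ → PS
    W x = Γ (+ M - + x) (+ 2 * + L)
    off : ∀ x → x ≢ 0 → (W x *ₚ shiftₚ (x ℕ.* x) (δ x)) m ≡ 0ℤ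
    off zero    x≢0 = ⊥-elim (x≢0 refl)
    off (suc x) _   = *ₚ-zeroʳ (W (suc x)) (λ m → trans (shift≗mon (suc x ℕ.* suc x) 0ₚ m) (mon-zero (+ (suc x ℕ.* suc x)) ≗-refl m)) m

  module _ {K : ℤ} (K≥3 : NN (K - + 3)) where

    private
      l₁ : ∀ K s → 0ℤ - K * s + (K - + 3) * (s - 1ℤ) + + 3 * (s - 1ℤ) + (K - + 3) + + 2 ≡ - 1ℤ
      l₁ = solve-∀
      l₂ : ∀ K s → 0ℤ + K * s + ((K - + 3) * (- 1ℤ - s) + + 3 * (- 1ℤ - s)) + (K - + 3) + + 2 ≡ - 1ℤ
      l₂ = solve-∀
      l₃ : ∀ K s → 0ℤ + 1ℤ - K * s + ((K - + 3) * (s - 1ℤ) + + 3 * (s - 1ℤ)) + (K - + 3) + + 1 ≡ - 1ℤ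
      l₃ = solve-∀
      l₄ : ∀ K s → 0ℤ + K * s - 1ℤ + ((K - + 3) * (- 1ℤ - (s - 1ℤ)) + + 3 * (- 1ℤ - (s - 1ℤ))) ≡ - 1ℤ
      l₄ = solve-∀
      l₅ : ∀ s → - 1ℤ - (s - 1ℤ) ≡ - s
      l₅ = solve-∀
      l₆ : ∀ K s → 0ℤ - K * s + 1ℤ ≡ 0ℤ + 1ℤ - K * s
      l₆ = solve-∀

      Ks≢1 : ∀ s → NN (0ℤ + K * s - 1ℤ) → NN (0ℤ + 1ℤ - K * s) → ⊥
      Ks≢1 s p q = by-sign (s - 1ℤ)
        (λ t → nn-absurd (nn-+ (nn-+ (nn-+ q (nn-+ (nn-* K≥3 t) (nn-* (nn 3) t))) K≥3) (nn 1)) (l₃ K s))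
        (λ t → nn-absurd (nn-+ p (nn-+ (nn-* K≥3 t) (nn-* (nn 3) t))) (l₄ K s))

      Ks≢0 : ∀ s → s ≢ 0ℤ → NN (0ℤ + K * s) → NN (0ℤ - K * s) → ⊥
      Ks≢0 s s≢0 p q = by-sign (s - 1ℤ)
        (λ t → nn-absurd (nn-+ (nn-+ (nn-+ (nn-+ q (nn-* K≥3 t)) (nn-* (nn 3) t)) K≥3) (nn 2)) (l₁ K s))
        (λ s≤0 → by-sign s
          (λ s≥0 → s≢0 (nn-antisym s s≥0 (nn-≡ s≤0 (l₅ s))))
          (λ t → nn-absurd (nn-+ (nn-+ (nn-+ p (nn-+ (nn-* K≥3 t) (nn-* (nn 3) t))) K≥3) (nn 2)) (l₂ K s)))

      Σℤ-single : ∀ B (r : ℤ → ℤ) → (∀ s → s ≢ 0ℤ → r s ≡ 0ℤ) → Σℤ B r ≡ r 0ℤ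
      Σℤ-single B r off = trans (+-congˡ (r 0ℤ) (∑-zero B (λ t → cong₂ _+_ (off (+ suc t) (λ ())) (off -[1+ t ] (λ ()))))) (ℤₚ.+-identityʳ (r 0ℤ))

      z₁ : ∀ M → M - + 2 * 0ℤ ≡ M
      z₁ = solve-∀
      z₂ : ∀ K → 0ℤ + K * 0ℤ ≡ 0ℤ
      z₂ = solve-∀
      z₃ : ∀ M → M + + 2 * 0ℤ + 1ℤ ≡ 1ℤ + M
      z₃ = solve-∀
      z₄ : ∀ K → 0ℤ - K * 0ℤ ≡ 0ℤ
      z₄ = solve-∀

    -- At L = 0 the arguments L + a and L - a are both nonnegative only for a = 0. As a is K s or K
    -- s - 1 and K ≥ 3, only the even term at s = 0 remains.
    P-zero : ∀ B M → P K B 0ℤ (+ M) ≗ 1ₚ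
    P-zero B M m = trans (Σℤ-single B _ (λ s s≢0 → cong₂ _-_ (first s s≢0) (second s)))
      (trans (cong₂ _-_ (trans (t₂-cong {0ℤ} refl (z₁ (+ M)) (z₂ K) (z₃ (+ M)) (z₄ K) m)
            (trans (mon-0 (Γℕ M 0 *ₚ 1ₚ) m) (trans (*ₚ-identityʳ (Γℕ M 0) m) (cong (λ f → f m) (Γℕ-zeroʳ M))))) (second 0ℤ))
          (ℤₚ.+-identityʳ (1ₚ m)))
      where
      first : ∀ s → s ≢ 0ℤ → mon (e₁ K 1ℤ s) (P₁ K 0ℤ (+ M) s) m ≡ 0ℤ
      first s s≢0 = t₂-vanish (e₁ K 1ℤ s) (+ M - + 2 * s) (0ℤ + K * s) (+ M + + 2 * s + 1ℤ) (0ℤ - K * s) (λ _ p _ q → Ks≢0 s s≢0 p q) m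
      second : ∀ s → mon (e₂ K 1ℤ s) (P₂ K 0ℤ (+ M) s) m ≡ 0ℤ
      second s = t₂-vanish (e₂ K 1ℤ s) (+ M - + 2 * s + 1ℤ) (0ℤ + K * s - 1ℤ) (+ M + + 2 * s) (0ℤ + 1ℤ - K * s) (λ _ p _ q → Ks≢1 s p q) m

    H-zero : ∀ B → H K 1ℤ B 0ℤ 0ℤ ≗ 1ₚ
    H-zero B m = trans (Σℤ-single B _ (λ s s≢0 → cong₂ _-_ (first s s≢0) (second s)))
      (trans (cong₂ _-_ (trans (t₁-cong {0ℤ} refl (z₂ K) (z₄ K) m) (mon-0 1ₚ m)) (second 0ℤ)) (ℤₚ.+-identityʳ (1ₚ m)))
      where
      first : ∀ s → s ≢ 0ℤ → mon (e₁ K 1ℤ s) (Γ (0ℤ + K * s) (0ℤ - K * s)) m ≡ 0ℤ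
      first s s≢0 = t₁-vanish (e₁ K 1ℤ s) (0ℤ + K * s) (0ℤ - K * s) (Ks≢0 s s≢0) m
      second : ∀ s → mon (e₂ K 1ℤ s) (Γ (0ℤ - K * s + 1ℤ) (0ℤ + K * s - 1ℤ)) m ≡ 0ℤ
      second s = t₁-vanish (e₂ K 1ℤ s) (0ℤ - K * s + 1ℤ) (0ℤ + K * s - 1ℤ) (λ p q → Ks≢1 s q (nn-≡ p (l₆ K s))) m

  -- The induction alternates: the shifted transform consumes `Q` and yields `P`, and `P≡Q` prepares
  -- the next one. In `G≡Q` the argument may be negative; then x ≥ 1 and both sides vanish.
  G≡P : ∀ j B L M → L ℕ.≤ B → G j (+ L) M ≗ P (modulus j) B (+ L) (+ M)
  G≡Q : ∀ j B L x → L ℕ.≤ B → G j (+ suc L - 1ℤ - + x) x ≗ Q (modulus j) B (+ suc L - 1ℤ - + x) (+ x)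

  G≡P zero B L M L≤B m = begin
    Γ′ M (+ 2 * + L) m              ≡⟨ Γ′-nonneg M (nn-* (nn 2) (nn L)) m ⟩
    Γ (+ M) (+ 2 * + L) m           ≡⟨ Γ≡R₃₁ B L M L≤B m ⟩
    R (+ 3) 1ℤ B (+ L) (+ M) m      ≡⟨ sym (P≡R (+ 3) B (+ L) (+ M) (nn 2) (nn L) (nn M) m) ⟩
    P (+ 3) B (+ L) (+ M) m         ∎
    where open ≡-Reasoning
  -- For L = 0 the shifted transform is not available: the left-hand side then consists of
  -- the term x = 0, which is 1 by the convention for the modified binomial coefficients.
  G≡P (suc j) B zero M L≤B m = begin
    ∑ (suc M) t                     ≡⟨ ∑-single (suc M) 0 t (s≤s z≤n) off ⟩
    t 0                             ≡⟨ *ₚ-cong {f′ = 1ₚ} (λ m → cong (λ f → f m) (Γℕ-zeroʳ M)) (G-neg j (- 1ℤ) 0 (nn 0)) m ⟩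
    (1ₚ *ₚ 1ₚ) m                    ≡⟨ *ₚ-identityˡ 1ₚ m ⟩
    1ₚ m                            ≡⟨ sym (P-zero {modulus (suc j)} (modulus≥3 (suc j)) B M m) ⟩
    P (modulus (suc j)) B 0ℤ (+ M) m ∎
    where
    open ≡-Reasoning
    t : ℕ → ℤ
    t x = (Γ′ (M ∸ x) (+ 2 * 0ℤ) *ₚ shiftₚ (x ℕ.* x ℕ.+ x) (G j (0ℤ - 1ℤ - + x) x)) m
    off : ∀ x → x ≢ 0 → t x ≡ 0ℤ
    off zero    x≢0 = ⊥-elim (x≢0 refl)
    off (suc x) _   = *ₚ-zeroʳ (Γ′ (M ∸ suc x) (+ 2 * 0ℤ)) (λ m → trans (shift-cong e (G-neg j (0ℤ - 1ℤ - + suc x) (suc x) (nn (suc x))) m)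
                        (trans (shift≗mon e 0ₚ m) (mon-zero (+ e) ≗-refl m))) m
      where e = suc x ℕ.* suc x ℕ.+ suc x
  G≡P (suc j) B (suc L) M L<B m = trans
    (∑-cong-< (suc M) (λ x x<M → *ₚ-cong (Γ′≗Γ M x (+ suc L) (ℕₚ.≤-pred x<M) (nn (suc L))) (shift-cong (x ℕ.* x ℕ.+ x) (G≡Q j B L x (ℕₚ.<⇒≤ L<B))) m))
    (burge¹ {modulus j} (modulus≥2 j) {+ suc L} (nn L) B M m)

  G≡Q j B L x L≤B m with sign? (+ suc L - 1ℤ - + x)
  ... | inj₁ p = let l , eq , l≤B = pos-part B p (nn-≡ (nn-+ (ℤₚ.i≤j⇒0≤j-i (+≤+ L≤B)) (nn x)) (lem (+ B) (+ L) (+ x)))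
                 in trans (cong (λ z → G j z x m) eq) (trans (G≡P j B l x l≤B m)
                      (trans (P≡Q (modulus j) B (+ l) (+ x) (modulus≥1 j) (nn l) (nn x) m) (cong (λ z → Q (modulus j) B z (+ x) m) (sym eq))))
    where
    lem : ∀ B L x → B - L + x ≡ B - (1ℤ + L - 1ℤ - x)
    lem = solve-∀
  ... | inj₂ p = trans (G-neg j (+ suc L - 1ℤ - + x) x p m)
        (trans (δ-pos x (nn-≡ (nn-+ p (nn L)) (lem (+ L) (+ x))) m) (sym (Q-neg (modulus j) B (+ suc L - 1ℤ - + x) (+ x) p m)))
    where
    lem : ∀ L x → - 1ℤ - (1ℤ + L - 1ℤ - x) + L ≡ x - 1ℤ
    lem = solve-∀

  -- The shifted layers are innermost, so the change from `P` to `R` takes place once, at a = 0;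
  -- from there on each transform raises K by 2 and i by 1.
  F≡R : ∀ a j B L M → L ℕ.≤ B → F a j (+ L) M ≗ R (modulus (a ℕ.+ j)) (idx a) B (+ L) (+ M)
  F≡R′ : ∀ a j B L x → L ℕ.≤ B → F a j (+ L - + x) x ≗ R (modulus (a ℕ.+ j)) (idx a) B (+ L - + x) (+ x)

  F≡R zero    j B L M L≤B m = trans (G≡P j B L M L≤B m) (P≡R (modulus j) B (+ L) (+ M) (modulus≥1 j) (nn L) (nn M) m)
  F≡R (suc a) j B L M L≤B m = trans
    (∑-cong-< (suc M) (λ x x<M → *ₚ-cong (Γ′≗Γ M x (+ L) (ℕₚ.≤-pred x<M) (nn L)) (shift-cong (x ℕ.* x) (F≡R′ a j B L x L≤B)) m))
    (burge {modulus (a ℕ.+ j)} {idx a} (idx≥0 a) (modulus≥2idx a j) B (+ L) M m)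

  F≡R′ a j B L x L≤B m with sign? (+ L - + x)
  ... | inj₁ p = let l , eq , l≤B = pos-part B p (nn-≡ (nn-+ (ℤₚ.i≤j⇒0≤j-i (+≤+ L≤B)) (nn x)) (lem (+ B) (+ L) (+ x)))
                 in trans (cong (λ z → F a j z x m) eq) (trans (F≡R a j B l x l≤B m) (cong (λ z → R (modulus (a ℕ.+ j)) (idx a) B z (+ x) m) (sym eq)))
    where
    lem : ∀ B L x → B - L + x ≡ B - (L - x)
    lem = solve-∀
  ... | inj₂ p = trans (F-neg a j (+ L - + x) x p m)
        (trans (δ-pos x (nn-≡ (nn-+ p (nn L)) (lem (+ L) (+ x))) m) (sym (R-neg (modulus (a ℕ.+ j)) (idx a) B (+ L - + x) (+ x) p m)))
    where
    lem : ∀ L x → - 1ℤ - (L - x) + L ≡ x - 1ℤ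
    lem = solve-∀

-- The right-hand side as a signed sum with a free cutoff.

module BosonicSide where

  open PowerSeries
  open GaussianBinomials
  open Summations
  open BosonicSums
  open BurgeTransform using (H)
  open import Data.Integer as ℤ using (ℤ; +_; -[1+_]; _+_; _*_; _-_; -_; 0ℤ; 1ℤ; _≤_; +≤+; ∣_∣; _/ℕ_; _%ℕ_)

  -- The remainder is d times the distance of x from the quotient, and it is smaller than d, so the
  -- distance is 0.
  *-/ℕ-cancel : ∀ x d .{{_ : ℕ.NonZero d}} → (x * + d) /ℕ d ≡ x
  *-/ℕ-cancel x d = sym (ℤₚ.i-j≡0⇒i≡j x q (ℤₚ.∣i∣≡0⇒i≡0 (small (∣ x - q ∣) (trans (sym (ℤₚ.abs-* (x - q) (+ d))) (cong ∣_∣ eq)))))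
    where
    q = (x * + d) /ℕ d
    r = (x * + d) %ℕ d
    lem : ∀ x q d r → x * d ≡ r + q * d → (x - q) * d ≡ r
    lem x q d r p = trans (lem₁ x q d) (trans (cong (_- q * d) p) (lem₂ q d r))
      where
      lem₁ : ∀ x q d → (x - q) * d ≡ x * d - q * d
      lem₁ = solve-∀
      lem₂ : ∀ q d r → r + q * d - q * d ≡ r
      lem₂ = solve-∀
    eq : (x - q) * + d ≡ + r
    eq = lem x q (+ d) (+ r) (ℤ-DivMod.a≡a%ℕn+[a/ℕn]*n (x * + d) d)
    small : ∀ n → n ℕ.* d ≡ r → n ≡ 0
    small zero    _ = refl
    small (suc n) p = ⊥-elim (ℕₚ.<⇒≱ (ℤ-DivMod.n%ℕd<d (x * + d) d) (subst (d ℕ.≤_) p (ℕₚ.m≤m+n d (n ℕ.* d))))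

  sgn-+1 : ∀ r → sgn (r + 1ℤ) ≡ - sgn r
  sgn-+1 (+ n)    = trans (cong (λ k → -[1+ 0 ] ℤ.^ k) (ℕₚ.+-comm n 1)) (ℤₚ.-1*i≡-i (-[1+ 0 ] ℤ.^ n))
  sgn-+1 -[1+ n ] = trans (cong sgn (lem n)) (trans (abs-neg n) (sym (trans (cong -_ (ℤₚ.-1*i≡-i (-[1+ 0 ] ℤ.^ n))) (ℤₚ.neg-involutive _))))
    where
    lem : ∀ n → -[1+ n ] + 1ℤ ≡ - + n
    lem zero    = refl
    lem (suc n) = refl
    abs-neg : ∀ n → sgn (- + n) ≡ -[1+ 0 ] ℤ.^ n
    abs-neg zero    = refl
    abs-neg (suc n) = refl

  sgn-even : ∀ s → sgn (+ 2 * s) ≡ 1ℤ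
  sgn-even s = trans (cong (λ k → -[1+ 0 ] ℤ.^ k) (ℤₚ.abs-* (+ 2) s)) (pow ∣ s ∣)
    where
    neg² : ∀ x → -[1+ 0 ] * (-[1+ 0 ] * x) ≡ x
    neg² = solve-∀
    pow : ∀ n → -[1+ 0 ] ℤ.^ (2 ℕ.* n) ≡ 1ℤ
    pow zero    = refl
    pow (suc n) = trans (cong (λ k → -[1+ 0 ] ℤ.^ suc k) (ℕₚ.+-suc n (n ℕ.+ 0))) (trans (neg² (-[1+ 0 ] ℤ.^ (2 ℕ.* n))) (pow n))

  sgn-odd : ∀ s → sgn (+ 2 * s - 1ℤ) ≡ - 1ℤ
  sgn-odd s = trans (sym (ℤₚ.neg-involutive (sgn (+ 2 * s - 1ℤ)))) (cong -_ (trans (sym (sgn-+1 (+ 2 * s - 1ℤ))) (trans (cong sgn (lem s)) (sgn-even s))))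
    where
    lem : ∀ s → + 2 * s - 1ℤ + 1ℤ ≡ + 2 * s
    lem = solve-∀

  data Parity : ℤ → Set where
    even : ∀ s → Parity (+ 2 * s)
    odd  : ∀ s → Parity (+ 2 * s - 1ℤ)

  parity : ∀ r → Parity r
  parity (+ n) = pos n
    where
    up : ∀ n → Parity (+ n) → Parity (+ suc n)
    up n p = step (+ n) p
      where
      lem₁ : ∀ s → + 2 * (s + 1ℤ) - 1ℤ ≡ 1ℤ + + 2 * s
      lem₁ = solve-∀
      lem₂ : ∀ s → + 2 * s ≡ 1ℤ + (+ 2 * s - 1ℤ)
      lem₂ = solve-∀
      step : ∀ r → Parity r → Parity (1ℤ + r)
      step _ (even s) = subst Parity (lem₁ s) (odd (s + 1ℤ))
      step _ (odd s)  = subst Parity (lem₂ s) (even s)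
    pos : ∀ n → Parity (+ n)
    pos zero    = even 0ℤ
    pos (suc n) = up n (pos n)
  parity -[1+ n ] = neg n
    where
    lem₂ : ∀ s → + 2 * (s - 1ℤ) ≡ + 2 * s - 1ℤ - 1ℤ
    lem₂ = solve-∀
    step : ∀ r → Parity r → Parity (r - 1ℤ)
    step _ (even s) = odd s
    step _ (odd s)  = subst Parity (lem₂ s) (even (s - 1ℤ))
    neg : ∀ n → Parity -[1+ n ]
    neg zero    = odd 0ℤ
    neg (suc n) = subst Parity (cong (λ k → -[1+ suc k ]) (ℕₚ.+-identityʳ n)) (step -[1+ n ] (neg n))

  abs-bound : ∀ {e} r → NN (+ e - r) → NN (+ e + r) → ∣ r ∣ ℕ.≤ e
  abs-bound (+ n)    p q = ℤₚ.drop‿+≤+ (ℤₚ.0≤i-j⇒j≤i p)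
  abs-bound -[1+ n ] p q = ℤₚ.drop‿+≤+ (ℤₚ.0≤i-j⇒j≤i {_} {+ suc n} q)

  -- The exponents are at least |r|, so the terms with |r| > m do not contribute to q^m.

  module _ {K i : ℤ} (i≥1 : NN (i - 1ℤ)) (K≥2i : NN (K - + 2 * i)) where

    private
      κ : ∀ K i → (K - + 2 * i) + + 2 * (i - 1ℤ) ≡ K - + 2
      κ = solve-∀
      K≥2 : NN (K - + 2)
      K≥2 = nn-≡ (nn-+ K≥2i (nn-* (nn 2) i≥1)) (κ K i)

      -- These identities write exponent ∓ r with positive coefficients in K - 2, i - 1, K - 2i and
      -- in s - 1, or in its counterpart for smaller s; nonnegativity is then read off.
      a₁ : ∀ K i s → (s - 1ℤ + + 1) * (+ 2 * ((K - + 2) * (s - 1ℤ) + + 2 * (s - 1ℤ)) + (+ 2 * (K - + 2) + + 2 + (K - + 2 * i)))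
           ≡ s * (+ 2 * K * s + K - + 2 * i) - + 2 * s
      a₁ = solve-∀
      a₂ : ∀ K i s → (s - 1ℤ + + 1) * (+ 2 * ((K - + 2) * (s - 1ℤ) + + 2 * (s - 1ℤ)) + (+ 2 * (K - + 2) + + 6 + (K - + 2 * i)))
           ≡ s * (+ 2 * K * s + K - + 2 * i) + + 2 * s
      a₂ = solve-∀
      a₃ : ∀ K i s → (- 1ℤ - s + + 1) * (+ 2 * ((K - + 2) * (- 1ℤ - s) + + 2 * (- 1ℤ - s)) + (K - + 2 + + 2 * (i - 1ℤ) + + 6))
           ≡ s * (+ 2 * K * s + K - + 2 * i) - + 2 * s
      a₃ = solve-∀
      a₄ : ∀ K i s → (- 1ℤ - s + + 1) * (+ 2 * ((K - + 2) * (- 1ℤ - s) + + 2 * (- 1ℤ - s)) + (K - + 2 + + 2 * (i - 1ℤ) + + 2))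
           ≡ s * (+ 2 * K * s + K - + 2 * i) + + 2 * s
      a₄ = solve-∀
      b₁ : ∀ K i s → (+ 2 * (s - 1ℤ) + + 1) * ((K - + 2) * (s - 1ℤ) + + 2 * (s - 1ℤ) + (K - + 2 * i + (i - 1ℤ)))
           ≡ (+ 2 * s - 1ℤ) * (K * s - i) - (+ 2 * s - 1ℤ)
      b₁ = solve-∀
      b₂ : ∀ K i s → (+ 2 * (s - 1ℤ) + + 1) * ((K - + 2) * (s - 1ℤ) + + 2 * (s - 1ℤ) + (K - + 2 * i + (i - 1ℤ) + + 2))
           ≡ (+ 2 * s - 1ℤ) * (K * s - i) + (+ 2 * s - 1ℤ)
      b₂ = solve-∀
      b₃ : ∀ K i s → (+ 2 * (- 1ℤ - (s - 1ℤ)) + + 1) * ((K - + 2) * (- 1ℤ - (s - 1ℤ)) + + 2 * (- 1ℤ - (s - 1ℤ)) + (i - 1ℤ + + 2))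
           ≡ (+ 2 * s - 1ℤ) * (K * s - i) - (+ 2 * s - 1ℤ)
      b₃ = solve-∀
      b₄ : ∀ K i s → (+ 2 * (- 1ℤ - (s - 1ℤ)) + + 1) * ((K - + 2) * (- 1ℤ - (s - 1ℤ)) + + 2 * (- 1ℤ - (s - 1ℤ)) + (i - 1ℤ))
           ≡ (+ 2 * s - 1ℤ) * (K * s - i) + (+ 2 * s - 1ℤ)
      b₄ = solve-∀

      K·≥0 : ∀ {t} → NN t → NN ((K - + 2) * t + + 2 * t)
      K·≥0 t≥0 = nn-+ (nn-* K≥2 t≥0) (nn-* (nn 2) t≥0)

      -1-[s-1] : ∀ s → - 1ℤ - (s - 1ℤ) ≡ - s
      -1-[s-1] = solve-∀

    e₁-⁻ : ∀ s → s ≢ 0ℤ → NN (e₁ K i s - + 2 * s)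
    e₁-⁻ s s≢0 = by-sign (s - 1ℤ)
      (λ t → nn-≡ (nn-* (nn-+ t (nn 1)) (nn-+ (nn-* (nn 2) (K·≥0 t)) (nn-+ (nn-+ (nn-* (nn 2) K≥2) (nn 2)) K≥2i))) (a₁ K i s))
      (λ s≤0 → by-sign s
        (λ s≥0 → ⊥-elim (s≢0 (nn-antisym s s≥0 (nn-≡ s≤0 (-1-[s-1] s)))))
        (λ t → nn-≡ (nn-* (nn-+ t (nn 1)) (nn-+ (nn-* (nn 2) (K·≥0 t)) (nn-+ (nn-+ K≥2 (nn-* (nn 2) i≥1)) (nn 6)))) (a₃ K i s)))

    e₁-⁺ : ∀ s → s ≢ 0ℤ → NN (e₁ K i s + + 2 * s)
    e₁-⁺ s s≢0 = by-sign (s - 1ℤ)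
      (λ t → nn-≡ (nn-* (nn-+ t (nn 1)) (nn-+ (nn-* (nn 2) (K·≥0 t)) (nn-+ (nn-+ (nn-* (nn 2) K≥2) (nn 6)) K≥2i))) (a₂ K i s))
      (λ s≤0 → by-sign s
        (λ s≥0 → ⊥-elim (s≢0 (nn-antisym s s≥0 (nn-≡ s≤0 (-1-[s-1] s)))))
        (λ t → nn-≡ (nn-* (nn-+ t (nn 1)) (nn-+ (nn-* (nn 2) (K·≥0 t)) (nn-+ (nn-+ K≥2 (nn-* (nn 2) i≥1)) (nn 2)))) (a₄ K i s)))

    e₂-⁻ : ∀ s → NN (e₂ K i s - (+ 2 * s - 1ℤ))
    e₂-⁻ s = by-sign (s - 1ℤ)
      (λ t → nn-≡ (nn-* (nn-+ (nn-* (nn 2) t) (nn 1)) (nn-+ (K·≥0 t) (nn-+ K≥2i i≥1))) (b₁ K i s))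
      (λ t → nn-≡ (nn-* (nn-+ (nn-* (nn 2) t) (nn 1)) (nn-+ (K·≥0 t) (nn-+ i≥1 (nn 2)))) (b₃ K i s))

    e₂-⁺ : ∀ s → NN (e₂ K i s + (+ 2 * s - 1ℤ))
    e₂-⁺ s = by-sign (s - 1ℤ)
      (λ t → nn-≡ (nn-* (nn-+ (nn-* (nn 2) t) (nn 1)) (nn-+ (K·≥0 t) (nn-+ (nn-+ K≥2i i≥1) (nn 2)))) (b₂ K i s))
      (λ t → nn-≡ (nn-* (nn-+ (nn-* (nn 2) t) (nn 1)) (nn-+ (K·≥0 t) i≥1)) (b₄ K i s))

  Σℤ-symRange : ∀ m (g : ℤ → ℤ) → sumℤ (map g (symRange m)) ≡ Σℤ m g
  Σℤ-symRange m g = begin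
    sumℤ (map g (symRange m))                                     ≡⟨ cong sumℤ (sym (Listₚ.map-∘ {g = g} {f = λ t → + t - + m} (upTo (suc (2 ℕ.* m))))) ⟩
    sumℤ (map (λ t → g (+ t - + m)) (upTo (suc (2 ℕ.* m))))       ≡⟨ sumℤ-upTo (λ t → g (+ t - + m)) (suc (2 ℕ.* m)) ⟩
    ∑ (suc (2 ℕ.* m)) (λ t → g (+ t - + m))                       ≡⟨ cong (λ n → ∑ n (λ t → g (+ t - + m))) count ⟩
    ∑ (m ℕ.+ suc m) (λ t → g (+ t - + m))                         ≡⟨ split m (suc m) ⟩
    ∑ m (λ t → g -[1+ t ]) + ∑ (suc m) (λ t → g (+ t))            ≡⟨ rearrange (∑ m (λ t → g -[1+ t ])) (g 0ℤ) (∑ m (λ t → g (+ suc t))) ⟩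
    g 0ℤ + (∑ m (λ t → g (+ suc t)) + ∑ m (λ t → g -[1+ t ]))     ≡⟨ +-congˡ (g 0ℤ) (sym (∑-+ m (λ t → g (+ suc t)) (λ t → g -[1+ t ]))) ⟩
    Σℤ m g                                                        ∎
    where
    open ≡-Reasoning
    rearrange : ∀ a b c → a + (b + c) ≡ b + (c + a)
    rearrange = solve-∀
    count : suc (2 ℕ.* m) ≡ m ℕ.+ suc m
    count = trans (cong (λ x → suc (m ℕ.+ x)) (ℕₚ.+-identityʳ m)) (sym (ℕₚ.+-suc m m))
    split : ∀ a b → ∑ (a ℕ.+ b) (λ t → g (+ t - + a)) ≡ ∑ a (λ t → g -[1+ t ]) + ∑ b (λ t → g (+ t))
    split zero    b = trans (∑-cong b (λ t → cong g (ℤₚ.+-identityʳ (+ t)))) (sym (ℤₚ.+-identityˡ _))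
    split (suc a) b = begin
      g -[1+ a ] + ∑ (a ℕ.+ b) (λ t → g (+ suc t - + suc a))                      ≡⟨ +-congˡ (g -[1+ a ]) (∑-cong (a ℕ.+ b) (λ t → cong g (lem (+ t) (+ a)))) ⟩
      g -[1+ a ] + ∑ (a ℕ.+ b) (λ t → g (+ t - + a))                              ≡⟨ +-congˡ (g -[1+ a ]) (split a b) ⟩
      g -[1+ a ] + (∑ a (λ t → g -[1+ t ]) + ∑ b (λ t → g (+ t)))                 ≡⟨ rearrange′ (g -[1+ a ]) (∑ a (λ t → g -[1+ t ])) (∑ b (λ t → g (+ t))) ⟩
      (∑ a (λ t → g -[1+ t ]) + g -[1+ a ]) + ∑ b (λ t → g (+ t))                 ≡⟨ cong (_+ ∑ b (λ t → g (+ t))) (sym (∑-snoc a (λ t → g -[1+ t ]))) ⟩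
      ∑ (suc a) (λ t → g -[1+ t ]) + ∑ b (λ t → g (+ t))                          ∎
      where
      lem : ∀ t a → 1ℤ + t - (1ℤ + a) ≡ t - a
      lem = solve-∀
      rearrange′ : ∀ a b c → a + (b + c) ≡ (b + a) + c
      rearrange′ = solve-∀

  -- The indices 2s and 2s - 1 with |s| ≤ B fill the interval from -2B - 1 to 2B, one more than a
  -- symmetric range; hence the extra term.
  Σℤ-pairs : ∀ B (g : ℤ → ℤ) → Σℤ B (λ s → g (+ 2 * s) + g (+ 2 * s - 1ℤ)) ≡ Σℤ (2 ℕ.* B) g + g (+ 2 * - + B - 1ℤ)
  Σℤ-pairs zero    g = lem (g 0ℤ) (g (- 1ℤ))
    where
    lem : ∀ a b → a + b + 0ℤ ≡ a + 0ℤ + b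
    lem = solve-∀
  Σℤ-pairs (suc B) g = begin
    Σℤ (suc B) h
      ≡⟨ Σℤ-suc B h ⟩
    Σℤ B h + (h (+ suc B) + h -[1+ B ])
      ≡⟨ cong₂ _+_ (Σℤ-pairs B g) (cong₂ _+_ (cong₂ _+_ (cong g p₁) (cong g p₂)) (cong (_+ g (+ 2 * -[1+ B ] - 1ℤ)) (cong g p₃))) ⟩
    (Σℤ (2 ℕ.* B) g + g (+ 2 * - + B - 1ℤ)) + ((g (+ suc (suc (2 ℕ.* B))) + g (+ suc (2 ℕ.* B))) + (g -[1+ suc (2 ℕ.* B) ] + g (+ 2 * -[1+ B ] - 1ℤ)))
      ≡⟨ cong (λ z → (Σℤ (2 ℕ.* B) g + z) + ((g (+ suc (suc (2 ℕ.* B))) + g (+ suc (2 ℕ.* B))) + (g -[1+ suc (2 ℕ.* B) ] + g (+ 2 * -[1+ B ] - 1ℤ)))) (cong g p₄) ⟩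
    (Σℤ (2 ℕ.* B) g + g -[1+ 2 ℕ.* B ]) + ((g (+ suc (suc (2 ℕ.* B))) + g (+ suc (2 ℕ.* B))) + (g -[1+ suc (2 ℕ.* B) ] + g (+ 2 * -[1+ B ] - 1ℤ)))
      ≡⟨ lem (Σℤ (2 ℕ.* B) g) (g -[1+ 2 ℕ.* B ]) (g (+ suc (suc (2 ℕ.* B)))) (g (+ suc (2 ℕ.* B))) (g -[1+ suc (2 ℕ.* B) ]) (g (+ 2 * -[1+ B ] - 1ℤ)) ⟩
    Σℤ (2 ℕ.* B) g + (g (+ suc (2 ℕ.* B)) + g -[1+ 2 ℕ.* B ]) + (g (+ suc (suc (2 ℕ.* B))) + g -[1+ suc (2 ℕ.* B) ]) + g (+ 2 * -[1+ B ] - 1ℤ)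
      ≡⟨ cong (λ z → z + (g (+ suc (suc (2 ℕ.* B))) + g -[1+ suc (2 ℕ.* B) ]) + g (+ 2 * -[1+ B ] - 1ℤ)) (sym (Σℤ-suc (2 ℕ.* B) g)) ⟩
    Σℤ (suc (2 ℕ.* B)) g + (g (+ suc (suc (2 ℕ.* B))) + g -[1+ suc (2 ℕ.* B) ]) + g (+ 2 * -[1+ B ] - 1ℤ)
      ≡⟨ cong (_+ g (+ 2 * -[1+ B ] - 1ℤ)) (sym (Σℤ-suc (suc (2 ℕ.* B)) g)) ⟩
    Σℤ (suc (suc (2 ℕ.* B))) g + g (+ 2 * -[1+ B ] - 1ℤ)
      ≡⟨ cong (λ n → Σℤ (suc n) g + g (+ 2 * -[1+ B ] - 1ℤ)) (sym (ℕₚ.+-suc B (B ℕ.+ 0))) ⟩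
    Σℤ (2 ℕ.* suc B) g + g (+ 2 * -[1+ B ] - 1ℤ) ∎
    where
    open ≡-Reasoning
    h : ℤ → ℤ
    h s = g (+ 2 * s) + g (+ 2 * s - 1ℤ)
    lem : ∀ a b c d e f → (a + b) + ((c + d) + (e + f)) ≡ a + (d + b) + (c + e) + f
    lem = solve-∀
    q₁ : ∀ B → + 2 * (1ℤ + B) ≡ 1ℤ + (1ℤ + + 2 * B)
    q₁ = solve-∀
    q₂ : ∀ B → + 2 * (1ℤ + B) - 1ℤ ≡ 1ℤ + + 2 * B
    q₂ = solve-∀
    q₃ : ∀ B → + 2 * - (1ℤ + B) ≡ - (1ℤ + (1ℤ + + 2 * B))
    q₃ = solve-∀
    q₄ : ∀ B → + 2 * - B - 1ℤ ≡ - (1ℤ + + 2 * B)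
    q₄ = solve-∀
    2B : + 2 * + B ≡ + (2 ℕ.* B)
    2B = sym (ℤₚ.pos-* 2 B)
    p₁ : + 2 * + suc B ≡ + suc (suc (2 ℕ.* B))
    p₁ = trans (q₁ (+ B)) (cong (λ z → 1ℤ + (1ℤ + z)) 2B)
    p₂ : + 2 * + suc B - 1ℤ ≡ + suc (2 ℕ.* B)
    p₂ = trans (q₂ (+ B)) (cong (λ z → 1ℤ + z) 2B)
    p₃ : + 2 * -[1+ B ] ≡ -[1+ suc (2 ℕ.* B) ]
    p₃ = trans (q₃ (+ B)) (cong (λ z → - (1ℤ + (1ℤ + z))) 2B)
    p₄ : + 2 * - + B - 1ℤ ≡ -[1+ 2 ℕ.* B ]
    p₄ = trans (q₄ (+ B)) (cong (λ z → - (1ℤ + z)) 2B)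

  module _ (k i n : ℕ) where

    private
      K : ℤ
      K = + (2 ℕ.* k ℕ.+ 1)

      2i : + (2 ℕ.* i) ≡ + 2 * + i
      2i = ℤₚ.pos-* 2 i

      num : ∀ K i s → (+ 2 * s) * (K * (+ 2 * s) + (K - + 2 * i)) ≡ s * (+ 2 * K * s + K - + 2 * i) * + 2
      num = solve-∀
      num′ : ∀ K i s → (+ 2 * s - 1ℤ) * (K * (+ 2 * s - 1ℤ) + (K - + 2 * i)) ≡ (+ 2 * s - 1ℤ) * (K * s - i) * + 2
      num′ = solve-∀
      bot : ∀ K i n s → + 4 * n - + 2 * K * (+ 2 * s) + (K - + 2 * i) * (1ℤ - + 1) ≡ (n - K * s) * + 4
      bot = solve-∀
      bot′ : ∀ K i n s → + 4 * n - + 2 * K * (+ 2 * s - 1ℤ) + (K - + 2 * i) * (- 1ℤ - + 1) ≡ (n - K * s + i) * + 4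
      bot′ = solve-∀

    rhsExp-even : ∀ s → rhsExp k i (+ 2 * s) ≡ e₁ K (+ i) s
    rhsExp-even s = trans (cong (_/ℕ 2) (trans (cong (λ z → (+ 2 * s) * (K * (+ 2 * s) + (K - z))) 2i) (num K (+ i) s))) (*-/ℕ-cancel (e₁ K (+ i) s) 2)

    rhsExp-odd : ∀ s → rhsExp k i (+ 2 * s - 1ℤ) ≡ e₂ K (+ i) s
    rhsExp-odd s = trans (cong (_/ℕ 2) (trans (cong (λ z → (+ 2 * s - 1ℤ) * (K * (+ 2 * s - 1ℤ) + (K - z))) 2i) (num′ K (+ i) s))) (*-/ℕ-cancel (e₂ K (+ i) s) 2)

    private
      cast : ∀ r σ → + (4 ℕ.* n) - + (2 ℕ.* (2 ℕ.* k ℕ.+ 1)) * r + (K - + (2 ℕ.* i)) * (σ - + 1)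
             ≡ + 4 * + n - + 2 * K * r + (K - + 2 * + i) * (σ - + 1)
      cast r σ = cong₂ _+_ (cong₂ (λ x y → x - y * r) (ℤₚ.pos-* 4 n) (ℤₚ.pos-* 2 (2 ℕ.* k ℕ.+ 1))) (cong (λ z → (K - z) * (σ - + 1)) 2i)

    rhsBot-even : ∀ s → rhsBot k i n (+ 2 * s) ≡ + n - K * s
    rhsBot-even s = trans (cong (_/ℕ 4) (trans (cast (+ 2 * s) (sgn (+ 2 * s)))
        (trans (cong (λ σ → + 4 * + n - + 2 * K * (+ 2 * s) + (K - + 2 * + i) * (σ - + 1)) (sgn-even s)) (bot K (+ i) (+ n) s))))
      (*-/ℕ-cancel (+ n - K * s) 4)

    rhsBot-odd : ∀ s → rhsBot k i n (+ 2 * s - 1ℤ) ≡ + n - K * s + + i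
    rhsBot-odd s = trans (cong (_/ℕ 4) (trans (cast (+ 2 * s - 1ℤ) (sgn (+ 2 * s - 1ℤ)))
        (trans (cong (λ σ → + 4 * + n - + 2 * K * (+ 2 * s - 1ℤ) + (K - + 2 * + i) * (σ - + 1)) (sgn-odd s)) (bot′ K (+ i) (+ n) s))))
      (*-/ℕ-cancel (+ n - K * s + + i) 4)

    private
      co : ∀ K n s → + 2 * n - (n - K * s) ≡ n + K * s
      co = solve-∀
      co′ : ∀ K i n s → + 2 * n - (n - K * s + i) ≡ n + K * s - i
      co′ = solve-∀

      binom : ∀ b → qBinom (+ (2 ℕ.* n)) b ≗ Γ b (+ 2 * + n - b)
      binom b m = trans (qBinom≗Γ (2 ℕ.* n) b m) (cong (λ z → Γ b (z - b) m) (ℤₚ.pos-* 2 n))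

    rhsTerm-even : ∀ s m → rhsTerm k i n (+ 2 * s) m ≡ mon (e₁ K (+ i) s) (Γ (+ n + K * s) (+ n - K * s)) m
    rhsTerm-even s m = begin
      sgn (+ 2 * s) * shiftℤₚ (rhsExp k i (+ 2 * s)) (qBinom (+ (2 ℕ.* n)) (rhsBot k i n (+ 2 * s))) m
        ≡⟨ cong₂ _*_ (sgn-even s) (trans (shiftℤ≗mon (rhsExp k i (+ 2 * s)) (qBinom (+ (2 ℕ.* n)) (rhsBot k i n (+ 2 * s))) m) (mon-cong (rhsExp-even s) (binom (rhsBot k i n (+ 2 * s))) m)) ⟩
      1ℤ * t₁ E (rhsBot k i n (+ 2 * s)) (+ 2 * + n - rhsBot k i n (+ 2 * s)) m
        ≡⟨ ℤₚ.*-identityˡ _ ⟩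
      t₁ E (rhsBot k i n (+ 2 * s)) (+ 2 * + n - rhsBot k i n (+ 2 * s)) m
        ≡⟨ cong (λ b → t₁ E b (+ 2 * + n - b) m) (rhsBot-even s) ⟩
      t₁ E (+ n - K * s) (+ 2 * + n - (+ n - K * s)) m
        ≡⟨ t₁-cong {E} {+ n - K * s} refl refl (co K (+ n) s) m ⟩
      t₁ E (+ n - K * s) (+ n + K * s) m
        ≡⟨ mon-cong {E} refl (Γ-sym (+ n - K * s) (+ n + K * s)) m ⟩
      t₁ E (+ n + K * s) (+ n - K * s) m ∎
      where
      open ≡-Reasoning
      E = e₁ K (+ i) s

    rhsTerm-odd : ∀ s m → rhsTerm k i n (+ 2 * s - 1ℤ) m ≡ - mon (e₂ K (+ i) s) (Γ (+ n - K * s + + i) (+ n + K * s - + i)) m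
    rhsTerm-odd s m = begin
      sgn (+ 2 * s - 1ℤ) * shiftℤₚ (rhsExp k i (+ 2 * s - 1ℤ)) (qBinom (+ (2 ℕ.* n)) (rhsBot k i n (+ 2 * s - 1ℤ))) m
        ≡⟨ cong₂ _*_ (sgn-odd s) (trans (shiftℤ≗mon (rhsExp k i (+ 2 * s - 1ℤ)) (qBinom (+ (2 ℕ.* n)) (rhsBot k i n (+ 2 * s - 1ℤ))) m) (mon-cong (rhsExp-odd s) (binom (rhsBot k i n (+ 2 * s - 1ℤ))) m)) ⟩
      - 1ℤ * t₁ E (rhsBot k i n (+ 2 * s - 1ℤ)) (+ 2 * + n - rhsBot k i n (+ 2 * s - 1ℤ)) m
        ≡⟨ ℤₚ.-1*i≡-i _ ⟩
      - t₁ E (rhsBot k i n (+ 2 * s - 1ℤ)) (+ 2 * + n - rhsBot k i n (+ 2 * s - 1ℤ)) m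
        ≡⟨ cong (λ b → - t₁ E b (+ 2 * + n - b) m) (rhsBot-odd s) ⟩
      - t₁ E (+ n - K * s + + i) (+ 2 * + n - (+ n - K * s + + i)) m
        ≡⟨ cong -_ (t₁-cong {E} {+ n - K * s + + i} refl refl (co′ K (+ i) (+ n) s) m) ⟩
      - t₁ E (+ n - K * s + + i) (+ n + K * s - + i) m ∎
      where
      open ≡-Reasoning
      E = e₂ K (+ i) s

    module _ (i≥1 : 1 ℕ.≤ i) (i≤k : i ℕ.≤ k) where

      private
        i≥1ℤ : NN (+ i - 1ℤ)
        i≥1ℤ = ℤₚ.i≤j⇒0≤j-i (+≤+ i≥1)
        lem : ∀ k i → + 2 * (k - i) + + 1 ≡ + 2 * k + + 1 - + 2 * i
        lem = solve-∀
        K≥2i : NN (K - + 2 * + i)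
        K≥2i = nn-≡ (nn-+ (nn-* (nn 2) (ℤₚ.i≤j⇒0≤j-i (+≤+ i≤k))) (nn 1)) (trans (lem (+ k) (+ i)) (cong (λ z → z + + 1 - + 2 * + i) (sym (ℤₚ.pos-* 2 k))))

        high : ∀ {e} r f m → NN (e - r) → NN (e + r) → NN e → m ℕ.< ∣ r ∣ → mon e f m ≡ 0ℤ
        high {+ e} r f m p q _ m<r = mon-high e f m (ℕₚ.<-≤-trans m<r (abs-bound r p q))

      rhsTerm-high : ∀ r m → m ℕ.< ∣ r ∣ → rhsTerm k i n r m ≡ 0ℤ
      rhsTerm-high r m = by-parity (parity r)
        where
        by-parity : ∀ {r} → Parity r → m ℕ.< ∣ r ∣ → rhsTerm k i n r m ≡ 0ℤ
        by-parity (even s) m<r = trans (rhsTerm-even s m)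
          (high (+ 2 * s) (Γ (+ n + K * s) (+ n - K * s)) m (e₁-⁻ {K} {+ i} i≥1ℤ K≥2i s s≢0) (e₁-⁺ {K} {+ i} i≥1ℤ K≥2i s s≢0) (e₁-nonneg {K} {+ i} (nn i) K≥2i s) m<r)
          where
          s≢0 : s ≢ 0ℤ
          s≢0 refl = ℕₚ.n≮0 m<r
        by-parity (odd s) m<r = trans (rhsTerm-odd s m)
          (cong -_ (high (+ 2 * s - 1ℤ) (Γ (+ n - K * s + + i) (+ n + K * s - + i)) m (e₂-⁻ {K} {+ i} i≥1ℤ K≥2i s) (e₂-⁺ {K} {+ i} i≥1ℤ K≥2i s) (e₂-nonneg {K} {+ i} (nn i) K≥2i s) m<r))

      -- The cutoff |r| ≤ m is enlarged to 2B, plus the unpaired index -2B - 1, at no cost, since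
      -- the exponent is at least |r|. What results has the same cutoff for all coefficients up to
      -- B.
      RHS≡H : ∀ B m → m ℕ.≤ B → RHS k i n m ≡ H K (+ i) B (+ n) (+ n) m
      RHS≡H B m m≤B = begin
        RHS k i n m
          ≡⟨ Σℤ-symRange m g ⟩
        Σℤ m g
          ≡⟨ sym (Σℤ-extend m (2 ℕ.* B ∸ m) g (λ t m≤t → rhsTerm-high (+ suc t) m (s≤s m≤t)) (λ t m≤t → rhsTerm-high -[1+ t ] m (s≤s m≤t))) ⟩
        Σℤ (m ℕ.+ (2 ℕ.* B ∸ m)) g
          ≡⟨ cong (λ N → Σℤ N g) (ℕₚ.m+[n∸m]≡n m≤2B) ⟩
        Σℤ (2 ℕ.* B) g
          ≡⟨ sym (ℤₚ.+-identityʳ _) ⟩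
        Σℤ (2 ℕ.* B) g + 0ℤ
          ≡⟨ +-congˡ (Σℤ (2 ℕ.* B) g) (sym (trans (cong g last) (rhsTerm-high -[1+ 2 ℕ.* B ] m (s≤s m≤2B)))) ⟩
        Σℤ (2 ℕ.* B) g + g (+ 2 * - + B - 1ℤ)
          ≡⟨ sym (Σℤ-pairs B g) ⟩
        Σℤ B (λ s → g (+ 2 * s) + g (+ 2 * s - 1ℤ))
          ≡⟨ Σℤ-cong B (λ s → cong₂ _+_ (rhsTerm-even s m) (rhsTerm-odd s m)) ⟩
        H K (+ i) B (+ n) (+ n) m ∎
        where
        open ≡-Reasoning
        g : ℤ → ℤ
        g r = rhsTerm k i n r m
        m≤2B : m ℕ.≤ 2 ℕ.* B
        m≤2B = ℕₚ.≤-trans m≤B (ℕₚ.m≤m+n B (B ℕ.+ 0))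
        q : ∀ B → + 2 * - B - 1ℤ ≡ - (1ℤ + + 2 * B)
        q = solve-∀
        last : + 2 * - + B - 1ℤ ≡ -[1+ 2 ℕ.* B ]
        last = trans (q (+ B)) (cong (λ z → - (1ℤ + z)) (sym (ℤₚ.pos-* 2 B)))

-- The left-hand side as a nested sum.

module FermionicSide where

  open PowerSeries
  open GaussianBinomials
  open Summations
  open BosonicSums
  open BosonicForms
  open BurgeTransform
  open Multisums
  open BosonicSide
  open import Data.Integer using (ℤ; +_; _+_; _*_; _-_; -_; 0ℤ; 1ℤ; _≤_)

  private
    shift-high : ∀ e f m → m ℕ.< e → shiftₚ e f m ≡ 0ℤ
    shift-high e f m m<e = trans (shift≗mon e f m) (mon-high e f m m<e)

    square-≥ : ∀ x → x ℕ.≤ x ℕ.* x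
    square-≥ zero    = z≤n
    square-≥ (suc x) = ℕₚ.m≤m+n (suc x) (x ℕ.* suc x)

    I≥L : ∀ m n → NN (+ (m ℕ.+ n) - + n)
    I≥L m n = nn-≡ (nn m) (lem (+ m) (+ n))
      where
      lem : ∀ m n → m ≡ m + n - n
      lem = solve-∀

  multisum₀ : ∀ a j n B m → n ℕ.≤ B →
    ∑ (suc m) (λ x → shiftₚ (x ℕ.* x) (F a j (+ n - + x) x) m) ≡ H (modulus (a ℕ.+ j) + + 2) (idx a + 1ℤ) B (+ n) (+ n) m
  multisum₀ a j n B m n≤B = begin
    ∑ (suc m) t
      -- The limit transform needs a range reaching n, so the range x ≤ m is extended to x ≤ m + n;
      -- the added terms have exponent at least x > m.
      ≡⟨ sym (∑-support t (s≤s (ℕₚ.m≤m+n m n)) (λ x m<x → shift-high (x ℕ.* x) (F a j (+ n - + x) x) m (ℕₚ.<-≤-trans m<x (square-≥ x)))) ⟩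
    ∑ (suc (m ℕ.+ n)) t
      ≡⟨ ∑-cong (suc (m ℕ.+ n)) (λ x → shift-cong (x ℕ.* x) (F≡R′ a j B n x n≤B) m) ⟩
    ∑ (suc (m ℕ.+ n)) (λ x → shiftₚ (x ℕ.* x) (R (modulus (a ℕ.+ j)) (idx a) B (+ n - + x) (+ x)) m)
      ≡⟨ burge∞ {modulus (a ℕ.+ j)} {idx a} (idx≥0 a) (modulus≥2idx a j) B (+ n) (m ℕ.+ n) m (I≥L m n) ⟩
    H (modulus (a ℕ.+ j) + + 2) (idx a + 1ℤ) B (+ n) (+ n) m ∎
    where
    open ≡-Reasoning
    t : ℕ → ℤ
    t x = shiftₚ (x ℕ.* x) (F a j (+ n - + x) x) m

  multisum₁ : ∀ j n B m → n ℕ.≤ B →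
    ∑ (suc m) (λ x → shiftₚ (x ℕ.* x ℕ.+ x) (G j (+ n - 1ℤ - + x) x) m) ≡ H (modulus j + + 2) 1ℤ B (+ n) (+ n) m
  -- For n = 0 only the tuple of zeros contributes: its binomials have negative tops and the
  -- modified value 1.
  multisum₁ j zero B m _ = begin
    ∑ (suc m) t       ≡⟨ ∑-single (suc m) 0 t (s≤s z≤n) off ⟩
    t 0               ≡⟨ G-neg j (- 1ℤ) 0 (nn 0) m ⟩
    1ₚ m              ≡⟨ sym (H-zero {modulus (suc j)} (modulus≥3 (suc j)) B m) ⟩
    H (modulus j + + 2) 1ℤ B 0ℤ 0ℤ m ∎
    where
    open ≡-Reasoning
    t : ℕ → ℤ
    t x = shiftₚ (x ℕ.* x ℕ.+ x) (G j (0ℤ - 1ℤ - + x) x) m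
    off : ∀ x → x ≢ 0 → t x ≡ 0ℤ
    off zero    x≢0 = ⊥-elim (x≢0 refl)
    off (suc x) _   = trans (shift-cong e (G-neg j (0ℤ - 1ℤ - + suc x) (suc x) (nn (suc x))) m) (trans (shift≗mon e 0ₚ m) (mon-zero (+ e) ≗-refl m))
      where e = suc x ℕ.* suc x ℕ.+ suc x
  multisum₁ j (suc n) B m n<B = begin
    ∑ (suc m) t
      ≡⟨ sym (∑-support t (s≤s (ℕₚ.m≤m+n m (suc n))) (λ x m<x → shift-high (x ℕ.* x ℕ.+ x) (G j (+ suc n - 1ℤ - + x) x) m (ℕₚ.<-≤-trans m<x (ℕₚ.m≤n+m x (x ℕ.* x))))) ⟩
    ∑ (suc (m ℕ.+ suc n)) t
      ≡⟨ ∑-cong (suc (m ℕ.+ suc n)) (λ x → shift-cong (x ℕ.* x ℕ.+ x) (G≡Q j B n x (ℕₚ.<⇒≤ n<B)) m) ⟩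
    ∑ (suc (m ℕ.+ suc n)) (λ x → shiftₚ (x ℕ.* x ℕ.+ x) (Q (modulus j) B (+ suc n - 1ℤ - + x) (+ x)) m)
      ≡⟨ burge¹∞ {modulus j} (modulus≥2 j) {+ suc n} (nn n) B (m ℕ.+ suc n) m (I≥L m (suc n)) ⟩
    H (modulus j + + 2) 1ℤ B (+ suc n) (+ suc n) m ∎
    where
    open ≡-Reasoning
    t : ℕ → ℤ
    t x = shiftₚ (x ℕ.* x ℕ.+ x) (G j (+ suc n - 1ℤ - + x) x) m

  sum-decr-suc : ∀ (g : List ℕ → ℤ) len b →
    sumℤ (map g (decr (suc len) b)) ≡ ∑ (suc b) (λ x → sumℤ (map (λ ns → g (x ∷ ns)) (decr len x)))
  sum-decr-suc g len b = trans (go (upTo (suc b))) (sumℤ-upTo (λ x → sumℤ (map (λ ns → g (x ∷ ns)) (decr len x))) (suc b))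
    where
    go : ∀ xs → sumℤ (map g (concatMap (λ x → map (x ∷_) (decr len x)) xs)) ≡ sumℤ (map (λ x → sumℤ (map (λ ns → g (x ∷ ns)) (decr len x))) xs)
    go []       = refl
    go (x ∷ xs) = begin
      sumℤ (map g (map (x ∷_) (decr len x) ++ rest))                ≡⟨ cong sumℤ (Listₚ.map-++ g (map (x ∷_) (decr len x)) rest) ⟩
      sumℤ (map g (map (x ∷_) (decr len x)) ++ map g rest)          ≡⟨ sumℤ-++ (map g (map (x ∷_) (decr len x))) (map g rest) ⟩
      sumℤ (map g (map (x ∷_) (decr len x))) + sumℤ (map g rest)    ≡⟨ cong₂ _+_ (cong sumℤ (sym (Listₚ.map-∘ {g = g} {f = x ∷_} (decr len x)))) (go xs) ⟩
      sumℤ (map (λ ns → g (x ∷ ns)) (decr len x)) + sumℤ (map (λ x → sumℤ (map (λ ns → g (x ∷ ns)) (decr len x))) xs) ∎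
      where
      open ≡-Reasoning
      rest = concatMap (λ x → map (x ∷_) (decr len x)) xs

  sum-decr-1 : ∀ (g : List ℕ → ℤ) b → sumℤ (map g (decr 1 b)) ≡ ∑ (suc b) (λ x → g (x ∷ []))
  sum-decr-1 g b = trans (sum-decr-suc g 0 b) (∑-cong (suc b) (λ x → ℤₚ.+-identityʳ (g (x ∷ []))))

  sum-decr-2 : ∀ (g : List ℕ → ℤ) b → sumℤ (map g (decr 2 b)) ≡ ∑ (suc b) (λ x → ∑ (suc x) (λ y → g (x ∷ y ∷ [])))
  sum-decr-2 g b = trans (sum-decr-suc g 1 b) (∑-cong (suc b) (λ x → sum-decr-1 (λ ns → g (x ∷ ns)) x))

  sum-decr-3 : ∀ (g : List ℕ → ℤ) b → sumℤ (map g (decr 3 b)) ≡ ∑ (suc b) (λ x → ∑ (suc x) (λ y → ∑ (suc y) (λ z → g (x ∷ y ∷ z ∷ []))))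
  sum-decr-3 g b = trans (sum-decr-suc g 2 b) (∑-cong (suc b) (λ x → sum-decr-2 (λ ns → g (x ∷ ns)) x))

  shift-∑ : ∀ e N (f : ℕ → PS) m → shiftₚ e (λ m → ∑ N (λ y → f y m)) m ≡ ∑ N (λ y → shiftₚ e (f y) m)
  shift-∑ e N f m with e ≤ᵇ m
  ... | true  = refl
  ... | false = sym (∑-zero N (λ _ → refl))

  *ₚ-∑ : ∀ W N (f : ℕ → PS) m → (W *ₚ (λ m → ∑ N (λ y → f y m))) m ≡ ∑ N (λ y → (W *ₚ f y) m)
  *ₚ-∑ W N f m = begin
    (W *ₚ (λ m → ∑ N (λ y → f y m))) m                    ≡⟨ conv W (λ m → ∑ N (λ y → f y m)) m ⟩
    ∑ (suc m) (λ t → W t * ∑ N (λ y → f y (m ∸ t)))       ≡⟨ ∑-cong (suc m) (λ t → sym (∑-* N (W t) (λ y → f y (m ∸ t)))) ⟩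
    ∑ (suc m) (λ t → ∑ N (λ y → W t * f y (m ∸ t)))       ≡⟨ ∑-swap (suc m) N (λ t y → W t * f y (m ∸ t)) ⟩
    ∑ N (λ y → ∑ (suc m) (λ t → W t * f y (m ∸ t)))       ≡⟨ ∑-cong N (λ y → sym (conv W (f y) m)) ⟩
    ∑ N (λ y → (W *ₚ f y) m)                              ∎
    where open ≡-Reasoning

  -- Here S is the sum of the earlier indices and A is the value of α. Top minus bottom is 2(n - S -
  -- x - A), free of y, so y enters only through x - y; this gives the multisum its nested form.
  -- Passing an index x lowers L by x, and by 1 more if the index is at least i.
  factor : ∀ n S x y (A L : ℤ) → y ℕ.≤ x → + n - + S - + x - A ≡ L →
    qBinom' (+ (2 ℕ.* n) - + (2 ℕ.* S) - + x - + y - + 2 * A) (+ x - + y) ≗ Γ′ (x ∸ y) (+ 2 * L)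
  factor n S x y A L y≤x L≡ m = trans (cong (λ b → qBinom' a b m) x-y)
    (trans (qBinom'≗Γ′ a (x ∸ y) m) (cong (λ v → Γ′ (x ∸ y) v m) eq))
    where
    a : ℤ
    a = + (2 ℕ.* n) - + (2 ℕ.* S) - + x - + y - + 2 * A
    x-y : + x - + y ≡ + (x ∸ y)
    x-y = trans (ℤₚ.m-n≡m⊖n x y) (ℤₚ.⊖-≥ y≤x)
    lem : ∀ n S x y A → + 2 * n - + 2 * S - x - y - + 2 * A - (x - y) ≡ + 2 * (n - S - x - A)
    lem = solve-∀
    eq : a - + (x ∸ y) ≡ + 2 * L
    eq = trans (cong₂ _-_ (cong₂ (λ u v → u - v - + x - + y - + 2 * A) (ℤₚ.pos-* 2 n) (ℤₚ.pos-* 2 S)) (sym x-y))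
      (trans (lem (+ n) (+ S) (+ x) (+ y) A) (cong (λ z → + 2 * z) L≡))

  nest₁ : ∀ {E e A A′} → E ≡ e → A ≗ A′ → shiftₚ E (A *ₚ 1ₚ) ≗ shiftₚ e A′
  nest₁ {E} {A = A} refl A≗ = shift-cong E (λ m → trans (*ₚ-identityʳ A m) (A≗ m))

  -- The definition has one common power of q in front of a flat product ending in `1ₚ`; the power
  -- is distributed to the layers to which its parts belong.
  nest₂ : ∀ {E A A′ B B′} e e′ → E ≡ e ℕ.+ e′ → A ≗ A′ → B ≗ B′ →
    shiftₚ E (A *ₚ (B *ₚ 1ₚ)) ≗ shiftₚ e (A′ *ₚ shiftₚ e′ B′)
  nest₂ {A = A} {A′} {B} {B′} e e′ refl A≗ B≗ m = trans (sym (shift-shift e e′ (A *ₚ (B *ₚ 1ₚ)) m))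
    (shift-cong e (λ m → trans (sym (shift-*ʳ e′ A (B *ₚ 1ₚ) m)) (*ₚ-cong A≗ (nest₁ {e′} {A = B} refl B≗) m)) m)

  nest₃ : ∀ {E A A′ B B′ C C′} e e′ e″ → E ≡ e ℕ.+ (e′ ℕ.+ e″) → A ≗ A′ → B ≗ B′ → C ≗ C′ →
    shiftₚ E (A *ₚ (B *ₚ (C *ₚ 1ₚ))) ≗ shiftₚ e (A′ *ₚ shiftₚ e′ (B′ *ₚ shiftₚ e″ C′))
  nest₃ {A = A} {A′} {B} {B′} {C} {C′} e e′ e″ refl A≗ B≗ C≗ m = trans (sym (shift-shift e (e′ ℕ.+ e″) (A *ₚ (B *ₚ (C *ₚ 1ₚ))) m))
    (shift-cong e (λ m → trans (sym (shift-*ʳ (e′ ℕ.+ e″) A (B *ₚ (C *ₚ 1ₚ)) m)) (*ₚ-cong A≗ (nest₂ {A = B} {B = C} e′ e″ refl B≗ C≗) m)) m)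

  -- In the following, c, c′, c″ ∈ {0, 1} tell which indices are at least i.

  private
    ex : ℕ → ℕ → ℕ
    ex zero    x = x ℕ.* x
    ex (suc _) x = x ℕ.* x ℕ.+ x

    lo : ℕ → ℤ → ℕ → ℤ
    lo zero    L x = L - + x
    lo (suc _) L x = L - 1ℤ - + x

    layer : ℕ → (ℤ → ℕ → PS) → ℤ → ℕ → PS
    layer c f L M m = ∑ (suc M) (λ x → (Γ′ (M ∸ x) (+ 2 * L) *ₚ shiftₚ (ex c x) (f (lo c L x) x)) m)

    base : ℤ → ℕ → PS
    base L M = Γ′ M (+ 2 * L)

    -- Exponents and parameters are left as hypotheses, because `lhsExp` and `α` compute to
    -- polynomials only when i is a numeral.
    LHS₂ : ∀ i c n m → (∀ x → lhsExp 2 i (x ∷ []) ≡ ex c x) →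
      (∀ x → + n - + 0 - + x - α i 1 ≡ lo c (+ n) x) →
      LHS 2 i n m ≡ ∑ (suc m) (λ x → shiftₚ (ex c x) (base (lo c (+ n) x) x) m)
    LHS₂ i c n m E l₁ = trans (sum-decr-1 (λ ns → lhsTerm 2 i n ns m) m)
      (∑-cong (suc m) (λ x → nest₁ {A = qBinom' (lhsTop i n (x ∷ []) 1) (+ x - + 0)} (E x) (factor n 0 x 0 (α i 1) (lo c (+ n) x) z≤n (l₁ x)) m))

    LHS₃ : ∀ i c c′ n m → (∀ x y → lhsExp 3 i (x ∷ y ∷ []) ≡ ex c x ℕ.+ ex c′ y) →
      (∀ x → + n - + 0 - + x - α i 1 ≡ lo c (+ n) x) →
      (∀ x y → + n - + (x ℕ.+ 0) - + y - α i 2 ≡ lo c′ (lo c (+ n) x) y) →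
      LHS 3 i n m ≡ ∑ (suc m) (λ x → shiftₚ (ex c x) (layer c′ base (lo c (+ n) x) x) m)
    LHS₃ i c c′ n m E l₁ l₂ = trans (sum-decr-2 (λ ns → lhsTerm 3 i n ns m) m)
      (∑-cong (suc m) (λ x → trans
        (∑-cong-< (suc x) (λ y y<x → nest₂ {A = qBinom' (lhsTop i n (x ∷ y ∷ []) 1) (+ x - + y)} {B = qBinom' (lhsTop i n (x ∷ y ∷ []) 2) (+ y - + 0)}
            (ex c x) (ex c′ y) (E x y)
            (factor n 0 x y (α i 1) (lo c (+ n) x) (ℕₚ.≤-pred y<x) (l₁ x))
            (factor n (x ℕ.+ 0) y 0 (α i 2) (lo c′ (lo c (+ n) x) y) z≤n (l₂ x y)) m))
        (sym (shift-∑ (ex c x) (suc x) (λ y → Γ′ (x ∸ y) (+ 2 * lo c (+ n) x) *ₚ shiftₚ (ex c′ y) (base (lo c′ (lo c (+ n) x) y) y)) m))))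

    LHS₄ : ∀ i c c′ c″ n m → (∀ x y z → lhsExp 4 i (x ∷ y ∷ z ∷ []) ≡ ex c x ℕ.+ (ex c′ y ℕ.+ ex c″ z)) →
      (∀ x → + n - + 0 - + x - α i 1 ≡ lo c (+ n) x) →
      (∀ x y → + n - + (x ℕ.+ 0) - + y - α i 2 ≡ lo c′ (lo c (+ n) x) y) →
      (∀ x y z → + n - + (x ℕ.+ (y ℕ.+ 0)) - + z - α i 3 ≡ lo c″ (lo c′ (lo c (+ n) x) y) z) →
      LHS 4 i n m ≡ ∑ (suc m) (λ x → shiftₚ (ex c x) (layer c′ (layer c″ base) (lo c (+ n) x) x) m)
    LHS₄ i c c′ c″ n m E l₁ l₂ l₃ = trans (sum-decr-3 (λ ns → lhsTerm 4 i n ns m) m)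
      (∑-cong (suc m) (λ x → trans
        (∑-cong-< (suc x) (λ y y<x → trans
          (∑-cong-< (suc y) (λ z z<y → nest₃
            {A = qBinom' (lhsTop i n (x ∷ y ∷ z ∷ []) 1) (+ x - + y)} {B = qBinom' (lhsTop i n (x ∷ y ∷ z ∷ []) 2) (+ y - + z)} {C = qBinom' (lhsTop i n (x ∷ y ∷ z ∷ []) 3) (+ z - + 0)}
            (ex c x) (ex c′ y) (ex c″ z) (E x y z)
            (factor n 0 x y (α i 1) (lo c (+ n) x) (ℕₚ.≤-pred y<x) (l₁ x))
            (factor n (x ℕ.+ 0) y z (α i 2) (lo c′ (lo c (+ n) x) y) (ℕₚ.≤-pred z<y) (l₂ x y))
            (factor n (x ℕ.+ (y ℕ.+ 0)) z 0 (α i 3) (lo c″ (lo c′ (lo c (+ n) x) y) z) z≤n (l₃ x y z)) m))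
          (inner x y)))
        (sym (shift-∑ (ex c x) (suc x) (λ y → W x y *ₚ shiftₚ (ex c′ y) (layer c″ base (lo c′ (lo c (+ n) x) y) y)) m))))
      where
      W : ℕ → ℕ → PS
      W x y = Γ′ (x ∸ y) (+ 2 * lo c (+ n) x)
      V : ℕ → ℕ → ℕ → PS
      V x y z = Γ′ (y ∸ z) (+ 2 * lo c′ (lo c (+ n) x) y) *ₚ shiftₚ (ex c″ z) (base (lo c″ (lo c′ (lo c (+ n) x) y) z) z)
      inner : ∀ x y → ∑ (suc y) (λ z → shiftₚ (ex c x) (W x y *ₚ shiftₚ (ex c′ y) (V x y z)) m)
        ≡ shiftₚ (ex c x) (W x y *ₚ shiftₚ (ex c′ y) (layer c″ base (lo c′ (lo c (+ n) x) y) y)) m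
      inner x y = trans (sym (shift-∑ (ex c x) (suc y) (λ z → W x y *ₚ shiftₚ (ex c′ y) (V x y z)) m))
        (shift-cong (ex c x) (λ m → trans (sym (*ₚ-∑ (W x y) (suc y) (λ z → shiftₚ (ex c′ y) (V x y z)) m))
          (*ₚ-cong {W x y} ≗-refl (λ m → sym (shift-∑ (ex c′ y) (suc y) (V x y) m)) m)) m)

  -- The outermost index is the limit transform: unshifted for i ≥ 2, followed by i - 2 unshifted
  -- and k - i shifted layers, and shifted for i = 1, followed by k - 2 shifted layers. The
  -- innermost binomial is part of this count.
  LHS≡H : ∀ k i n B m → k ≡ 2 ⊎ k ≡ 3 ⊎ k ≡ 4 → 1 ℕ.≤ i → i ℕ.≤ k → n ℕ.≤ B →
    LHS k i n m ≡ H (+ (2 ℕ.* k ℕ.+ 1)) (+ i) B (+ n) (+ n) m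
  LHS≡H _ zero _ _ _ _ () _ _
  LHS≡H _ 1 n B m (inj₁ refl) _ _ n≤B = trans (LHS₂ 1 1 n m (λ x → E x) (λ x → l₁ (+ n) (+ x))) (multisum₁ 0 n B m n≤B)
    where
    E : ∀ x → x ℕ.* x ℕ.+ 0 ℕ.+ (x ℕ.+ 0) ≡ x ℕ.* x ℕ.+ x
    E = ℕ-Solver.solve-∀
    l₁ : ∀ n x → n - + 0 - x - + 1 ≡ n - 1ℤ - x
    l₁ = solve-∀
  LHS≡H _ 2 n B m (inj₁ refl) _ _ n≤B = trans (LHS₂ 2 0 n m (λ x → E x) (λ x → l₁ (+ n) (+ x))) (multisum₀ 0 0 n B m n≤B)
    where
    E : ∀ x → x ℕ.* x ℕ.+ 0 ℕ.+ 0 ≡ x ℕ.* x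
    E = ℕ-Solver.solve-∀
    l₁ : ∀ n x → n - + 0 - x - + 0 ≡ n - x
    l₁ = solve-∀
  LHS≡H _ (suc (suc (suc _))) n B m (inj₁ refl) _ (s≤s (s≤s ())) _
  LHS≡H _ 1 n B m (inj₂ (inj₁ refl)) _ _ n≤B =
    trans (LHS₃ 1 1 1 n m E (λ x → l₁ (+ n) (+ x)) (λ x y → l₂ (+ n) (+ x) (+ y))) (multisum₁ 1 n B m n≤B)
    where
    E : ∀ x y → x ℕ.* x ℕ.+ (y ℕ.* y ℕ.+ 0) ℕ.+ (x ℕ.+ (y ℕ.+ 0)) ≡ x ℕ.* x ℕ.+ x ℕ.+ (y ℕ.* y ℕ.+ y)
    E = ℕ-Solver.solve-∀
    l₁ : ∀ n x → n - + 0 - x - + 1 ≡ n - 1ℤ - x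
    l₁ = solve-∀
    l₂ : ∀ n x y → n - (x + 0ℤ) - y - + 2 ≡ n - 1ℤ - x - 1ℤ - y
    l₂ = solve-∀
  LHS≡H _ 2 n B m (inj₂ (inj₁ refl)) _ _ n≤B =
    trans (LHS₃ 2 0 1 n m E (λ x → l₁ (+ n) (+ x)) (λ x y → l₂ (+ n) (+ x) (+ y))) (multisum₀ 0 1 n B m n≤B)
    where
    E : ∀ x y → x ℕ.* x ℕ.+ (y ℕ.* y ℕ.+ 0) ℕ.+ (y ℕ.+ 0) ≡ x ℕ.* x ℕ.+ (y ℕ.* y ℕ.+ y)
    E = ℕ-Solver.solve-∀
    l₁ : ∀ n x → n - + 0 - x - + 0 ≡ n - x
    l₁ = solve-∀
    l₂ : ∀ n x y → n - (x + 0ℤ) - y - + 1 ≡ n - x - 1ℤ - y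
    l₂ = solve-∀
  LHS≡H _ 3 n B m (inj₂ (inj₁ refl)) _ _ n≤B =
    trans (LHS₃ 3 0 0 n m E (λ x → l₁ (+ n) (+ x)) (λ x y → l₂ (+ n) (+ x) (+ y))) (multisum₀ 1 0 n B m n≤B)
    where
    E : ∀ x y → x ℕ.* x ℕ.+ (y ℕ.* y ℕ.+ 0) ℕ.+ 0 ≡ x ℕ.* x ℕ.+ y ℕ.* y
    E = ℕ-Solver.solve-∀
    l₁ : ∀ n x → n - + 0 - x - + 0 ≡ n - x
    l₁ = solve-∀
    l₂ : ∀ n x y → n - (x + 0ℤ) - y - + 0 ≡ n - x - y
    l₂ = solve-∀
  LHS≡H _ (suc (suc (suc (suc _)))) n B m (inj₂ (inj₁ refl)) _ (s≤s (s≤s (s≤s ()))) _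
  LHS≡H _ 1 n B m (inj₂ (inj₂ refl)) _ _ n≤B =
    trans (LHS₄ 1 1 1 1 n m E (λ x → l₁ (+ n) (+ x)) (λ x y → l₂ (+ n) (+ x) (+ y)) (λ x y z → l₃ (+ n) (+ x) (+ y) (+ z))) (multisum₁ 2 n B m n≤B)
    where
    E : ∀ x y z → x ℕ.* x ℕ.+ (y ℕ.* y ℕ.+ (z ℕ.* z ℕ.+ 0)) ℕ.+ (x ℕ.+ (y ℕ.+ (z ℕ.+ 0))) ≡ x ℕ.* x ℕ.+ x ℕ.+ ((y ℕ.* y ℕ.+ y) ℕ.+ (z ℕ.* z ℕ.+ z))
    E = ℕ-Solver.solve-∀
    l₁ : ∀ n x → n - + 0 - x - + 1 ≡ n - 1ℤ - x
    l₁ = solve-∀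
    l₂ : ∀ n x y → n - (x + 0ℤ) - y - + 2 ≡ n - 1ℤ - x - 1ℤ - y
    l₂ = solve-∀
    l₃ : ∀ n x y z → n - (x + (y + 0ℤ)) - z - + 3 ≡ n - 1ℤ - x - 1ℤ - y - 1ℤ - z
    l₃ = solve-∀
  LHS≡H _ 2 n B m (inj₂ (inj₂ refl)) _ _ n≤B =
    trans (LHS₄ 2 0 1 1 n m E (λ x → l₁ (+ n) (+ x)) (λ x y → l₂ (+ n) (+ x) (+ y)) (λ x y z → l₃ (+ n) (+ x) (+ y) (+ z))) (multisum₀ 0 2 n B m n≤B)
    where
    E : ∀ x y z → x ℕ.* x ℕ.+ (y ℕ.* y ℕ.+ (z ℕ.* z ℕ.+ 0)) ℕ.+ (y ℕ.+ (z ℕ.+ 0)) ≡ x ℕ.* x ℕ.+ ((y ℕ.* y ℕ.+ y) ℕ.+ (z ℕ.* z ℕ.+ z))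
    E = ℕ-Solver.solve-∀
    l₁ : ∀ n x → n - + 0 - x - + 0 ≡ n - x
    l₁ = solve-∀
    l₂ : ∀ n x y → n - (x + 0ℤ) - y - + 1 ≡ n - x - 1ℤ - y
    l₂ = solve-∀
    l₃ : ∀ n x y z → n - (x + (y + 0ℤ)) - z - + 2 ≡ n - x - 1ℤ - y - 1ℤ - z
    l₃ = solve-∀
  LHS≡H _ 3 n B m (inj₂ (inj₂ refl)) _ _ n≤B =
    trans (LHS₄ 3 0 0 1 n m E (λ x → l₁ (+ n) (+ x)) (λ x y → l₂ (+ n) (+ x) (+ y)) (λ x y z → l₃ (+ n) (+ x) (+ y) (+ z))) (multisum₀ 1 1 n B m n≤B)
    where
    E : ∀ x y z → x ℕ.* x ℕ.+ (y ℕ.* y ℕ.+ (z ℕ.* z ℕ.+ 0)) ℕ.+ (z ℕ.+ 0) ≡ x ℕ.* x ℕ.+ (y ℕ.* y ℕ.+ (z ℕ.* z ℕ.+ z))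
    E = ℕ-Solver.solve-∀
    l₁ : ∀ n x → n - + 0 - x - + 0 ≡ n - x
    l₁ = solve-∀
    l₂ : ∀ n x y → n - (x + 0ℤ) - y - + 0 ≡ n - x - y
    l₂ = solve-∀
    l₃ : ∀ n x y z → n - (x + (y + 0ℤ)) - z - + 1 ≡ n - x - y - 1ℤ - z
    l₃ = solve-∀
  LHS≡H _ 4 n B m (inj₂ (inj₂ refl)) _ _ n≤B =
    trans (LHS₄ 4 0 0 0 n m E (λ x → l₁ (+ n) (+ x)) (λ x y → l₂ (+ n) (+ x) (+ y)) (λ x y z → l₃ (+ n) (+ x) (+ y) (+ z))) (multisum₀ 2 0 n B m n≤B)
    where
    E : ∀ x y z → x ℕ.* x ℕ.+ (y ℕ.* y ℕ.+ (z ℕ.* z ℕ.+ 0)) ℕ.+ 0 ≡ x ℕ.* x ℕ.+ (y ℕ.* y ℕ.+ z ℕ.* z)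
    E = ℕ-Solver.solve-∀
    l₁ : ∀ n x → n - + 0 - x - + 0 ≡ n - x
    l₁ = solve-∀
    l₂ : ∀ n x y → n - (x + 0ℤ) - y - + 0 ≡ n - x - y
    l₂ = solve-∀
    l₃ : ∀ n x y z → n - (x + (y + 0ℤ)) - z - + 0 ≡ n - x - y - z
    l₃ = solve-∀
  LHS≡H _ (suc (suc (suc (suc (suc _))))) n B m (inj₂ (inj₂ refl)) _ (s≤s (s≤s (s≤s (s≤s ())))) _

  LHS≡RHS : ∀ k i n m → k ≡ 2 ⊎ k ≡ 3 ⊎ k ≡ 4 → 1 ℕ.≤ i → i ℕ.≤ k → LHS k i n m ≡ RHS k i n m
  LHS≡RHS k i n m k∈ i≥1 i≤k = trans (LHS≡H k i n (m ℕ.+ n) m k∈ i≥1 i≤k (ℕₚ.m≤n+m n m)) (sym (RHS≡H k i n i≥1 i≤k (m ℕ.+ n) m (ℕₚ.m≤m+n m n)))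

-- Recurrence, boundary relations and axis values of H.

module StripRecurrence where

  open PowerSeries
  open GaussianBinomials
  open Summations
  open BosonicSums
  open BurgeTransform using (H)
  open import Data.Integer using (ℤ; +_; -[1+_]; _+_; _*_; _-_; -_; 0ℤ; 1ℤ)

  private
    mon-diff : ∀ e n f m → mon e (diff n f) m ≡ mon e f m - mon (e + + n) f m
    mon-diff e n f m = trans (mon-+ e f (negₚ (shiftₚ n f)) m)
      (+-congˡ (mon e f m) (trans (mon-neg (shiftₚ n f)) (cong -_ (mon-shift e n f m))))
      where
      mon-neg : ∀ g → mon e (negₚ g) m ≡ - mon e g m
      mon-neg g with + m - e
      ... | + _      = refl
      ... | -[1+ _ ] = refl

    x-x : ∀ x → x - x ≡ 0ℤ
    x-x = solve-∀

  Γ-absorb : ∀ u v e m → t₁ e u v m - t₁ (e + u) u v m ≡ t₁ e (u - 1ℤ) v m - t₁ (e + (u + v)) (u - 1ℤ) v m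
  Γ-absorb -[1+ u ] v e m = cong₂ _-_
    (trans (mon-zero e ≗-refl m) (sym (mon-zero e ≗-refl m)))
    (trans (mon-zero (e + -[1+ u ]) ≗-refl m) (sym (mon-zero (e + (-[1+ u ] + v)) ≗-refl m)))
  Γ-absorb (+ zero) -[1+ v ] e m = cong₂ _-_
    (trans (mon-zero e ≗-refl m) (sym (mon-zero e ≗-refl m)))
    (trans (mon-zero (e + 0ℤ) ≗-refl m) (sym (mon-zero (e + (0ℤ + -[1+ v ])) ≗-refl m)))
  Γ-absorb (+ suc u) -[1+ v ] e m = cong₂ _-_
    (trans (mon-zero e ≗-refl m) (sym (mon-zero e ≗-refl m)))
    (trans (mon-zero (e + + suc u) ≗-refl m) (sym (mon-zero (e + (+ suc u + -[1+ v ])) ≗-refl m)))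
  Γ-absorb (+ zero) (+ v) e m = trans (trans (cong (λ z → t₁ e 0ℤ (+ v) m - t₁ z 0ℤ (+ v) m) (ℤₚ.+-identityʳ e)) (x-x (t₁ e 0ℤ (+ v) m)))
    (sym (cong₂ _-_ (mon-zero e ≗-refl m) (mon-zero (e + (0ℤ + + v)) ≗-refl m)))
  Γ-absorb (+ suc u) (+ v) e m = trans (sym (mon-diff e (suc u) (Γℕ (suc u) v) m))
    (trans (mon-cong {e} refl (Γℕ-absorb u v) m) (mon-diff e (suc u ℕ.+ v) (Γℕ u v) m))

  Γ-absorb′ : ∀ u v e m → t₁ e u v m - t₁ (e + v) u v m ≡ t₁ e u (v - 1ℤ) m - t₁ (e + (u + v)) u (v - 1ℤ) m
  Γ-absorb′ u v e m = trans (cong₂ _-_ (flip e u v) (flip (e + v) u v)) (trans (Γ-absorb v u e m)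
    (cong₂ _-_ (flip e (v - 1ℤ) u) (trans (flip (e + (v + u)) (v - 1ℤ) u) (t₁-cong {u = u} {v - 1ℤ} (cong (λ z → e + z) (ℤₚ.+-comm v u)) refl refl m))))
    where
    flip : ∀ e u v → t₁ e u v m ≡ t₁ e v u m
    flip e u v = mon-cong {e} refl (Γ-sym u v) m

  -- In Pascal's rule the term q^u T(u,v-1) equals T(u,v-1) - (1-q^u) T(u,v-1), and absorption turns
  -- the last product into (1-q^(u+v-1)) T(u-1,v-1). The gain is that the coefficients involve u + v
  -- only.
  Γ-rec : ∀ u v e m → u + v ≢ 0ℤ →
    t₁ e u v m ≡ t₁ e (u - 1ℤ) v m + t₁ e u (v - 1ℤ) m - (t₁ e (u - 1ℤ) (v - 1ℤ) m - t₁ (e + (u + v - 1ℤ)) (u - 1ℤ) (v - 1ℤ) m)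
  Γ-rec u v e m u+v≢0 = begin
    t₁ e u v m
      ≡⟨ unit e u v ⟩
    mon e (Γ u v *ₚ 1ₚ) m
      ≡⟨ Γ-pascal u v 1ₚ e m (λ p q → ⊥-elim (u+v≢0 (cong₂ _+_ p q))) ⟩
    mon e (Γ (u - 1ℤ) v *ₚ 1ₚ) m + mon (e + u) (Γ u (v - 1ℤ) *ₚ 1ₚ) m
      ≡⟨ cong₂ _+_ (sym (unit e (u - 1ℤ) v)) (sym (unit (e + u) u (v - 1ℤ))) ⟩
    t₁ e (u - 1ℤ) v m + t₁ (e + u) u (v - 1ℤ) m
      ≡⟨ lem (t₁ e (u - 1ℤ) v m) (t₁ e u (v - 1ℤ) m) (t₁ (e + u) u (v - 1ℤ) m) ⟩
    t₁ e (u - 1ℤ) v m + t₁ e u (v - 1ℤ) m - (t₁ e u (v - 1ℤ) m - t₁ (e + u) u (v - 1ℤ) m)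
      ≡⟨ cong (λ z → t₁ e (u - 1ℤ) v m + t₁ e u (v - 1ℤ) m - z) (trans (Γ-absorb u (v - 1ℤ) e m)
           (cong (λ z → t₁ e (u - 1ℤ) (v - 1ℤ) m - z) (t₁-cong {u = u - 1ℤ} {v - 1ℤ} (lem′ e u v) refl refl m))) ⟩
    t₁ e (u - 1ℤ) v m + t₁ e u (v - 1ℤ) m - (t₁ e (u - 1ℤ) (v - 1ℤ) m - t₁ (e + (u + v - 1ℤ)) (u - 1ℤ) (v - 1ℤ) m) ∎
    where
    open ≡-Reasoning
    unit : ∀ e u v → t₁ e u v m ≡ mon e (Γ u v *ₚ 1ₚ) m
    unit e u v = mon-cong {e} refl (≗-sym (*ₚ-identityʳ (Γ u v))) m
    lem : ∀ x y z → x + z ≡ x + y - (y - z)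
    lem = solve-∀
    lem′ : ∀ e u v → e + (u + (v - 1ℤ)) ≡ e + (u + v - 1ℤ)
    lem′ = solve-∀

  module _ {K i : ℤ} (i≥1 : NN (i - 1ℤ)) (K≥2i : NN (K - + 2 * i)) where

    private
      i≥0 : NN i
      i≥0 = nn-≡ (nn-+ i≥1 (nn 1)) (lem i)
        where
        lem : ∀ i → i - 1ℤ + + 1 ≡ i
        lem = solve-∀

      K≥1 : NN (K - 1ℤ)
      K≥1 = nn-≡ (nn-+ K≥2i (nn-+ (nn-* (nn 2) i≥1) (nn 1))) (lem K i)
        where
        lem : ∀ K i → K - + 2 * i + (+ 2 * (i - 1ℤ) + + 1) ≡ K - 1ℤ
        lem = solve-∀

      f₁ f₂ : ℤ → ℤ → ℕ → ℤ → ℤ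
      f₁ a b m s = t₁ (e₁ K i s) (a + K * s) (b - K * s) m
      f₂ a b m s = t₁ (e₂ K i s) (a - K * s + i) (b + K * s - i) m

      shift-H : ∀ B N a b m → shiftₚ N (H K i B a b) m ≡
        Σℤ B (λ s → t₁ (e₁ K i s + + N) (a + K * s) (b - K * s) m - t₁ (e₂ K i s + + N) (a - K * s + i) (b + K * s - i) m)
      shift-H B N a b m = trans (shift-Bos {K} {i} i≥0 K≥2i B N (λ s → Γ (a + K * s) (b - K * s)) (λ s → Γ (a - K * s + i) (b + K * s - i)) m)
        (Σℤ-cong B (λ s → cong₂ _-_
          (t₁-cong {u = a + K * s} {b - K * s} (ℤₚ.+-comm (+ N) (e₁ K i s)) refl refl m)
          (t₁-cong {u = a - K * s + i} {b + K * s - i} (ℤₚ.+-comm (+ N) (e₂ K i s)) refl refl m)))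

      Σℤ-combine : ∀ B (f g h k l : ℤ → ℤ) → (∀ s → f s ≡ g s + h s - (k s - l s)) → Σℤ B f ≡ Σℤ B g + Σℤ B h - (Σℤ B k - Σℤ B l)
      Σℤ-combine B f g h k l eq = trans (Σℤ-cong B eq) (trans (Σℤ-- B (λ s → g s + h s) (λ s → k s - l s)) (cong₂ _-_ (Σℤ-+ B g h) (Σℤ-- B k l)))

      subtract : ∀ a b c d a′ b′ c′ d′ → (a + b - (c - d)) - (a′ + b′ - (c′ - d′)) ≡ (a - a′) + (b - b′) - ((c - c′) - (d - d′))
      subtract = solve-∀

      a-1+ : ∀ a K s → a + K * s - 1ℤ ≡ a - 1ℤ + K * s
      a-1+ = solve-∀
      b-1- : ∀ b K s → b - K * s - 1ℤ ≡ b - 1ℤ - K * s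
      b-1- = solve-∀
      a-1+i : ∀ a K i s → a - K * s + i - 1ℤ ≡ a - 1ℤ - K * s + i
      a-1+i = solve-∀
      b-1-i : ∀ b K i s → b + K * s - i - 1ℤ ≡ b - 1ℤ + K * s - i
      b-1-i = solve-∀
      sum₁ : ∀ a b K s → a + K * s + (b - K * s) ≡ a + b
      sum₁ = solve-∀
      sum₂ : ∀ a b K i s → a - K * s + i + (b + K * s - i) ≡ a + b
      sum₂ = solve-∀

    -- All translates and reflections of (a, b) have the coordinate sum a + b, so `Γ-rec` has the
    -- same coefficients in every term of the signed sum.
    H-rec : ∀ B a b N m → a + b ≢ 0ℤ → a + b - 1ℤ ≡ + N →
      H K i B a b m ≡ H K i B (a - 1ℤ) b m + H K i B a (b - 1ℤ) m - diff N (H K i B (a - 1ℤ) (b - 1ℤ)) m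
    H-rec B a b N m a+b≢0 N≡ = trans
      (Σℤ-combine B (λ s → f₁ a b m s - f₂ a b m s) (λ s → f₁ (a - 1ℤ) b m s - f₂ (a - 1ℤ) b m s) (λ s → f₁ a (b - 1ℤ) m s - f₂ a (b - 1ℤ) m s)
        (λ s → f₁ (a - 1ℤ) (b - 1ℤ) m s - f₂ (a - 1ℤ) (b - 1ℤ) m s)
        (λ s → t₁ (e₁ K i s + + N) (a - 1ℤ + K * s) (b - 1ℤ - K * s) m - t₁ (e₂ K i s + + N) (a - 1ℤ - K * s + i) (b - 1ℤ + K * s - i) m)
        (λ s → trans (cong₂ _-_ (first s) (second s)) (subtract (f₁ (a - 1ℤ) b m s) (f₁ a (b - 1ℤ) m s) (f₁ (a - 1ℤ) (b - 1ℤ) m s) _ (f₂ (a - 1ℤ) b m s) (f₂ a (b - 1ℤ) m s) (f₂ (a - 1ℤ) (b - 1ℤ) m s) _)))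
      (cong (λ z → H K i B (a - 1ℤ) b m + H K i B a (b - 1ℤ) m - (H K i B (a - 1ℤ) (b - 1ℤ) m - z)) (sym (shift-H B N (a - 1ℤ) (b - 1ℤ) m)))
      where
      first : ∀ s → f₁ a b m s ≡ f₁ (a - 1ℤ) b m s + f₁ a (b - 1ℤ) m s - (f₁ (a - 1ℤ) (b - 1ℤ) m s - t₁ (e₁ K i s + + N) (a - 1ℤ + K * s) (b - 1ℤ - K * s) m)
      first s = trans (Γ-rec (a + K * s) (b - K * s) (e₁ K i s) m (λ p → a+b≢0 (trans (sym (sum₁ a b K s)) p)))
        (cong₂ _-_ (cong₂ _+_ (t₁-cong {e₁ K i s} {v = b - K * s} refl (a-1+ a K s) refl m) (t₁-cong {e₁ K i s} {a + K * s} refl refl (b-1- b K s) m))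
          (cong₂ _-_ (t₁-cong {e₁ K i s} refl (a-1+ a K s) (b-1- b K s) m)
            (t₁-cong (cong (λ z → e₁ K i s + z) (trans (cong (_- 1ℤ) (sum₁ a b K s)) N≡)) (a-1+ a K s) (b-1- b K s) m)))
      second : ∀ s → f₂ a b m s ≡ f₂ (a - 1ℤ) b m s + f₂ a (b - 1ℤ) m s - (f₂ (a - 1ℤ) (b - 1ℤ) m s - t₁ (e₂ K i s + + N) (a - 1ℤ - K * s + i) (b - 1ℤ + K * s - i) m)
      second s = trans (Γ-rec (a - K * s + i) (b + K * s - i) (e₂ K i s) m (λ p → a+b≢0 (trans (sym (sum₂ a b K i s)) p)))
        (cong₂ _-_ (cong₂ _+_ (t₁-cong {e₂ K i s} {v = b + K * s - i} refl (a-1+i a K i s) refl m) (t₁-cong {e₂ K i s} {a - K * s + i} refl refl (b-1-i b K i s) m))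
          (cong₂ _-_ (t₁-cong {e₂ K i s} refl (a-1+i a K i s) (b-1-i b K i s) m)
            (t₁-cong (cong (λ z → e₂ K i s + z) (trans (cong (_- 1ℤ) (sum₂ a b K i s)) N≡)) (a-1+i a K i s) (b-1-i b K i s) m)))

    -- At a - b = K - i the reflection s ↦ s + 1 exchanges the two halves of the correction term,
    -- and at b - a = i they agree term by term.

    private
      boundary : ∀ B N a b a′ b′ m (z₁ z₂ : ℤ → ℤ) → Σℤ B z₁ ≡ Σℤ B z₂ →
        (∀ s → f₁ a b m s - z₁ s ≡ f₁ a′ b′ m s - t₁ (e₁ K i s + + N) (a′ + K * s) (b′ - K * s) m) →
        (∀ s → f₂ a b m s - z₂ s ≡ f₂ a′ b′ m s - t₁ (e₂ K i s + + N) (a′ - K * s + i) (b′ + K * s - i) m) →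
        H K i B a b m ≡ diff N (H K i B a′ b′) m
      boundary B N a b a′ b′ m z₁ z₂ z≡ p q = begin
        Σℤ B (λ s → f₁ a b m s - f₂ a b m s)
          ≡⟨ Σℤ-- B (f₁ a b m) (f₂ a b m) ⟩
        Σℤ B (f₁ a b m) - Σℤ B (f₂ a b m)
          ≡⟨ shuffle (Σℤ B (f₁ a b m)) (Σℤ B (f₂ a b m)) (Σℤ B z₁) ⟩
        (Σℤ B (f₁ a b m) - Σℤ B z₁) - (Σℤ B (f₂ a b m) - Σℤ B z₁)
          ≡⟨ cong (λ z → (Σℤ B (f₁ a b m) - Σℤ B z₁) - (Σℤ B (f₂ a b m) - z)) z≡ ⟩
        (Σℤ B (f₁ a b m) - Σℤ B z₁) - (Σℤ B (f₂ a b m) - Σℤ B z₂)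
          ≡⟨ cong₂ _-_ (trans (sym (Σℤ-- B (f₁ a b m) z₁)) (trans (Σℤ-cong B p) (Σℤ-- B (f₁ a′ b′ m) g₁)))
                       (trans (sym (Σℤ-- B (f₂ a b m) z₂)) (trans (Σℤ-cong B q) (Σℤ-- B (f₂ a′ b′ m) g₂))) ⟩
        (Σℤ B (f₁ a′ b′ m) - Σℤ B g₁) - (Σℤ B (f₂ a′ b′ m) - Σℤ B g₂)
          ≡⟨ shuffle′ (Σℤ B (f₁ a′ b′ m)) (Σℤ B g₁) (Σℤ B (f₂ a′ b′ m)) (Σℤ B g₂) ⟩
        (Σℤ B (f₁ a′ b′ m) - Σℤ B (f₂ a′ b′ m)) - (Σℤ B g₁ - Σℤ B g₂)
          ≡⟨ sym (cong₂ _-_ (Σℤ-- B (f₁ a′ b′ m) (f₂ a′ b′ m)) (trans (shift-H B N a′ b′ m) (Σℤ-- B g₁ g₂))) ⟩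
        diff N (H K i B a′ b′) m ∎
        where
        open ≡-Reasoning
        g₁ g₂ : ℤ → ℤ
        g₁ s = t₁ (e₁ K i s + + N) (a′ + K * s) (b′ - K * s) m
        g₂ s = t₁ (e₂ K i s + + N) (a′ - K * s + i) (b′ + K * s - i) m
        shuffle : ∀ x y z → x - y ≡ (x - z) - (y - z)
        shuffle = solve-∀
        shuffle′ : ∀ x y z w → (x - y) - (z - w) ≡ (x - z) - (y - w)
        shuffle′ = solve-∀

    -- The point lies one step outside the strip, a - b = c₁ + 1. In `H-rec` at the neighbouring
    -- boundary point this relation cancels two terms. The bound B > b makes the ends of the
    -- translated sum vanish.
    H-upper : ∀ B a b N m → a ≡ b + K - i → a + b ≡ + N → NN (+ B - b - 1ℤ) → NN b → H K i B a b m ≡ diff N (H K i B (a - 1ℤ) b) m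
    H-upper B a b N m a≡ N≡ B>b b≥0 = boundary B N a b (a - 1ℤ) b m z₁ z₂
        (trans (Σℤ-cong B z₁≡) (Σℤ-shift₀ B z₂ low high))
        (λ s → trans (Γ-absorb (a + K * s) (b - K * s) (e₁ K i s) m) (cong₂ _-_ (t₁-cong {e₁ K i s} {v = b - K * s} refl (a-1+ a K s) refl m)
          (t₁-cong {v = b - K * s} (cong (λ z → e₁ K i s + z) (trans (sum₁ a b K s) N≡)) (a-1+ a K s) refl m)))
        (λ s → trans (Γ-absorb (a - K * s + i) (b + K * s - i) (e₂ K i s) m) (cong₂ _-_ (t₁-cong {e₂ K i s} {v = b + K * s - i} refl (a-1+i a K i s) refl m)
          (t₁-cong {v = b + K * s - i} (cong (λ z → e₂ K i s + z) (trans (sum₂ a b K i s) N≡)) (a-1+i a K i s) refl m)))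
      where
      z₁ z₂ : ℤ → ℤ
      z₁ s = t₁ (e₁ K i s + (a + K * s)) (a + K * s) (b - K * s) m
      z₂ s = t₁ (e₂ K i s + (a - K * s + i)) (a - K * s + i) (b + K * s - i) m
      l₁ : ∀ b K i s → s * (+ 2 * K * s + K - + 2 * i) + (b + K - i + K * s) ≡ (+ 2 * (s + 1ℤ) - 1ℤ) * (K * (s + 1ℤ) - i) + (b + K - i - K * (s + 1ℤ) + i)
      l₁ = solve-∀
      l₂ : ∀ b K i s → b + K - i + K * s ≡ b + K * (s + 1ℤ) - i
      l₂ = solve-∀
      l₃ : ∀ b K i s → b - K * s ≡ b + K - i - K * (s + 1ℤ) + i
      l₃ = solve-∀
      l₄ : ∀ B b K i → b + K * - B - i + ((K - 1ℤ) * B + (B - b - 1ℤ) + (i - 1ℤ) + + 1) ≡ - 1ℤ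
      l₄ = solve-∀
      l₅ : ∀ B b K i → b + K - i - K * (1ℤ + B) + i + ((K - 1ℤ) * B + (B - b - 1ℤ)) ≡ - 1ℤ
      l₅ = solve-∀
      exponent : ∀ s → e₁ K i s + (a + K * s) ≡ e₂ K i (s + 1ℤ) + (a - K * (s + 1ℤ) + i)
      exponent s = subst (λ a → e₁ K i s + (a + K * s) ≡ e₂ K i (s + 1ℤ) + (a - K * (s + 1ℤ) + i)) (sym a≡) (l₁ b K i s)
      z₁≡ : ∀ s → z₁ s ≡ z₂ (s + 1ℤ)
      z₁≡ s = trans (mon-cong {e₁ K i s + (a + K * s)} refl (Γ-sym (a + K * s) (b - K * s)) m)
        (t₁-cong (exponent s) (trans (l₃ b K i s) (cong (λ a → a - K * (s + 1ℤ) + i) (sym a≡))) (trans (cong (λ a → a + K * s) a≡) (l₂ b K i s)) m)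
      low : z₂ (- + B) ≡ 0ℤ
      low = t₁-vanish (e₂ K i (- + B) + (a - K * - + B + i)) (a - K * - + B + i) (b + K * - + B - i)
        (λ _ p → nn-absurd (nn-+ p (nn-+ (nn-+ (nn-+ (nn-* K≥1 (nn B)) B>b) i≥1) (nn 1))) (l₄ (+ B) b K i)) m
      high : z₂ (+ suc B) ≡ 0ℤ
      high = t₁-vanish (e₂ K i (+ suc B) + (a - K * + suc B + i)) (a - K * + suc B + i) (b + K * + suc B - i)
        (λ p _ → nn-absurd (nn-+ p (nn-+ (nn-* K≥1 (nn B)) B>b)) (trans (cong (λ a → a - K * + suc B + i + ((K - 1ℤ) * + B + (+ B - b - 1ℤ))) a≡) (l₅ (+ B) b K i))) m

    H-lower : ∀ B a b N m → b ≡ a + i → a + b ≡ + N → H K i B a b m ≡ diff N (H K i B a (b - 1ℤ)) m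
    H-lower B a b N m b≡ N≡ = boundary B N a b a (b - 1ℤ) m z₁ z₂ (Σℤ-cong B z₁≡)
        (λ s → trans (Γ-absorb′ (a + K * s) (b - K * s) (e₁ K i s) m) (cong₂ _-_ (t₁-cong {e₁ K i s} {a + K * s} refl refl (b-1- b K s) m)
          (t₁-cong {u = a + K * s} (cong (λ z → e₁ K i s + z) (trans (sum₁ a b K s) N≡)) refl (b-1- b K s) m)))
        (λ s → trans (Γ-absorb′ (a - K * s + i) (b + K * s - i) (e₂ K i s) m) (cong₂ _-_ (t₁-cong {e₂ K i s} {a - K * s + i} refl refl (b-1-i b K i s) m)
          (t₁-cong {u = a - K * s + i} (cong (λ z → e₂ K i s + z) (trans (sum₂ a b K i s) N≡)) refl (b-1-i b K i s) m)))
      where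
      z₁ z₂ : ℤ → ℤ
      z₁ s = t₁ (e₁ K i s + (b - K * s)) (a + K * s) (b - K * s) m
      z₂ s = t₁ (e₂ K i s + (b + K * s - i)) (a - K * s + i) (b + K * s - i) m
      l₁ : ∀ b K i s → s * (+ 2 * K * s + K - + 2 * i) + (b - K * s) ≡ (+ 2 * s - 1ℤ) * (K * s - i) + (b + K * s - i)
      l₁ = solve-∀
      l₂ : ∀ a K i s → a + i - K * s ≡ a - K * s + i
      l₂ = solve-∀
      l₃ : ∀ a K i s → a + K * s ≡ a + i + K * s - i
      l₃ = solve-∀
      z₁≡ : ∀ s → z₁ s ≡ z₂ s
      z₁≡ s = trans (mon-cong {e₁ K i s + (b - K * s)} refl (Γ-sym (a + K * s) (b - K * s)) m)
        (t₁-cong (l₁ b K i s) (trans (cong (λ b → b - K * s) b≡) (l₂ a K i s)) (trans (l₃ a K i s) (cong (λ b → b + K * s - i) (sym b≡))) m)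

    private
      H-single : ∀ B a b m → (∀ s → s ≢ 0ℤ → NN (a + K * s) → NN (b - K * s) → ⊥) → (∀ s → NN (a - K * s + i) → NN (b + K * s - i) → ⊥) →
        H K i B a b m ≡ t₁ 0ℤ a b m
      H-single B a b m p q = trans (+-congˡ (f₁ a b m 0ℤ - f₂ a b m 0ℤ) (∑-zero B (λ t → cong₂ _+_ (off (+ suc t) (λ ())) (off -[1+ t ] (λ ())))))
        (trans (ℤₚ.+-identityʳ (f₁ a b m 0ℤ - f₂ a b m 0ℤ)) (trans (cong (λ z → f₁ a b m 0ℤ - z) (second 0ℤ)) (trans (ℤₚ.+-identityʳ (f₁ a b m 0ℤ))
          (t₁-cong {0ℤ} refl (l₁ a K) (l₂ b K) m))))
        where
        l₁ : ∀ a K → a + K * 0ℤ ≡ a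
        l₁ = solve-∀
        l₂ : ∀ b K → b - K * 0ℤ ≡ b
        l₂ = solve-∀
        second : ∀ s → f₂ a b m s ≡ 0ℤ
        second s = t₁-vanish (e₂ K i s) (a - K * s + i) (b + K * s - i) (q s) m
        off : ∀ s → s ≢ 0ℤ → f₁ a b m s - f₂ a b m s ≡ 0ℤ
        off s s≢0 = cong₂ _-_ (t₁-vanish (e₁ K i s) (a + K * s) (b - K * s) (p s s≢0) m) (second s)

      K·≥0 : ∀ {t} → NN t → NN ((K - 1ℤ) * t + t)
      K·≥0 t≥0 = nn-+ (nn-* K≥1 t≥0) t≥0

      -1-[s-1] : ∀ s → - 1ℤ - (s - 1ℤ) ≡ - s
      -1-[s-1] = solve-∀

      by-sign₀ : ∀ s → s ≢ 0ℤ → (NN (s - 1ℤ) → ⊥) → (NN (- 1ℤ - s) → ⊥) → ⊥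
      by-sign₀ s s≢0 p n = by-sign (s - 1ℤ) p (λ s≤0 → by-sign s (λ s≥0 → s≢0 (nn-antisym s s≥0 (nn-≡ s≤0 (-1-[s-1] s)))) n)

      l₁ : ∀ K s → 0ℤ - K * s + ((K - 1ℤ) * (s - 1ℤ) + (s - 1ℤ) + (K - 1ℤ)) ≡ - 1ℤ
      l₁ = solve-∀
      l₂ : ∀ a K i s → a + K * s + ((K - 1ℤ) * (- 1ℤ - s) + (- 1ℤ - s) + (K - i - 1ℤ - a) + (i - 1ℤ + + 1)) ≡ - 1ℤ
      l₂ = solve-∀
      l₃ : ∀ a K i s → a - K * s + i + ((K - 1ℤ) * (s - 1ℤ) + (s - 1ℤ) + (K - i - 1ℤ - a)) ≡ - 1ℤ
      l₃ = solve-∀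
      l₄ : ∀ K i s → 0ℤ + K * s - i + ((K - 1ℤ) * (- 1ℤ - (s - 1ℤ)) + (- 1ℤ - (s - 1ℤ)) + (i - 1ℤ)) ≡ - 1ℤ
      l₄ = solve-∀
      l₅ : ∀ b K i s → b - K * s + ((K - 1ℤ) * (s - 1ℤ) + (s - 1ℤ) + (i - 1ℤ - b) + (K - + 2 * i + (i - 1ℤ) + + 1)) ≡ - 1ℤ
      l₅ = solve-∀
      l₆ : ∀ K s → 0ℤ + K * s + ((K - 1ℤ) * (- 1ℤ - s) + (- 1ℤ - s) + (K - 1ℤ)) ≡ - 1ℤ
      l₆ = solve-∀
      l₇ : ∀ K i s → 0ℤ - K * s + i + ((K - 1ℤ) * (s - 1ℤ) + (s - 1ℤ) + (K - + 2 * i + (i - 1ℤ))) ≡ - 1ℤ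
      l₇ = solve-∀
      l₈ : ∀ b K i s → b + K * s - i + ((K - 1ℤ) * (- 1ℤ - (s - 1ℤ)) + (- 1ℤ - (s - 1ℤ)) + (i - 1ℤ - b)) ≡ - 1ℤ
      l₈ = solve-∀

    -- For a point of an axis inside the strip, every translate other than itself and every
    -- reflection has a negative coordinate.
    H-axis₁ : ∀ B a m → NN (K - i - 1ℤ - + a) → H K i B (+ a) 0ℤ m ≡ 1ₚ m
    H-axis₁ B a m c₁≥a = trans (H-single B (+ a) 0ℤ m
        (λ s s≢0 p q → by-sign₀ s s≢0 (λ t → nn-absurd (nn-+ q (nn-+ (K·≥0 t) K≥1)) (l₁ K s))
                                      (λ t → nn-absurd (nn-+ p (nn-+ (nn-+ (K·≥0 t) c₁≥a) (nn-+ i≥1 (nn 1)))) (l₂ (+ a) K i s)))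
        (λ s p q → by-sign (s - 1ℤ) (λ t → nn-absurd (nn-+ p (nn-+ (K·≥0 t) c₁≥a)) (l₃ (+ a) K i s))
                                    (λ t → nn-absurd (nn-+ q (nn-+ (K·≥0 t) i≥1)) (l₄ K i s))))
      (trans (mon-0 (Γℕ a 0) m) (cong (λ f → f m) (Γℕ-zeroʳ a)))

    H-axis₂ : ∀ B b m → NN (i - 1ℤ - + b) → H K i B 0ℤ (+ b) m ≡ 1ₚ m
    H-axis₂ B b m c₂≥b = trans (H-single B 0ℤ (+ b) m
        (λ s s≢0 p q → by-sign₀ s s≢0 (λ t → nn-absurd (nn-+ q (nn-+ (nn-+ (K·≥0 t) c₂≥b) (nn-+ (nn-+ K≥2i i≥1) (nn 1)))) (l₅ (+ b) K i s))
                                      (λ t → nn-absurd (nn-+ p (nn-+ (K·≥0 t) K≥1)) (l₆ K s)))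
        (λ s p q → by-sign (s - 1ℤ) (λ t → nn-absurd (nn-+ p (nn-+ (K·≥0 t) (nn-+ K≥2i i≥1))) (l₇ K i s))
                                    (λ t → nn-absurd (nn-+ q (nn-+ (K·≥0 t) c₂≥b)) (l₈ (+ b) K i s))))
      (mon-0 1ₚ m)

-- Counting cylindric partitions by the numbers of their parts.

module CylindricPartitions where

  open PowerSeries
  open import Data.Integer using (+_; _+_; _-_; 0ℤ)
  open import Data.List.Properties as Listₚ using ()
  open import Data.List.Membership.Propositional using (_∈_; lose; find)
  open import Data.List.Membership.Propositional.Properties using (∈-concatMap⁺; ∈-concatMap⁻; ∈-map⁺; ∈-map⁻; ∈-upTo⁺; ∈-upTo⁻; ∈-filter⁺; ∈-filter⁻; ∈-cartesianProduct⁺; ∈-cartesianProduct⁻)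
  open import Data.List.Membership.Propositional.Properties.WithK using (unique∧set⇒bag)
  open import Data.List.Relation.Binary.BagAndSetEquality using (∼bag⇒↭)
  open import Data.List.Relation.Binary.Permutation.Propositional.Properties using (↭-length)
  open import Data.List.Relation.Unary.All as All using (All; []; _∷_)
  import Data.List.Relation.Unary.All.Properties as Allₚ
  open import Data.List.Relation.Unary.Any using (here; there)
  open import Data.List.Relation.Unary.AllPairs as AllPairs using (AllPairs; []; _∷_)
  import Data.List.Relation.Unary.AllPairs.Properties as AllPairsₚ
  open import Data.List.Relation.Unary.Unique.Propositional using (Unique)
  import Data.List.Relation.Unary.Unique.Propositional.Properties as Uniqueₚ

  length-filter-cong : ∀ {A : Set} {P Q : A → Set} (P? : Decidable P) (Q? : Decidable Q) xs →
    (∀ {x} → x ∈ xs → P x ⇔ Q x) → length (filter P? xs) ≡ length (filter Q? xs)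
  length-filter-cong P? Q? []       eq = refl
  length-filter-cong P? Q? (x ∷ xs) eq with P? x | Q? x
  ... | yes _ | yes _ = cong suc (length-filter-cong P? Q? xs (eq ∘ there))
  ... | no _  | no _  = length-filter-cong P? Q? xs (eq ∘ there)
  ... | yes p | no ¬q = contradiction (Equivalence.to (eq (here refl)) p) ¬q
  ... | no ¬p | yes q = contradiction (Equivalence.from (eq (here refl)) q) ¬p

  length-filter-split : ∀ {A : Set} {P Q : A → Set} (P? : Decidable P) (Q? : Decidable Q) xs →
    length (filter P? xs) ≡ length (filter (λ x → P? x ×-dec Q? x) xs) ℕ.+ length (filter (λ x → P? x ×-dec ¬? (Q? x)) xs)
  length-filter-split P? Q? []       = refl
  length-filter-split P? Q? (x ∷ xs) with P? x | Q? x
  ... | no _  | _     = length-filter-split P? Q? xs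
  ... | yes _ | yes _ = cong suc (length-filter-split P? Q? xs)
  ... | yes _ | no _  = trans (cong suc (length-filter-split P? Q? xs)) (sym (ℕₚ.+-suc _ _))

  -- Cardinalities are compared through duplicate-free lists, so a bijection need only be described
  -- on members.
  length-≡ : ∀ {A : Set} {xs ys : List A} → Unique xs → Unique ys → (∀ {x} → x ∈ xs ⇔ x ∈ ys) → length xs ≡ length ys
  length-≡ uxs uys eq = ↭-length (∼bag⇒↭ (unique∧set⇒bag uxs uys eq))

  data Decreasing : ℕ → ℕ → List ℕ → Set where
    []  : ∀ {b} → Decreasing 0 b []
    _∷_ : ∀ {n b x xs} → x ℕ.≤ b → Decreasing n x xs → Decreasing (suc n) b (x ∷ xs)

  decr⁺ : ∀ {n b xs} → Decreasing n b xs → xs ∈ decr n b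
  decr⁺ []             = here refl
  decr⁺ {suc n} {b} (_∷_ {x = x} x≤b d) =
    ∈-concatMap⁺ (λ x → map (x ∷_) (decr n x)) (lose (∈-upTo⁺ (s≤s x≤b)) (∈-map⁺ (x ∷_) (decr⁺ d)))

  decr⁻ : ∀ n {b xs} → xs ∈ decr n b → Decreasing n b xs
  decr⁻ zero    (here refl) = []
  decr⁻ (suc n) {b} p with find (∈-concatMap⁻ (λ x → map (x ∷_) (decr n x)) {xs = upTo (suc b)} p)
  ... | x , x∈ , q with ∈-map⁻ (x ∷_) q
  ...   | ys , ys∈ , refl = ℕₚ.≤-pred (∈-upTo⁻ x∈) ∷ decr⁻ n ys∈

  decr-unique : ∀ n b → Unique (decr n b)
  decr-unique zero    b = [] ∷ []
  decr-unique (suc n) b = Uniqueₚ.concat⁺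
    (Allₚ.map⁺ (All.tabulate (λ {x} _ → Uniqueₚ.map⁺ Listₚ.∷-injectiveʳ (decr-unique n x))))
    (AllPairsₚ.map⁺ (AllPairs.map disjoint (Uniqueₚ.upTo⁺ (suc b))))
    where
    disjoint : ∀ {x y} → x ≢ y → ∀ {v} → v ∈ map (x ∷_) (decr n x) × v ∈ map (y ∷_) (decr n y) → ⊥
    disjoint {x} {y} x≢y (p , q) with ∈-map⁻ (x ∷_) p | ∈-map⁻ (y ∷_) q
    ... | _ , _ , refl | _ , _ , eq = x≢y (Listₚ.∷-injectiveˡ eq)

  weaken : ∀ {n b b′ xs} → b ℕ.≤ b′ → Decreasing n b xs → Decreasing n b′ xs
  weaken b≤b′ []        = []
  weaken b≤b′ (x≤b ∷ d) = ℕₚ.≤-trans x≤b b≤b′ ∷ d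

  -- The enumerating list bounds the entries by the total size. When the size changes, membership in
  -- the new list is recovered from the sum of the entries.
  tighten : ∀ {n b m xs} → Decreasing n b xs → sumℕ xs ℕ.≤ m → Decreasing n m xs
  tighten []                 _ = []
  tighten (_∷_ {x = x} _ d) s = ℕₚ.≤-trans (ℕₚ.m≤m+n x _) s ∷ d

  nth-bound : ∀ {n b xs} j → Decreasing n b xs → nth xs j ℕ.≤ b
  nth-bound j             []        = z≤n
  nth-bound zero          (x≤b ∷ d) = z≤n
  nth-bound (suc zero)    (x≤b ∷ d) = x≤b
  nth-bound (suc (suc j)) (x≤b ∷ d) = ℕₚ.≤-trans (nth-bound (suc j) d) x≤b

  nth-mono : ∀ {n b xs} i j → i ℕ.≤ j → Decreasing n b xs → nth xs (suc j) ℕ.≤ nth xs (suc i)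
  nth-mono i       j       i≤j       []        = z≤n
  nth-mono zero    zero    i≤j       (x≤b ∷ d) = ℕₚ.≤-refl
  nth-mono zero    (suc j) i≤j       (x≤b ∷ d) = nth-bound (suc j) d
  nth-mono (suc i) (suc j) (s≤s i≤j) (x≤b ∷ d) = nth-mono i j i≤j d

  nth-beyond : ∀ {n b xs} j → n ℕ.≤ j → Decreasing n b xs → nth xs (suc j) ≡ 0
  nth-beyond j       n≤j       []        = refl
  nth-beyond (suc j) (s≤s n≤j) (x≤b ∷ d) = nth-beyond j n≤j d

  nth-vanish : ∀ {n b xs a} j → nth xs (suc a) ≡ 0 → a ℕ.≤ j → Decreasing n b xs → nth xs (suc j) ≡ 0
  nth-vanish {a = a} j z a≤j d = ℕₚ.n≤0⇒n≡0 (subst (_ ℕ.≤_) z (nth-mono a j a≤j d))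

  inc : ℕ → List ℕ → List ℕ
  inc zero    xs       = xs
  inc (suc a) []       = []
  inc (suc a) (x ∷ xs) = suc x ∷ inc a xs

  dec : ℕ → List ℕ → List ℕ
  dec zero    xs       = xs
  dec (suc a) []       = []
  dec (suc a) (x ∷ xs) = pred x ∷ dec a xs

  inc-injective : ∀ a {xs ys} → inc a xs ≡ inc a ys → xs ≡ ys
  inc-injective zero    eq = eq
  inc-injective (suc a) {[]}     {[]}     eq = refl
  inc-injective (suc a) {x ∷ xs} {y ∷ ys} eq =
    cong₂ _∷_ (ℕₚ.suc-injective (Listₚ.∷-injectiveˡ eq)) (inc-injective a (Listₚ.∷-injectiveʳ eq))

  inc-decreasing : ∀ a {n b xs} → Decreasing n b xs → Decreasing n (suc b) (inc a xs)
  inc-decreasing zero    d         = weaken (ℕₚ.n≤1+n _) d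
  inc-decreasing (suc a) []        = []
  inc-decreasing (suc a) (x≤b ∷ d) = s≤s x≤b ∷ inc-decreasing a d

  sum-inc : ∀ a {n b xs} → a ℕ.≤ n → Decreasing n b xs → sumℕ (inc a xs) ≡ a ℕ.+ sumℕ xs
  sum-inc zero    a≤n       d         = refl
  sum-inc (suc a) (s≤s a≤n) (_∷_ {x = x} {xs} x≤b d) = cong suc (trans (cong (x ℕ.+_) (sum-inc a a≤n d)) (swap x a (sumℕ xs)))
    where
    swap : ∀ x a s → x ℕ.+ (a ℕ.+ s) ≡ a ℕ.+ (x ℕ.+ s)
    swap = ℕ-Solver.solve-∀

  nth-inc-< : ∀ a {n b xs} j → a ℕ.≤ n → j ℕ.< a → Decreasing n b xs → nth (inc a xs) (suc j) ≡ suc (nth xs (suc j))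
  nth-inc-< (suc a) zero    (s≤s a≤n) j<a       (x≤b ∷ d) = refl
  nth-inc-< (suc a) (suc j) (s≤s a≤n) (s≤s j<a) (x≤b ∷ d) = nth-inc-< a j a≤n j<a d

  nth-inc-≥ : ∀ a xs j → a ℕ.≤ j → nth (inc a xs) (suc j) ≡ nth xs (suc j)
  nth-inc-≥ zero    xs       j       a≤j       = refl
  nth-inc-≥ (suc a) []       j       a≤j       = refl
  nth-inc-≥ (suc a) (x ∷ xs) (suc j) (s≤s a≤j) = nth-inc-≥ a xs j a≤j

  -- On decreasing lists: the first a entries are positive.
  Positive : ℕ → List ℕ → Set
  Positive zero    xs = ⊤
  Positive (suc a) xs = nth xs (suc a) ≢ 0

  positive? : ∀ a xs → Dec (Positive a xs)
  positive? zero    xs = yes tt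
  positive? (suc a) xs = ¬? (nth xs (suc a) ℕ.≟ 0)

  inc-positive : ∀ a {n b xs} → a ℕ.≤ n → Decreasing n b xs → Positive a (inc a xs)
  inc-positive zero    a≤n d = tt
  inc-positive (suc a) a≤n d eq with trans (sym (nth-inc-< (suc a) a a≤n ℕₚ.≤-refl d)) eq
  ... | ()

  private
    head-positive : ∀ a {n b x xs} → Decreasing (suc n) b (x ∷ xs) → Positive (suc a) (x ∷ xs) → ∃ λ y → x ≡ suc y
    head-positive a {x = suc y} d p = y , refl
    head-positive a {x = zero}  d p = ⊥-elim (p (ℕₚ.n≤0⇒n≡0 (nth-mono 0 a z≤n d)))

    tail-positive : ∀ a {x xs} → Positive (suc a) (x ∷ xs) → Positive a xs
    tail-positive zero    p = tt
    tail-positive (suc a) p = p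

  -- Lowering only the first a entries preserves the order because the entries behind them are 0.
  dec-decreasing : ∀ a {n b xs} → Decreasing n b xs → Positive a xs → nth xs (suc a) ≡ 0 → Decreasing n (pred b) (dec a xs)
  dec-decreasing zero    []                    p z = []
  dec-decreasing zero    (_∷_ {x = x} x≤b d)   p refl = z≤n ∷ d
  dec-decreasing (suc a) []                    p z = []
  dec-decreasing (suc a) (x≤b ∷ d)             p z = ℕₚ.pred-mono-≤ x≤b ∷ dec-decreasing a d (tail-positive a p) z

  inc-dec : ∀ a {n b xs} → Decreasing n b xs → Positive a xs → inc a (dec a xs) ≡ xs
  inc-dec zero    d         p = refl
  inc-dec (suc a) []        p = refl
  inc-dec (suc a) (_∷_ x≤b d) p with head-positive a (x≤b ∷ d) p
  ... | y , refl = cong (suc y ∷_) (inc-dec a d (tail-positive a p))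

  T-all⁺ : ∀ (p : ℕ → Bool) (f g : ℕ → ℕ) n → (∀ j → j ℕ.< n → T (p (f (g j)))) → T (foldr (λ x r → p x ∧ r) true (map f (applyUpTo g n)))
  T-all⁺ p f g zero    h = tt
  T-all⁺ p f g (suc n) h = Equivalence.from Boolₚ.T-∧ (h 0 (s≤s z≤n) , T-all⁺ p f (g ∘ suc) n (λ j j<n → h (suc j) (s≤s j<n)))

  T-all⁻ : ∀ (p : ℕ → Bool) (f g : ℕ → ℕ) n → T (foldr (λ x r → p x ∧ r) true (map f (applyUpTo g n))) → ∀ j → j ℕ.< n → T (p (f (g j)))
  T-all⁻ p f g (suc n) t zero    _         = proj₁ (Equivalence.to Boolₚ.T-∧ t)
  T-all⁻ p f g (suc n) t (suc j) (s≤s j<n) = T-all⁻ p f (g ∘ suc) n (proj₂ (Equivalence.to Boolₚ.T-∧ t)) j j<n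

  module _ (c₁ c₂ n : ℕ) where

    Cylindric : List ℕ → List ℕ → Set
    Cylindric l₁ l₂ = ∀ j → nth l₂ (suc j ℕ.+ c₂) ℕ.≤ nth l₁ (suc j) × nth l₁ (suc j ℕ.+ c₁) ℕ.≤ nth l₂ (suc j)

    cylindric⁺ : ∀ l₁ l₂ → Cylindric l₁ l₂ → T (isCylindric c₁ c₂ n l₁ l₂)
    cylindric⁺ l₁ l₂ c = T-all⁺ _ (1 ℕ.+_) id n (λ j _ → Equivalence.from Boolₚ.T-∧ (ℕₚ.≤⇒≤ᵇ (proj₁ (c j)) , ℕₚ.≤⇒≤ᵇ (proj₂ (c j))))

    -- The Boolean test stops at j = n; beyond it both sides of the inequalities are padding zeros.
    cylindric⁻ : ∀ {b₁ b₂ l₁ l₂} → Decreasing n b₁ l₁ → Decreasing n b₂ l₂ → T (isCylindric c₁ c₂ n l₁ l₂) → Cylindric l₁ l₂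
    cylindric⁻ {l₁ = l₁} {l₂} d₁ d₂ t j with j ℕ.<? n
    ... | yes j<n = let p , q = Equivalence.to Boolₚ.T-∧ (T-all⁻ _ (1 ℕ.+_) id n t j j<n)
                    in ℕₚ.≤ᵇ⇒≤ (nth l₂ (suc j ℕ.+ c₂)) (nth l₁ (suc j)) p , ℕₚ.≤ᵇ⇒≤ (nth l₁ (suc j ℕ.+ c₁)) (nth l₂ (suc j)) q
    ... | no j≮n  = ℕₚ.≤-reflexive (trans (nth-beyond (j ℕ.+ c₂) (ℕₚ.≤-trans n≤j (ℕₚ.m≤m+n j c₂)) d₂) (sym (nth-beyond j n≤j d₁)))
                  , ℕₚ.≤-reflexive (trans (nth-beyond (j ℕ.+ c₁) (ℕₚ.≤-trans n≤j (ℕₚ.m≤m+n j c₁)) d₁) (sym (nth-beyond j n≤j d₂)))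
      where n≤j = ℕₚ.≮⇒≥ j≮n

    private
      Pair : Set
      Pair = List ℕ × List ℕ

      pairs : ℕ → List Pair
      pairs m = cartesianProduct (decr n m) (decr n m)

      pairs-unique : ∀ m → Unique (pairs m)
      pairs-unique m = Uniqueₚ.cartesianProduct⁺ (decr-unique n m) (decr-unique n m)

      pairs⁺ : ∀ {m l₁ l₂} → Decreasing n m l₁ → Decreasing n m l₂ → (l₁ , l₂) ∈ pairs m
      pairs⁺ d₁ d₂ = ∈-cartesianProduct⁺ (decr⁺ d₁) (decr⁺ d₂)

      pairs⁻ : ∀ {m l₁ l₂} → (l₁ , l₂) ∈ pairs m → Decreasing n m l₁ × Decreasing n m l₂
      pairs⁻ {m} p = let p₁ , p₂ = ∈-cartesianProduct⁻ (decr n m) (decr n m) p in decr⁻ n p₁ , decr⁻ n p₂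

    -- Cylindric partitions of size m with at most a and at most b parts, padded by 0 to length n
    Shape : (a b m : ℕ) → Pair → Set
    Shape a b m (l₁ , l₂) = T (isCylindric c₁ c₂ n l₁ l₂) × sumℕ l₁ ℕ.+ sumℕ l₂ ≡ m × nth l₁ (suc a) ≡ 0 × nth l₂ (suc b) ≡ 0

    shape? : ∀ a b m → Decidable (Shape a b m)
    shape? a b m (l₁ , l₂) = Boolₚ.T? (isCylindric c₁ c₂ n l₁ l₂) ×-dec (sumℕ l₁ ℕ.+ sumℕ l₂ ℕ.≟ m) ×-dec (nth l₁ (suc a) ℕ.≟ 0) ×-dec (nth l₂ (suc b) ℕ.≟ 0)

    count : (a b : ℕ) → PS
    count a b m = + length (filter (shape? a b m) (pairs m))

    Full : (a b m : ℕ) → Pair → Set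
    Full a b m (l₁ , l₂) = Shape a b m (l₁ , l₂) × Positive a l₁ × Positive b l₂

    full? : ∀ a b m → Decidable (Full a b m)
    full? a b m (l₁ , l₂) = shape? a b m (l₁ , l₂) ×-dec (positive? a l₁ ×-dec positive? b l₂)

    countFull : (a b : ℕ) → PS
    countFull a b m = + length (filter (full? a b m) (pairs m))

    -- Subtracting 1 from the first a parts of l₁ and the first b parts of l₂
    -- is a bijection from Full a b (a + b + m) to Shape a b m.
    module _ {a b : ℕ} (a≤n : a ℕ.≤ n) (b≤n : b ℕ.≤ n) (b≤a+c₂ : b ℕ.≤ a ℕ.+ c₂) (a≤b+c₁ : a ℕ.≤ b ℕ.+ c₁) where

      private
        inc-≥ : ∀ a {m xs} j → a ℕ.≤ n → Decreasing n m xs → nth xs (suc j) ℕ.≤ nth (inc a xs) (suc j)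
        inc-≥ a {xs = xs} j a≤n d with j ℕ.<? a
        ... | yes j<a = subst (nth xs (suc j) ℕ.≤_) (sym (nth-inc-< a j a≤n j<a d)) (ℕₚ.n≤1+n _)
        ... | no j≮a  = ℕₚ.≤-reflexive (sym (nth-inc-≥ a xs j (ℕₚ.≮⇒≥ j≮a)))

        -- If j + c < b, then j < a by b ≤ a + c, so a raised entry on the small side is always
        -- matched by a raised entry on the large side.
        half⁺ : ∀ {a b c m xs ys} j → a ℕ.≤ n → b ℕ.≤ n → b ℕ.≤ a ℕ.+ c → Decreasing n m xs → Decreasing n m ys →
          nth ys (suc j ℕ.+ c) ℕ.≤ nth xs (suc j) → nth (inc b ys) (suc j ℕ.+ c) ℕ.≤ nth (inc a xs) (suc j)
        half⁺ {a} {b} {c} {xs = xs} {ys} j a≤n b≤n b≤a+c dx dy h with j ℕ.+ c ℕ.<? b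
        ... | yes p = subst₂ ℕ._≤_ (sym (nth-inc-< b (j ℕ.+ c) b≤n p dy)) (sym (nth-inc-< a j a≤n (ℕₚ.+-cancelʳ-< c j a (ℕₚ.<-≤-trans p b≤a+c)) dx)) (s≤s h)
        ... | no p = ℕₚ.≤-trans (ℕₚ.≤-reflexive (nth-inc-≥ b ys (j ℕ.+ c) (ℕₚ.≮⇒≥ p))) (ℕₚ.≤-trans h (inc-≥ a j a≤n dx))

        -- Where both entries were raised, 1 cancels; otherwise j + c ≥ b, and the smaller entry is
        -- one of the zeros behind the first b entries.
        half⁻ : ∀ {a b c m xs ys} j → a ℕ.≤ n → b ℕ.≤ n → b ℕ.≤ a ℕ.+ c → Decreasing n m xs → Decreasing n m ys → nth ys (suc b) ≡ 0 →
          nth (inc b ys) (suc j ℕ.+ c) ℕ.≤ nth (inc a xs) (suc j) → nth ys (suc j ℕ.+ c) ℕ.≤ nth xs (suc j)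
        half⁻ {a} {b} {c} {xs = xs} {ys} j a≤n b≤n b≤a+c dx dy z h with j ℕ.+ c ℕ.<? b
        ... | yes p = ℕₚ.≤-pred (subst₂ ℕ._≤_ (nth-inc-< b (j ℕ.+ c) b≤n p dy) (nth-inc-< a j a≤n (ℕₚ.+-cancelʳ-< c j a (ℕₚ.<-≤-trans p b≤a+c)) dx) h)
        ... | no p = subst (ℕ._≤ nth xs (suc j)) (sym (nth-vanish (j ℕ.+ c) z (ℕₚ.≮⇒≥ p) dy)) z≤n

        f : Pair → Pair
        f (l₁ , l₂) = inc a l₁ , inc b l₂

        f-injective : ∀ {p q} → f p ≡ f q → p ≡ q
        f-injective eq = cong₂ _,_ (inc-injective a (cong proj₁ eq)) (inc-injective b (cong proj₂ eq))

        sum-f : ∀ {m l₁ l₂} → Decreasing n m l₁ → Decreasing n m l₂ → sumℕ (inc a l₁) ℕ.+ sumℕ (inc b l₂) ≡ (a ℕ.+ b) ℕ.+ (sumℕ l₁ ℕ.+ sumℕ l₂)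
        sum-f {l₁ = l₁} {l₂} d₁ d₂ = trans (cong₂ ℕ._+_ (sum-inc a a≤n d₁) (sum-inc b b≤n d₂)) (interchange′ a (sumℕ l₁) b (sumℕ l₂))
          where
          interchange′ : ∀ w x y z → (w ℕ.+ x) ℕ.+ (y ℕ.+ z) ≡ (w ℕ.+ y) ℕ.+ (x ℕ.+ z)
          interchange′ = ℕ-Solver.solve-∀

        f⁺ : ∀ m {p} → p ∈ filter (shape? a b m) (pairs m) → f p ∈ filter (full? a b (a ℕ.+ b ℕ.+ m)) (pairs (a ℕ.+ b ℕ.+ m))
        f⁺ m {l₁ , l₂} p∈ with ∈-filter⁻ (shape? a b m) {xs = pairs m} p∈
        ... | p∈′ , cyl , size , z₁ , z₂ with pairs⁻ {m} p∈′
        ...   | d₁ , d₂ = ∈-filter⁺ (full? a b (a ℕ.+ b ℕ.+ m))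
            (pairs⁺ (tighten (inc-decreasing a d₁) (ℕₚ.≤-trans (ℕₚ.m≤m+n _ _) (ℕₚ.≤-reflexive total))) (tighten (inc-decreasing b d₂) (ℕₚ.≤-trans (ℕₚ.m≤n+m _ _) (ℕₚ.≤-reflexive total))))
            ((cylindric⁺ (inc a l₁) (inc b l₂) (λ j → half⁺ j a≤n b≤n b≤a+c₂ d₁ d₂ (proj₁ (c j)) , half⁺ j b≤n a≤n a≤b+c₁ d₂ d₁ (proj₂ (c j)))
              , total , trans (nth-inc-≥ a l₁ a ℕₚ.≤-refl) z₁ , trans (nth-inc-≥ b l₂ b ℕₚ.≤-refl) z₂)
            , inc-positive a a≤n d₁ , inc-positive b b≤n d₂)
          where
          total : sumℕ (inc a l₁) ℕ.+ sumℕ (inc b l₂) ≡ a ℕ.+ b ℕ.+ m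
          total = trans (sum-f d₁ d₂) (cong (a ℕ.+ b ℕ.+_) size)
          c : Cylindric l₁ l₂
          c = cylindric⁻ d₁ d₂ cyl

        f⁻ : ∀ m {p} → p ∈ filter (full? a b m) (pairs m) → ∃ λ m′ → m ≡ a ℕ.+ b ℕ.+ m′ × ∃ λ p′ → p′ ∈ filter (shape? a b m′) (pairs m′) × p ≡ f p′
        f⁻ m {l₁ , l₂} p∈ with ∈-filter⁻ (full? a b m) {xs = pairs m} p∈
        ... | p∈′ , (cyl , size , z₁ , z₂) , pos₁ , pos₂ with pairs⁻ {m} p∈′
        ...   | d₁ , d₂ = m′ , trans (sym size) total , (dec a l₁ , dec b l₂) ,
            ∈-filter⁺ (shape? a b m′) (pairs⁺ (tighten e₁ (ℕₚ.m≤m+n _ _)) (tighten e₂ (ℕₚ.m≤n+m _ _)))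
              (cylindric⁺ (dec a l₁) (dec b l₂) (λ j → half⁻ j a≤n b≤n b≤a+c₂ e₁ e₂ z₂′ (proj₁ (c j)) , half⁻ j b≤n a≤n a≤b+c₁ e₂ e₁ z₁′ (proj₂ (c j))) , refl , z₁′ , z₂′)
            , sym (cong₂ _,_ i₁ i₂)
          where
          e₁ : Decreasing n (pred m) (dec a l₁)
          e₁ = dec-decreasing a d₁ pos₁ z₁
          e₂ : Decreasing n (pred m) (dec b l₂)
          e₂ = dec-decreasing b d₂ pos₂ z₂
          i₁ : inc a (dec a l₁) ≡ l₁
          i₁ = inc-dec a d₁ pos₁
          i₂ : inc b (dec b l₂) ≡ l₂
          i₂ = inc-dec b d₂ pos₂
          m′ = sumℕ (dec a l₁) ℕ.+ sumℕ (dec b l₂)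
          total : sumℕ l₁ ℕ.+ sumℕ l₂ ≡ a ℕ.+ b ℕ.+ m′
          total = trans (sym (cong₂ (λ x y → sumℕ x ℕ.+ sumℕ y) i₁ i₂)) (sum-f e₁ e₂)
          z₁′ : nth (dec a l₁) (suc a) ≡ 0
          z₁′ = trans (sym (nth-inc-≥ a (dec a l₁) a ℕₚ.≤-refl)) (trans (cong (λ l → nth l (suc a)) i₁) z₁)
          z₂′ : nth (dec b l₂) (suc b) ≡ 0
          z₂′ = trans (sym (nth-inc-≥ b (dec b l₂) b ℕₚ.≤-refl)) (trans (cong (λ l → nth l (suc b)) i₂) z₂)
          c : Cylindric (inc a (dec a l₁)) (inc b (dec b l₂))
          c = subst (λ (p : Pair) → Cylindric (proj₁ p) (proj₂ p)) (sym (cong₂ _,_ i₁ i₂)) (cylindric⁻ d₁ d₂ cyl)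

        bijection : ∀ m → length (filter (full? a b (a ℕ.+ b ℕ.+ m)) (pairs (a ℕ.+ b ℕ.+ m))) ≡ length (filter (shape? a b m) (pairs m))
        bijection m = trans (length-≡ (Uniqueₚ.filter⁺ (full? a b (a ℕ.+ b ℕ.+ m)) (pairs-unique (a ℕ.+ b ℕ.+ m)))
            (Uniqueₚ.map⁺ f-injective (Uniqueₚ.filter⁺ (shape? a b m) (pairs-unique m))) (mk⇔ to from))
          (Listₚ.length-map f (filter (shape? a b m) (pairs m)))
          where
          to : ∀ {p} → p ∈ filter (full? a b (a ℕ.+ b ℕ.+ m)) (pairs (a ℕ.+ b ℕ.+ m)) → p ∈ map f (filter (shape? a b m) (pairs m))
          to p∈ with f⁻ (a ℕ.+ b ℕ.+ m) p∈
          ... | m′ , eq , p′ , p′∈ , refl with ℕₚ.+-cancelˡ-≡ (a ℕ.+ b) m m′ eq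
          ...   | refl = ∈-map⁺ f p′∈
          from : ∀ {p} → p ∈ map f (filter (shape? a b m) (pairs m)) → p ∈ filter (full? a b (a ℕ.+ b ℕ.+ m)) (pairs (a ℕ.+ b ℕ.+ m))
          from p∈ with ∈-map⁻ f p∈
          ... | p′ , p′∈ , refl = f⁺ m p′∈

        empty : ∀ {A : Set} (xs : List A) → (∀ {x} → x ∈ xs → ⊥) → length xs ≡ 0
        empty []       h = refl
        empty (x ∷ xs) h = ⊥-elim (h (here refl))

        shift-at : ∀ e g m → shiftₚ e g (e ℕ.+ m) ≡ g m
        shift-at zero    g m = refl
        shift-at (suc e) g m = trans (shift-suc e g (e ℕ.+ m)) (shift-at e g m)

        shift-below : ∀ e g m → m ℕ.< e → shiftₚ e g m ≡ 0ℤ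
        shift-below (suc e) g zero    _         = refl
        shift-below (suc e) g (suc m) (s≤s m<e) = trans (shift-suc e g m) (shift-below e g m m<e)

      -- The bijection removes 1 from a + b parts; below size a + b no pair has all these parts
      -- positive.
      countFull≡shift : countFull a b ≗ shiftₚ (a ℕ.+ b) (count a b)
      countFull≡shift m with a ℕ.+ b ℕ.≤? m
      ... | yes p = subst (λ m → countFull a b m ≡ shiftₚ (a ℕ.+ b) (count a b) m) (ℕₚ.m+[n∸m]≡n p)
              (trans (cong +_ (bijection (m ∸ (a ℕ.+ b)))) (sym (shift-at (a ℕ.+ b) (count a b) (m ∸ (a ℕ.+ b)))))
      ... | no p  = trans (cong +_ (empty (filter (full? a b m) (pairs m)) (λ p∈ → let m′ , eq , _ = f⁻ m p∈ in p (subst (a ℕ.+ b ℕ.≤_) (sym eq) (ℕₚ.m≤m+n (a ℕ.+ b) m′)))))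
              (sym (shift-below (a ℕ.+ b) (count a b) m (ℕₚ.≰⇒> p)))

    private
      module _ (m : ℕ) where
        Z₁ Z₂ : ℕ → Pair → Set
        Z₁ a (l₁ , l₂) = nth l₁ (suc a) ≡ 0
        Z₂ b (l₁ , l₂) = nth l₂ (suc b) ≡ 0
        z₁? : ∀ a → Decidable (Z₁ a)
        z₁? a (l₁ , l₂) = nth l₁ (suc a) ℕ.≟ 0
        z₂? : ∀ b → Decidable (Z₂ b)
        z₂? b (l₁ , l₂) = nth l₂ (suc b) ℕ.≟ 0

        drop₁ : ∀ a b {p} → p ∈ pairs m → (Shape (suc a) b m p × Z₁ a p) ⇔ Shape a b m p
        drop₁ a b {l₁ , l₂} p∈ = mk⇔ (λ { ((c , s , _ , z) , z′) → c , s , z′ , z })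
          (λ { (c , s , z′ , z) → (c , s , nth-vanish (suc a) z′ (ℕₚ.n≤1+n a) (proj₁ (pairs⁻ {m} p∈)) , z) , z′ })

        drop₂ : ∀ a b {p} → p ∈ pairs m → (Shape a (suc b) m p × Z₂ b p) ⇔ Shape a b m p
        drop₂ a b {l₁ , l₂} p∈ = mk⇔ (λ { ((c , s , z , _) , z′) → c , s , z , z′ })
          (λ { (c , s , z , z′) → (c , s , z , nth-vanish (suc b) z′ (ℕₚ.n≤1+n b) (proj₂ (pairs⁻ {m} p∈))) , z′ })

        rest₁ : ℕ → ℕ → ℕ
        rest₁ a b = length (filter (λ p → shape? (suc a) b m p ×-dec ¬? (z₁? a p)) (pairs m))

        rest₂ : ℕ → ℕ → ℕ
        rest₂ a b = length (filter (λ p → shape? a (suc b) m p ×-dec ¬? (z₂? b p)) (pairs m))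

        split₁ : ∀ a b → length (filter (shape? (suc a) b m) (pairs m)) ≡ length (filter (shape? a b m) (pairs m)) ℕ.+ rest₁ a b
        split₁ a b = trans (length-filter-split (shape? (suc a) b m) (z₁? a) (pairs m))
          (cong (ℕ._+ rest₁ a b) (length-filter-cong (λ p → shape? (suc a) b m p ×-dec z₁? a p) (shape? a b m) (pairs m) (drop₁ a b)))

        split₂ : ∀ a b → length (filter (shape? a (suc b) m) (pairs m)) ≡ length (filter (shape? a b m) (pairs m)) ℕ.+ rest₂ a b
        split₂ a b = trans (length-filter-split (shape? a (suc b) m) (z₂? b) (pairs m))
          (cong (ℕ._+ rest₂ a b) (length-filter-cong (λ p → shape? a (suc b) m p ×-dec z₂? b p) (shape? a b m) (pairs m) (drop₂ a b)))

        rest₁-full : ∀ a b → (∀ {l₁ l₂} → (l₁ , l₂) ∈ pairs m → Shape (suc a) b m (l₁ , l₂) → nth l₁ (suc a) ≢ 0 → Positive b l₂) →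
          rest₁ a b ≡ length (filter (full? (suc a) b m) (pairs m))
        rest₁-full a b h = length-filter-cong (λ p → shape? (suc a) b m p ×-dec ¬? (z₁? a p)) (full? (suc a) b m) (pairs m)
          (λ p∈ → mk⇔ (λ { (s , nz) → s , nz , h p∈ s nz }) (λ { (s , nz , _) → s , nz }))

        rest₂-full : ∀ a b → (∀ {l₁ l₂} → (l₁ , l₂) ∈ pairs m → Shape a (suc b) m (l₁ , l₂) → nth l₂ (suc b) ≢ 0 → Positive a l₁) →
          rest₂ a b ≡ length (filter (full? a (suc b) m) (pairs m))
        rest₂-full a b h = length-filter-cong (λ p → shape? a (suc b) m p ×-dec ¬? (z₂? b p)) (full? a (suc b) m) (pairs m)
          (λ p∈ → mk⇔ (λ { (s , nz) → s , h p∈ s nz , nz }) (λ { (s , _ , nz) → s , nz }))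

        rest₁-split : ∀ a b → rest₁ a (suc b) ≡ rest₁ a b ℕ.+ length (filter (full? (suc a) (suc b) m) (pairs m))
        rest₁-split a b = trans (length-filter-split (λ p → shape? (suc a) (suc b) m p ×-dec ¬? (z₁? a p)) (z₂? b) (pairs m))
          (cong₂ ℕ._+_
            (length-filter-cong (λ p → (shape? (suc a) (suc b) m p ×-dec ¬? (z₁? a p)) ×-dec z₂? b p) (λ p → shape? (suc a) b m p ×-dec ¬? (z₁? a p)) (pairs m)
              (λ p∈ → mk⇔ (λ { ((s , nz) , z) → Equivalence.to (drop₂ (suc a) b p∈) (s , z) , nz })
                          (λ { (s , nz) → let s′ , z = Equivalence.from (drop₂ (suc a) b p∈) s in (s′ , nz) , z })))
            (length-filter-cong (λ p → (shape? (suc a) (suc b) m p ×-dec ¬? (z₁? a p)) ×-dec ¬? (z₂? b p)) (full? (suc a) (suc b) m) (pairs m)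
              (λ p∈ → mk⇔ (λ { ((s , nz) , nz′) → s , nz , nz′ }) (λ { (s , nz , nz′) → (s , nz) , nz′ }))))

    -- `rest₁` counts the pairs whose first partition has its last allowed part positive. Splitting
    -- these by the last part of the second partition isolates the full pairs, and the remainder is
    -- what distinguishes the counts for (a+1, b) and (a, b).
    count-interior : ∀ a b m → count (suc a) (suc b) m + count a b m ≡ count a (suc b) m + count (suc a) b m + countFull (suc a) (suc b) m
    count-interior a b m = cong +_ (begin
      S (suc a) (suc b) ℕ.+ S a b                                        ≡⟨ cong (ℕ._+ S a b) (split₁ m a (suc b)) ⟩
      S a (suc b) ℕ.+ rest₁ m a (suc b) ℕ.+ S a b                        ≡⟨ cong (λ r → S a (suc b) ℕ.+ r ℕ.+ S a b) (rest₁-split m a b) ⟩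
      S a (suc b) ℕ.+ (rest₁ m a b ℕ.+ E) ℕ.+ S a b                      ≡⟨ shuffle (S a (suc b)) (rest₁ m a b) E (S a b) ⟩
      S a (suc b) ℕ.+ (S a b ℕ.+ rest₁ m a b) ℕ.+ E                      ≡⟨ cong (λ r → S a (suc b) ℕ.+ r ℕ.+ E) (sym (split₁ m a b)) ⟩
      S a (suc b) ℕ.+ S (suc a) b ℕ.+ E                                  ∎)
      where
      open ≡-Reasoning
      S : ℕ → ℕ → ℕ
      S a b = length (filter (shape? a b m) (pairs m))
      E = length (filter (full? (suc a) (suc b) m) (pairs m))
      shuffle : ∀ w x y z → w ℕ.+ (x ℕ.+ y) ℕ.+ z ≡ w ℕ.+ (z ℕ.+ x) ℕ.+ y
      shuffle = ℕ-Solver.solve-∀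

    -- At a + 1 = b + c₁ the cylindric inequality at j = b bounds part a + 1 of the first partition
    -- by part b of the second. If the former is positive, then so are all b parts of the latter,
    -- and the pair is full.
    count-upper : ∀ a b m → b ≡ 0 ⊎ suc a ≡ b ℕ.+ c₁ → count (suc a) b m ≡ count a b m + countFull (suc a) b m
    count-upper a b m bd = cong +_ (trans (split₁ m a b) (cong (length (filter (shape? a b m) (pairs m)) ℕ.+_) (rest₁-full m a b (positive bd))))
      where
      positive : ∀ {b} → b ≡ 0 ⊎ suc a ≡ b ℕ.+ c₁ → ∀ {l₁ l₂} → (l₁ , l₂) ∈ pairs m → Shape (suc a) b m (l₁ , l₂) → nth l₁ (suc a) ≢ 0 → Positive b l₂
      positive (inj₁ refl) _ _ _ = tt
      positive {zero}  (inj₂ _)  _ _ _ = tt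
      positive {suc b} (inj₂ eq) {l₁} {l₂} p∈ (c , _) nz z = nz (ℕₚ.n≤0⇒n≡0 (subst (ℕ._≤ 0) (cong (nth l₁) (sym eq))
        (subst (nth l₁ (suc b ℕ.+ c₁) ℕ.≤_) z (proj₂ (cylindric⁻ (proj₁ (pairs⁻ {m} p∈)) (proj₂ (pairs⁻ {m} p∈)) c b)))))

    count-lower : ∀ a b m → a ≡ 0 ⊎ suc b ≡ a ℕ.+ c₂ → count a (suc b) m ≡ count a b m + countFull a (suc b) m
    count-lower a b m bd = cong +_ (trans (split₂ m a b) (cong (length (filter (shape? a b m) (pairs m)) ℕ.+_) (rest₂-full m a b (positive bd))))
      where
      positive : ∀ {a} → a ≡ 0 ⊎ suc b ≡ a ℕ.+ c₂ → ∀ {l₁ l₂} → (l₁ , l₂) ∈ pairs m → Shape a (suc b) m (l₁ , l₂) → nth l₂ (suc b) ≢ 0 → Positive a l₁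
      positive (inj₁ refl) _ _ _ = tt
      positive {zero}  (inj₂ _)  _ _ _ = tt
      positive {suc a} (inj₂ eq) {l₁} {l₂} p∈ (c , _) nz z = nz (ℕₚ.n≤0⇒n≡0 (subst (ℕ._≤ 0) (cong (nth l₂) (sym eq))
        (subst (nth l₂ (suc a ℕ.+ c₂) ℕ.≤_) z (proj₁ (cylindric⁻ (proj₁ (pairs⁻ {m} p∈)) (proj₂ (pairs⁻ {m} p∈)) c a)))))

    count-00 : count 0 0 ≗ 1ₚ
    count-00 zero    = cong +_ (trans (length-filter-cong (shape? 0 0 0) (λ _ → yes tt) (pairs 0)
        (λ {p} p∈ → mk⇔ (λ _ → tt) (λ _ → zeros {proj₁ p} {proj₂ p} (proj₁ (pairs⁻ {0} p∈)) (proj₂ (pairs⁻ {0} p∈))))) one)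
      where
      nth0 : ∀ {n xs} j → Decreasing n 0 xs → nth xs j ≡ 0
      nth0 j d = ℕₚ.n≤0⇒n≡0 (nth-bound j d)
      sum0 : ∀ {n xs} → Decreasing n 0 xs → sumℕ xs ≡ 0
      sum0 []        = refl
      sum0 (z≤n ∷ d) = sum0 d
      zeros : ∀ {l₁ l₂} → Decreasing n 0 l₁ → Decreasing n 0 l₂ → Shape 0 0 0 (l₁ , l₂)
      zeros {l₁} {l₂} d₁ d₂ = cylindric⁺ l₁ l₂ (λ j → ℕₚ.≤-reflexive (trans (nth0 (suc j ℕ.+ c₂) d₂) (sym (nth0 (suc j) d₁))) , ℕₚ.≤-reflexive (trans (nth0 (suc j ℕ.+ c₁) d₁) (sym (nth0 (suc j) d₂))))
        , cong₂ ℕ._+_ (sum0 d₁) (sum0 d₂) , nth0 1 d₁ , nth0 1 d₂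
      decr-0 : ∀ n → ∃ λ zs → decr n 0 ≡ zs ∷ []
      decr-0 zero    = [] , refl
      decr-0 (suc n) = let zs , eq = decr-0 n in 0 ∷ zs , cong (λ xs → map (0 ∷_) xs ++ []) eq
      one : length (filter (λ _ → yes tt) (pairs 0)) ≡ 1
      one = subst (λ xs → length (filter (λ _ → yes tt) (cartesianProduct xs xs)) ≡ 1) (sym (proj₂ (decr-0 n))) refl
    count-00 (suc m) = cong (λ xs → + length xs) (Listₚ.filter-none (shape? 0 0 (suc m)) (All.tabulate none))
      where
      sum0 : ∀ {n b xs} → Decreasing n b xs → nth xs 1 ≡ 0 → sumℕ xs ≡ 0
      sum0 []                z    = refl
      sum0 (_ ∷ [])          refl = refl
      sum0 (_ ∷ (z≤n ∷ d))   refl = sum0 (z≤n {0} ∷ d) refl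
      none : ∀ {p} → p ∈ pairs (suc m) → ¬ Shape 0 0 (suc m) p
      none {l₁ , l₂} p∈ (_ , s , z₁ , z₂) with pairs⁻ {suc m} p∈
      ... | d₁ , d₂ with trans (sym s) (cong₂ ℕ._+_ (sum0 d₁ z₁) (sum0 d₂ z₂))
      ...   | ()

    CP≡count : CP c₁ c₂ n ≗ count n n
    CP≡count m = cong +_ (length-filter-cong (λ p → Boolₚ.T? _) (shape? n n m) (pairs m)
      (λ {p} p∈ → mk⇔
        (λ t → let c , s = Equivalence.to Boolₚ.T-∧ t ; d₁ , d₂ = pairs⁻ {m} p∈
               in c , ℕₚ.≡ᵇ⇒≡ _ m s , nth-beyond n ℕₚ.≤-refl d₁ , nth-beyond n ℕₚ.≤-refl d₂)
        (λ { (c , s , _) → Equivalence.from Boolₚ.T-∧ (c , ℕₚ.≡⇒≡ᵇ _ m s) })))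

-- Comparison of the counting series with H inside the strip.

module CylindricFormula where

  open PowerSeries
  open GaussianBinomials
  open Summations
  open BosonicSums
  open BurgeTransform using (H)
  open BosonicSide using (RHS≡H)
  open StripRecurrence
  open CylindricPartitions
  open import Data.Integer using (ℤ; +_; _+_; _*_; _-_; -_; 1ℤ; _≤_; +≤+)

  module _ (k i n : ℕ) (i≥1 : 1 ℕ.≤ i) (i≤k : i ℕ.≤ k) (B : ℕ) (n<B : n ℕ.< B) where

    private
      K : ℤ
      K = + (2 ℕ.* k ℕ.+ 1)
      c₁ c₂ : ℕ
      c₁ = 2 ℕ.* k ∸ i
      c₂ = i ∸ 1

      i≥1ℤ : NN (+ i - 1ℤ)
      i≥1ℤ = ℤₚ.i≤j⇒0≤j-i (+≤+ i≥1)

      lem-K : ∀ k i → + 2 * (k - i) + + 1 ≡ + 2 * k + + 1 - + 2 * i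
      lem-K = solve-∀
      K≥2i : NN (K - + 2 * + i)
      K≥2i = nn-≡ (nn-+ (nn-* (nn 2) (ℤₚ.i≤j⇒0≤j-i (+≤+ i≤k))) (nn 1)) (trans (lem-K (+ k) (+ i)) (cong (λ z → z + + 1 - + 2 * + i) (sym (ℤₚ.pos-* 2 k))))

      i≤2k : i ℕ.≤ 2 ℕ.* k
      i≤2k = ℕₚ.≤-trans i≤k (ℕₚ.m≤m+n k (k ℕ.+ 0))

      c₁+i : c₁ ℕ.+ i ≡ 2 ℕ.* k
      c₁+i = ℕₚ.m∸n+n≡m i≤2k

      c₂+1 : suc c₂ ≡ i
      c₂+1 = ℕₚ.m+[n∸m]≡n i≥1

      c₁≥1 : 1 ℕ.≤ c₁
      c₁≥1 = ℕₚ.≤-trans i≥1 (ℕₚ.+-cancelʳ-≤ i i c₁ (subst (i ℕ.+ i ℕ.≤_) (sym c₁+i) (ℕₚ.+-mono-≤ i≤k (ℕₚ.≤-trans i≤k (ℕₚ.m≤m+n k 0)))))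

      lem-c₁ : ∀ c i → c + i + + 1 - i - 1ℤ ≡ c
      lem-c₁ = solve-∀
      c₁≡ : K - + i - 1ℤ ≡ + c₁
      c₁≡ = trans (cong (λ z → + z + + 1 - + i - 1ℤ) (sym c₁+i)) (lem-c₁ (+ c₁) (+ i))

      lem-c₂ : ∀ c → 1ℤ + c - 1ℤ ≡ c
      lem-c₂ = solve-∀
      c₂≡ : + i - 1ℤ ≡ + c₂
      c₂≡ = trans (cong (λ z → + z - 1ℤ) (sym c₂+1)) (lem-c₂ (+ c₂))

      C : ℕ → ℕ → PS
      C = count c₁ c₂ n

      𝓗 : ℕ → ℕ → PS
      𝓗 a b = H K (+ i) B (+ a) (+ b)

      -- The top factor of the Pochhammer product is what clears the difference on the left of each
      -- counting recurrence.
      step : ∀ M f {g} → diff (suc M) f ≗ g → qPoch (suc M) *ₚ f ≗ qPoch M *ₚ g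
      step M f eq m = trans (qPoch-suc-* M f m) (trans (sym (diff-*ʳ (suc M) (qPoch M) f m)) (*ₚ-cong {qPoch M} ≗-refl eq m))

      x+y-y : ∀ x y → x + y - y ≡ x
      x+y-y = solve-∀

      upper-diff : ∀ a b → suc a ℕ.≤ n → b ℕ.≤ n → b ℕ.≤ suc a ℕ.+ c₂ → suc a ℕ.≤ b ℕ.+ c₁ → b ≡ 0 ⊎ suc a ≡ b ℕ.+ c₁ → diff (suc a ℕ.+ b) (C (suc a) b) ≗ C a b
      upper-diff a b a≤n b≤n s₁ s₂ bd m = trans (cong₂ _-_ (count-upper c₁ c₂ n a b m bd) (sym (countFull≡shift c₁ c₂ n a≤n b≤n s₁ s₂ m)))
        (x+y-y (C a b m) (countFull c₁ c₂ n (suc a) b m))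

      lower-diff : ∀ a b → a ℕ.≤ n → suc b ℕ.≤ n → suc b ℕ.≤ a ℕ.+ c₂ → a ℕ.≤ suc b ℕ.+ c₁ → a ≡ 0 ⊎ suc b ≡ a ℕ.+ c₂ → diff (a ℕ.+ suc b) (C a (suc b)) ≗ C a b
      lower-diff a b a≤n b≤n s₁ s₂ bd m = trans (cong₂ _-_ (count-lower c₁ c₂ n a b m bd) (sym (countFull≡shift c₁ c₂ n a≤n b≤n s₁ s₂ m)))
        (x+y-y (C a b m) (countFull c₁ c₂ n a (suc b) m))

      solve-rec : ∀ x y p q e → x + y ≡ p + q + e → x - e ≡ p + q - y
      solve-rec x y p q e eq = trans (l₁ x y e) (trans (cong (λ z → z - y - e) eq) (l₂ p q e y))
        where
        l₁ : ∀ x y e → x - e ≡ x + y - y - e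
        l₁ = solve-∀
        l₂ : ∀ p q e y → p + q + e - y - e ≡ p + q - y
        l₂ = solve-∀

      interior-diff : ∀ a b → suc a ℕ.≤ n → suc b ℕ.≤ n → suc b ℕ.≤ suc a ℕ.+ c₂ → suc a ℕ.≤ suc b ℕ.+ c₁ →
        diff (suc a ℕ.+ suc b) (C (suc a) (suc b)) ≗ (C a (suc b) +ₚ C (suc a) b) -ₚ C a b
      interior-diff a b a≤n b≤n s₁ s₂ m = trans (cong (λ z → C (suc a) (suc b) m - z) (sym (countFull≡shift c₁ c₂ n a≤n b≤n s₁ s₂ m)))
        (solve-rec (C (suc a) (suc b) m) (C a b m) (C a (suc b) m) (C (suc a) b m) (countFull c₁ c₂ n (suc a) (suc b) m) (count-interior c₁ c₂ n a b m))

      *ₚ-distrib-- : ∀ W f g h → W *ₚ ((f +ₚ g) -ₚ h) ≗ ((W *ₚ f) +ₚ (W *ₚ g)) -ₚ (W *ₚ h)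
      *ₚ-distrib-- W f g h m = trans (*ₚ-distribˡ W (f +ₚ g) (negₚ h) m)
        (cong₂ _+_ (*ₚ-distribˡ W f g m) (trans (*ₚ-comm W (negₚ h) m) (trans (neg-*ˡ h W m) (cong -_ (*ₚ-comm h W m)))))

      rec : ∀ a b m → 𝓗 (suc a) (suc b) m ≡ 𝓗 a (suc b) m + 𝓗 (suc a) b m - diff (suc (a ℕ.+ b)) (𝓗 a b) m
      rec a b m = H-rec {K} {+ i} i≥1ℤ K≥2i B (+ suc a) (+ suc b) (suc (a ℕ.+ b)) m (λ ()) (cong +_ (ℕₚ.+-suc a b))

      y+x-y : ∀ x y → y + x - y ≡ x
      y+x-y = solve-∀

      -- The neighbour (a+1, b) lies just outside the strip, and by `H-upper` its value cancels the
      -- difference term; this mirrors the single term of `count-upper`.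
      upper-rec : ∀ a b m → suc a ≡ suc b ℕ.+ c₁ → suc b ℕ.≤ n → 𝓗 (suc a) (suc b) m ≡ 𝓗 a (suc b) m
      upper-rec a b m eq b≤n = trans (rec a b m) (trans (cong (λ z → 𝓗 a (suc b) m + z - diff (suc (a ℕ.+ b)) (𝓗 a b) m)
          (H-upper {K} {+ i} i≥1ℤ K≥2i B (+ suc a) (+ b) (suc (a ℕ.+ b)) m a≡ refl (nn-≡ (ℤₚ.i≤j⇒0≤j-i (+≤+ (ℕₚ.≤-trans b≤n (ℕₚ.<⇒≤ n<B)))) (l₂ (+ B) (+ b))) (nn b)))
        (x+y-y (𝓗 a (suc b) m) (diff (suc (a ℕ.+ b)) (𝓗 a b) m)))
        where
        l₁ : ∀ b K i → 1ℤ + b + (K - i - 1ℤ) ≡ b + K - i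
        l₁ = solve-∀
        l₂ : ∀ B b → B - (1ℤ + b) ≡ B - b - 1ℤ
        l₂ = solve-∀
        a≡ : + suc a ≡ + b + K - + i
        a≡ = trans (cong +_ eq) (trans (cong (λ z → + suc b + z) (sym c₁≡)) (l₁ (+ b) K (+ i)))

      lower-rec : ∀ a b m → suc b ≡ suc a ℕ.+ c₂ → 𝓗 (suc a) (suc b) m ≡ 𝓗 (suc a) b m
      lower-rec a b m eq = trans (rec a b m) (trans (cong (λ z → z + 𝓗 (suc a) b m - diff (suc (a ℕ.+ b)) (𝓗 a b) m)
          (H-lower {K} {+ i} i≥1ℤ K≥2i B (+ a) (+ suc b) (suc (a ℕ.+ b)) m b≡ (cong +_ (ℕₚ.+-suc a b))))
        (y+x-y (𝓗 (suc a) b m) (diff (suc (a ℕ.+ b)) (𝓗 a b) m)))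
        where
        b≡ : + suc b ≡ + a + + i
        b≡ = cong +_ (trans eq (trans (sym (ℕₚ.+-suc a c₂)) (cong (a ℕ.+_) c₂+1)))

      axis₁ : ∀ a m → a ℕ.≤ c₁ → 𝓗 a 0 m ≡ 1ₚ m
      axis₁ a m a≤ = H-axis₁ {K} {+ i} i≥1ℤ K≥2i B a m (nn-≡ (ℤₚ.i≤j⇒0≤j-i (+≤+ a≤)) (cong (_- + a) (sym c₁≡)))

      axis₂ : ∀ b m → b ℕ.≤ c₂ → 𝓗 0 b m ≡ 1ₚ m
      axis₂ b m b≤ = H-axis₂ {K} {+ i} i≥1ℤ K≥2i B b m (nn-≡ (ℤₚ.i≤j⇒0≤j-i (+≤+ b≤)) (cong (_- + b) (sym c₂≡)))

    -- The case distinction follows the counting side: axes, the two edges of the strip, interior.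
    -- The interior recurrence refers to both neighbours, which remain in the strip exactly off the
    -- edges.
    qPoch-count : ∀ a b → a ℕ.≤ n → b ℕ.≤ n → b ℕ.≤ a ℕ.+ c₂ → a ℕ.≤ b ℕ.+ c₁ → qPoch (a ℕ.+ b) *ₚ count c₁ c₂ n a b ≗ H K (+ i) B (+ a) (+ b)
    qPoch-count zero zero _ _ _ _ m = trans (*ₚ-identityˡ (C 0 0) m) (trans (count-00 c₁ c₂ n m) (sym (axis₁ 0 m z≤n)))
    qPoch-count (suc a) zero a≤n b≤n s₁ s₂ m = trans (step (a ℕ.+ 0) (C (suc a) 0) (upper-diff a 0 a≤n b≤n s₁ s₂ (inj₁ refl)) m)
      (trans (qPoch-count a 0 (ℕₚ.<⇒≤ a≤n) b≤n z≤n (ℕₚ.<⇒≤ s₂) m) (trans (axis₁ a m (ℕₚ.<⇒≤ s₂)) (sym (axis₁ (suc a) m s₂))))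
    qPoch-count zero (suc b) a≤n b≤n s₁ s₂ m = trans (step b (C 0 (suc b)) (lower-diff 0 b a≤n b≤n s₁ s₂ (inj₁ refl)) m)
      (trans (qPoch-count 0 b a≤n (ℕₚ.<⇒≤ b≤n) (ℕₚ.<⇒≤ s₁) z≤n m) (trans (axis₂ b m (ℕₚ.<⇒≤ s₁)) (sym (axis₂ (suc b) m s₁))))
    qPoch-count (suc a) (suc b) a≤n b≤n s₁ s₂ m with suc a ℕ.≟ suc b ℕ.+ c₁ | suc b ℕ.≟ suc a ℕ.+ c₂
    ... | yes eq | _ = trans (step (a ℕ.+ suc b) (C (suc a) (suc b)) (upper-diff a (suc b) a≤n b≤n s₁ s₂ (inj₂ eq)) m)
          (trans (qPoch-count a (suc b) (ℕₚ.<⇒≤ a≤n) b≤n strip (ℕₚ.<⇒≤ s₂) m) (sym (upper-rec a b m eq b≤n)))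
      where
      strip : suc b ℕ.≤ a ℕ.+ c₂
      -- On this edge a = b + c₁, and c₁ ≥ 1 gives b + 1 ≤ a, so the neighbour (a, b+1) is still in
      -- the strip.
      strip = ℕₚ.≤-trans (subst (suc b ℕ.≤_) (sym (ℕₚ.suc-injective eq)) (subst (ℕ._≤ b ℕ.+ c₁) (ℕₚ.+-comm b 1) (ℕₚ.+-monoʳ-≤ b c₁≥1))) (ℕₚ.m≤m+n a c₂)
    ... | no _ | yes eq = trans (*ₚ-cong {g = C (suc a) (suc b)} (λ m → cong (λ N → qPoch (suc N) m) (ℕₚ.+-suc a b)) ≗-refl m)
          (trans (step (suc (a ℕ.+ b)) (C (suc a) (suc b)) (λ m → trans (cong (λ N → diff (suc N) (C (suc a) (suc b)) m) (sym (ℕₚ.+-suc a b))) (lower-diff (suc a) b a≤n b≤n s₁ s₂ (inj₂ eq) m)) m)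
          (trans (qPoch-count (suc a) b a≤n (ℕₚ.<⇒≤ b≤n) (ℕₚ.<⇒≤ s₁) strip m) (sym (lower-rec a b m eq))))
      where
      strip : suc a ℕ.≤ b ℕ.+ c₁
      strip = subst (λ b → suc a ℕ.≤ b ℕ.+ c₁) (sym (ℕₚ.suc-injective eq)) (ℕₚ.≤-trans (subst (ℕ._≤ a ℕ.+ c₁) (ℕₚ.+-comm a 1) (ℕₚ.+-monoʳ-≤ a c₁≥1)) (ℕₚ.+-monoˡ-≤ c₁ (ℕₚ.m≤m+n a c₂)))
    ... | no ¬upper | no ¬lower = begin
        (qPoch (suc (a ℕ.+ suc b)) *ₚ C (suc a) (suc b)) m
          ≡⟨ step (a ℕ.+ suc b) (C (suc a) (suc b)) (interior-diff a b a≤n b≤n s₁ s₂) m ⟩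
        (qPoch (a ℕ.+ suc b) *ₚ ((C a (suc b) +ₚ C (suc a) b) -ₚ C a b)) m
          ≡⟨ *ₚ-distrib-- (qPoch (a ℕ.+ suc b)) (C a (suc b)) (C (suc a) b) (C a b) m ⟩
        (qPoch (a ℕ.+ suc b) *ₚ C a (suc b)) m + (qPoch (a ℕ.+ suc b) *ₚ C (suc a) b) m - (qPoch (a ℕ.+ suc b) *ₚ C a b) m
          ≡⟨ cong₂ _-_ (cong₂ _+_ (qPoch-count a (suc b) (ℕₚ.<⇒≤ a≤n) b≤n sb≤ (ℕₚ.<⇒≤ s₂) m)
               (trans (cong (λ N → (qPoch N *ₚ C (suc a) b) m) (ℕₚ.+-suc a b)) (qPoch-count (suc a) b a≤n (ℕₚ.<⇒≤ b≤n) (ℕₚ.<⇒≤ s₁) sa≤ m)))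
               (trans (cong (λ N → (qPoch N *ₚ C a b) m) (ℕₚ.+-suc a b)) (trans (qPoch-suc-* (a ℕ.+ b) (C a b) m)
                 (diff-cong (suc (a ℕ.+ b)) (qPoch-count a b (ℕₚ.<⇒≤ a≤n) (ℕₚ.<⇒≤ b≤n) (ℕₚ.<⇒≤ sb≤) (ℕₚ.<⇒≤ sa≤)) m))) ⟩
        𝓗 a (suc b) m + 𝓗 (suc a) b m - diff (suc (a ℕ.+ b)) (𝓗 a b) m
          ≡⟨ sym (rec a b m) ⟩
        𝓗 (suc a) (suc b) m ∎
      where
      open ≡-Reasoning
      sa≤ : suc a ℕ.≤ b ℕ.+ c₁
      sa≤ = ℕₚ.≤-pred (ℕₚ.≤∧≢⇒< s₂ ¬upper)
      sb≤ : suc b ℕ.≤ a ℕ.+ c₂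
      sb≤ = ℕₚ.≤-pred (ℕₚ.≤∧≢⇒< s₁ ¬lower)

  CP≡RHS : ∀ k i n → 1 ℕ.≤ i → i ℕ.≤ k → CP (2 ℕ.* k ∸ i) (i ∸ 1) n ≗ invₚ (qPoch (2 ℕ.* n)) *ₚ RHS k i n
  CP≡RHS k i n i≥1 i≤k = invₚ-cancel (qPoch (2 ℕ.* n)) (qPoch-const (2 ℕ.* n)) (λ m → begin
    (qPoch (2 ℕ.* n) *ₚ CP c₁ c₂ n) m
      ≡⟨ *ₚ-cong (λ m → cong (λ N → qPoch (n ℕ.+ N) m) (ℕₚ.+-identityʳ n)) (CP≡count c₁ c₂ n) m ⟩
    (qPoch (n ℕ.+ n) *ₚ count c₁ c₂ n n n) m
      -- The cutoff m + n + 1 exceeds n, as the edge relation requires, and is at least m, as the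
      -- comparison with `RHS` requires.
      ≡⟨ qPoch-count k i n i≥1 i≤k (suc (m ℕ.+ n)) (s≤s (ℕₚ.m≤n+m n m)) n n ℕₚ.≤-refl ℕₚ.≤-refl (ℕₚ.m≤m+n n c₂) (ℕₚ.m≤m+n n c₁) m ⟩
    H (+ (2 ℕ.* k ℕ.+ 1)) (+ i) (suc (m ℕ.+ n)) (+ n) (+ n) m
      ≡⟨ sym (RHS≡H k i n i≥1 i≤k (suc (m ℕ.+ n)) m (ℕₚ.m≤n⇒m≤1+n (ℕₚ.m≤m+n m n))) ⟩
    RHS k i n m ∎)
    where
    open ≡-Reasoning
    c₁ = 2 ℕ.* k ∸ i
    c₂ = i ∸ 1

open FermionicSide using (LHS≡RHS)
open CylindricFormula using (CP≡RHS)
open import Data.Nat using (ℕ; _≤_; _∸_; _*_)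
open import Relation.Binary.PropositionalEquality using (_≡_)
open import Data.Sum using (_⊎_)
open import Data.Product using (_×_)

theorem1p4 : (k i n : ℕ) → (k ≡ 2 ⊎ k ≡ 3 ⊎ k ≡ 4) → 1 ≤ i → i ≤ k →
    ((m : ℕ) → LHS k i n m ≡ RHS k i n m)
    × ((k ≡ 2 ⊎ k ≡ 3) → (i ≡ 1 ⊎ i ≡ 2) →
       (m : ℕ) → CP (2 * k ∸ i) (i ∸ 1) n m ≡ (invₚ (qPoch (2 * n)) *ₚ RHS k i n) m)
theorem1p4 k i n k∈ i≥1 i≤k =
  (λ m → LHS≡RHS k i n m k∈ i≥1 i≤k) , (λ _ _ → CP≡RHS k i n i≥1 i≤k)
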